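{- The critical exponent of Kimberling's infinite word ${\bf B}$ is $2+\frac{1}{\psi-1}=3.19148788395\cdots$, where $\psi$ is the real zero of $X^3-X^2-X-1$.
   Context: Definition of ${\bf B}$: Let $B_0=00$. Given a binary word $B_i$, factor it into blocks: each letter $1$ is a block by itself, and each maximal run of consecutive $0$'s is a block, which is either $0$ or $00$ (runs of three or more $0$'s never occur). Then $B_{i+1}$ is obtained by replacing each block $0$ by $0$, each block $1$ by $10$, and each block $00$ by $0101$. For example $B_1=0101$, $B_2=010010$, $B_3=0100101100$. For $i\ge 2$, $B_i$ is a prefix of $B_{i+1}$, and ${\bf B}=0100101100\cdots$ is the unique infinite word having all $B_i$, $i\ge 2$, as prefixes. A finite word $w=w[1..n]$ has period $p\ge 1$ if $w[i]=w[i+p]$ for all $1\le i\le n-p$; the smallest positive period is denoted $\mathrm{per}(w)$. The exponent of a finite nonempty word $w$ is $\exp(w)=|w|/\mathrm{per}(w)$. The critical exponent of an infinite word ${\bf x}$ is $\sup\{\exp(w): w \text{ is a nonempty factor of } {\bf x}\}$, where a factor is a finite contiguous block of letters. -}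

module Defs where

open import Data.Fin using (Fin; zero; suc; toℕ; fromℕ<)
open import Data.Fin.Patterns using (0F; 1F)
open import Data.Fin.Properties using (toℕ-fromℕ<; toℕ<n)
open import Data.Integer using (+_)
open import Data.List using (List; []; _∷_; _++_; length; lookup; concatMap)
open import Data.List.Relation.Binary.Prefix.Heterogeneous using (Prefix; []; _∷_)
open import Data.Nat as ℕ using (ℕ; zero; suc; NonZero; z≤n; s≤s)
import Data.Nat.Properties as ℕP
open import Data.Product using (∃; ∃-syntax; _×_; _,_; proj₁; proj₂)
open import Data.Rational as ℚ using (ℚ; 0ℚ; 1ℚ; ∣_∣)
import Data.Rational.Properties as ℚP
open import Data.Rational.Solver using (module +-*-Solver)
open import Data.Sum using (_⊎_; inj₁; inj₂)
open import Relation.Binary.PropositionalEquality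
open import Relation.Nullary using (yes; no; contradiction)

------------------------------------------------------------------------
-- Words

Letter : Set
Letter = Fin 2

Word : Set
Word = List Letter

InfiniteWord : Set
InfiniteWord = ℕ → Letter

-- Positions are counted from 0.
OccursAt : ℕ → Word → InfiniteWord → Set
OccursAt i w x = ∀ (j : Fin (length w)) → lookup w j ≡ x (i ℕ.+ toℕ j)

IsPrefixOf : Word → InfiniteWord → Set
IsPrefixOf w x = OccursAt 0 w x

IsFactorOf : Word → InfiniteWord → Set
IsFactorOf w x = ∃[ i ] OccursAt i w x

HasPeriod : Word → ℕ → Set
HasPeriod w p = NonZero p ×
  (∀ (i j : Fin (length w)) → toℕ j ≡ toℕ i ℕ.+ p → lookup w i ≡ lookup w j)

record IsPer (w : Word) (p : ℕ) : Set where
  field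
    period  : HasPeriod w p
    minimal : ∀ q → HasPeriod w q → p ℕ.≤ q

-- "q is the exponent of w".
IsExp : Word → ℚ → Set
IsExp w q = ∃[ p ] ∃ λ (per : IsPer w p) →
  q ≡ ℚ._/_ (+ length w) p {{proj₁ (IsPer.period per)}}

IsExpOfFactor : InfiniteWord → ℚ → Set
IsExpOfFactor x q = ∃[ w ] w ≢ [] × IsFactorOf w x × IsExp w q

------------------------------------------------------------------------
-- Kimberling's word

data Block : Set where
  ⟨0⟩ ⟨1⟩ ⟨00⟩ : Block

-- The Bᵢ contain no run of three 0's; on such a run, the parsing below would
-- cut off blocks 00 from the left.
blocks : Word → List Block
blocks []             = []
blocks (1F ∷ w)       = ⟨1⟩ ∷ blocks w
blocks (0F ∷ [])      = ⟨0⟩ ∷ []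
blocks (0F ∷ 1F ∷ w)  = ⟨0⟩ ∷ ⟨1⟩ ∷ blocks w
blocks (0F ∷ 0F ∷ w)  = ⟨00⟩ ∷ blocks w

image : Block → Word
image ⟨0⟩  = 0F ∷ []
image ⟨1⟩  = 1F ∷ 0F ∷ []
image ⟨00⟩ = 0F ∷ 1F ∷ 0F ∷ 1F ∷ []

step : Word → Word
step w = concatMap image (blocks w)

B : ℕ → Word
B zero    = 0F ∷ 0F ∷ []
B (suc i) = step (B i)

infix 4 _⊑_
_⊑_ : Word → Word → Set
_⊑_ = Prefix _≡_

⊑-refl : ∀ w → w ⊑ w
⊑-refl []      = []
⊑-refl (a ∷ w) = refl ∷ ⊑-refl w

⊑-trans : ∀ {u v w} → u ⊑ v → v ⊑ w → u ⊑ w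
⊑-trans []         _          = []
⊑-trans (refl ∷ p) (refl ∷ q) = refl ∷ ⊑-trans p q

step-mono : ∀ {u v} → u ⊑ v → step u ⊑ step v
step-mono []                                       = []
step-mono {1F ∷ _}      (refl ∷ p)                 = refl ∷ refl ∷ step-mono p
step-mono {0F ∷ []}     {_ ∷ []}      (refl ∷ [])  = refl ∷ []
step-mono {0F ∷ []}     {_ ∷ 0F ∷ _}  (refl ∷ [])  = refl ∷ []
step-mono {0F ∷ []}     {_ ∷ 1F ∷ _}  (refl ∷ [])  = refl ∷ []
step-mono {0F ∷ 0F ∷ _} (refl ∷ refl ∷ p)          =
  refl ∷ refl ∷ refl ∷ refl ∷ step-mono p
step-mono {0F ∷ 1F ∷ _} (refl ∷ refl ∷ p)          =
  refl ∷ refl ∷ refl ∷ step-mono p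

B-⊑-suc : ∀ i → B (2 ℕ.+ i) ⊑ B (3 ℕ.+ i)
B-⊑-suc zero    = refl ∷ refl ∷ refl ∷ refl ∷ refl ∷ refl ∷ []
B-⊑-suc (suc i) = step-mono (B-⊑-suc i)

B-⊑-+ : ∀ i k → B (2 ℕ.+ i) ⊑ B (2 ℕ.+ (k ℕ.+ i))
B-⊑-+ i zero    = ⊑-refl _
B-⊑-+ i (suc k) = ⊑-trans (B-⊑-+ i k) (B-⊑-suc (k ℕ.+ i))

B-⊑ : ∀ {i j} → i ℕ.≤ j → B (2 ℕ.+ i) ⊑ B (2 ℕ.+ j)
B-⊑ {i} {j} i≤j = subst (λ m → B (2 ℕ.+ i) ⊑ B (2 ℕ.+ m)) (ℕP.m∸n+n≡m i≤j)
                        (B-⊑-+ i (j ℕ.∸ i))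

length-step : ∀ w → length w ℕ.≤ length (step w)
length-step []            = z≤n
length-step (1F ∷ w)      = s≤s (ℕP.m≤n⇒m≤1+n (length-step w))
length-step (0F ∷ [])     = s≤s z≤n
length-step (0F ∷ 1F ∷ w) = s≤s (s≤s (ℕP.m≤n⇒m≤1+n (length-step w)))
length-step (0F ∷ 0F ∷ w) =
  s≤s (s≤s (ℕP.m≤n⇒m≤1+n (ℕP.m≤n⇒m≤1+n (length-step w))))

length-step-< : ∀ w → (0F ∷ 1F ∷ []) ⊑ w → length w ℕ.< length (step w)
length-step-< (_ ∷ _ ∷ w) (refl ∷ refl ∷ []) = s≤s (s≤s (s≤s (length-step w)))

length-B : ∀ i → i ℕ.< length (B (2 ℕ.+ i))
length-B zero    = s≤s z≤n
length-B (suc i) = ℕP.≤-<-trans (length-B i)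
  (length-step-< (B (2 ℕ.+ i)) (⊑-trans (refl ∷ refl ∷ []) (B-⊑ {0} {i} z≤n)))

𝐁 : InfiniteWord
𝐁 n = lookup (B (2 ℕ.+ n)) (fromℕ< (length-B n))

⊑-lookup : ∀ {u v} → u ⊑ v → (i : Fin (length u)) (j : Fin (length v)) →
           toℕ i ≡ toℕ j → lookup u i ≡ lookup v j
⊑-lookup (refl ∷ _) zero    zero    _ = refl
⊑-lookup (_ ∷ p)    (suc i) (suc j) e = ⊑-lookup p i j (ℕP.suc-injective e)

-- 𝐁 is the unique infinite word having all Bᵢ, i ≥ 2, as prefixes.
𝐁-prefixes : ∀ i → 2 ℕ.≤ i → IsPrefixOf (B i) 𝐁
𝐁-prefixes (suc (suc i)) (s≤s (s≤s z≤n)) j with ℕP.≤-total i (toℕ j)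
... | inj₁ i≤j = ⊑-lookup (B-⊑ i≤j) j _ (sym (toℕ-fromℕ< (length-B (toℕ j))))
... | inj₂ j≤i = sym (⊑-lookup (B-⊑ j≤i) _ j (toℕ-fromℕ< (length-B (toℕ j))))

𝐁-unique : ∀ x → (∀ i → 2 ℕ.≤ i → IsPrefixOf (B i) x) → ∀ n → x n ≡ 𝐁 n
𝐁-unique x h n = begin
  x n                           ≡⟨ cong x (toℕ-fromℕ< (length-B n)) ⟨
  x (toℕ (fromℕ< (length-B n))) ≡⟨ h (2 ℕ.+ n) (s≤s (s≤s z≤n)) _ ⟨
  𝐁 n                           ∎
  where open ≡-Reasoning

------------------------------------------------------------------------
-- Real numbers, as Cauchy sequences of rationals up to _≃ℝ_

record ℝ : Set where
  constructor mkℝ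
  field
    seq    : ℕ → ℚ
    cauchy : ∀ ε → 0ℚ ℚ.< ε →
             ∃[ N ] ∀ m n → N ℕ.≤ m → N ℕ.≤ n → ∣ seq m ℚ.- seq n ∣ ℚ.< ε
open ℝ public

infix 4 _≃ℝ_ _≤ℝ_ _<ℝ_ _#ℝ_

_≃ℝ_ : ℝ → ℝ → Set
x ≃ℝ y = ∀ ε → 0ℚ ℚ.< ε → ∃[ N ] ∀ n → N ℕ.≤ n → ∣ seq x n ℚ.- seq y n ∣ ℚ.< ε

_≤ℝ_ : ℝ → ℝ → Set
x ≤ℝ y = ∀ ε → 0ℚ ℚ.< ε → ∃[ N ] ∀ n → N ℕ.≤ n → seq x n ℚ.≤ seq y n ℚ.+ ε

_<ℝ_ : ℝ → ℝ → Set
x <ℝ y = ∃[ ε ] 0ℚ ℚ.< ε × ∃[ N ] ∀ n → N ℕ.≤ n → seq x n ℚ.+ ε ℚ.≤ seq y n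

_#ℝ_ : ℝ → ℝ → Set
x #ℝ y = x <ℝ y ⊎ y <ℝ x

fromℚ : ℚ → ℝ
fromℚ q = mkℝ (λ _ → q) λ ε 0<ε → 0 , λ _ _ _ _ →
  subst (ℚ._< ε) (cong ∣_∣ (sym (ℚP.+-inverseʳ q))) 0<ε

0ℝ 1ℝ : ℝ
0ℝ = fromℚ 0ℚ
1ℝ = fromℚ 1ℚ

0<pos : ∀ {p} → 0ℚ ℚ.< p → ℚ.Positive p
0<pos = ℚ.positive

0<* : ∀ {p q} → 0ℚ ℚ.< p → 0ℚ ℚ.< q → 0ℚ ℚ.< p ℚ.* q
0<* {p} {q} 0<p 0<q = ℚP.positive⁻¹ (p ℚ.* q)
  {{ℚP.pos*pos⇒pos p {{0<pos 0<p}} q {{0<pos 0<q}}}}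

recip : ∀ {p} → 0ℚ ℚ.< p → ∃[ r ] 0ℚ ℚ.< r × p ℚ.* r ≡ 1ℚ
recip {p} 0<p = r , ℚP.positive⁻¹ r {{ℚP.1/pos⇒pos p}} , ℚP.*-inverseʳ p
  where
  instance
    p⁺ : ℚ.Positive p
    p⁺ = 0<pos 0<p
    p≠0 : ℚ.NonZero p
    p≠0 = ℚP.pos⇒nonZero p
  r = ℚ.1/ p

half-pos : ∀ {ε} → 0ℚ ℚ.< ε → 0ℚ ℚ.< ℚ.½ ℚ.* ε
half-pos = 0<* (ℚP.positive⁻¹ ℚ.½)

half+half : ∀ ε → ℚ.½ ℚ.* ε ℚ.+ ℚ.½ ℚ.* ε ≡ ε
half+half ε = trans (sym (ℚP.*-distribʳ-+ ε ℚ.½ ℚ.½)) (ℚP.*-identityˡ ε)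

∣∣-nonNeg : ∀ p → 0ℚ ℚ.≤ ∣ p ∣
∣∣-nonNeg p = ℚP.nonNegative⁻¹ ∣ p ∣ {{ℚP.∣-∣-nonNeg p}}

*-mono-≤-nonNeg : ∀ {p q r s} → 0ℚ ℚ.≤ r → 0ℚ ℚ.≤ q → p ℚ.≤ q → r ℚ.≤ s →
           p ℚ.* r ℚ.≤ q ℚ.* s
*-mono-≤-nonNeg {p} {q} {r} {s} 0≤r 0≤q p≤q r≤s = ℚP.≤-trans
  (ℚP.*-monoʳ-≤-nonNeg r {{ℚ.nonNegative 0≤r}} p≤q)
  (ℚP.*-monoˡ-≤-nonNeg q {{ℚ.nonNegative 0≤q}} r≤s)

bounded : ∀ x → ∃[ K ] 0ℚ ℚ.< K × ∃[ N ] ∀ n → N ℕ.≤ n → ∣ seq x n ∣ ℚ.≤ K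
bounded x with cauchy x 1ℚ (ℚP.positive⁻¹ 1ℚ)
... | N , h = 1ℚ ℚ.+ ∣ seq x N ∣
            , ℚP.+-mono-<-≤ (ℚP.positive⁻¹ 1ℚ) (∣∣-nonNeg (seq x N))
            , N , λ n N≤n → begin
  ∣ seq x n ∣                                 ≡⟨ cong ∣_∣ (split (seq x n) (seq x N)) ⟩
  ∣ (seq x n ℚ.- seq x N) ℚ.+ seq x N ∣       ≤⟨ ℚP.∣p+q∣≤∣p∣+∣q∣ (seq x n ℚ.- seq x N) (seq x N) ⟩
  ∣ seq x n ℚ.- seq x N ∣ ℚ.+ ∣ seq x N ∣     ≤⟨ ℚP.+-monoˡ-≤ _ (ℚP.<⇒≤ (h n N N≤n ℕP.≤-refl)) ⟩
  1ℚ ℚ.+ ∣ seq x N ∣                          ∎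
  where
  open ℚP.≤-Reasoning
  open +-*-Solver
  split : ∀ a b → a ≡ (a ℚ.- b) ℚ.+ b
  split = solve 2 (λ a b → a := (a :- b) :+ b) refl

infixl 6 _+ℝ_ _-ℝ_
infixl 7 _*ℝ_
infix  8 -ℝ_
infixr 8 _^ℝ_

_+ℝ_ : ℝ → ℝ → ℝ
x +ℝ y = mkℝ (λ n → seq x n ℚ.+ seq y n) λ ε 0<ε →
  let (M , hx) = cauchy x (ℚ.½ ℚ.* ε) (half-pos 0<ε)
      (N , hy) = cauchy y (ℚ.½ ℚ.* ε) (half-pos 0<ε)
  in M ℕ.⊔ N , λ m n m≥ n≥ → begin-strict
    ∣ (seq x m ℚ.+ seq y m) ℚ.- (seq x n ℚ.+ seq y n) ∣
      ≡⟨ cong ∣_∣ (regroup (seq x m) (seq y m) (seq x n) (seq y n)) ⟩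
    ∣ (seq x m ℚ.- seq x n) ℚ.+ (seq y m ℚ.- seq y n) ∣
      ≤⟨ ℚP.∣p+q∣≤∣p∣+∣q∣ (seq x m ℚ.- seq x n) (seq y m ℚ.- seq y n) ⟩
    ∣ seq x m ℚ.- seq x n ∣ ℚ.+ ∣ seq y m ℚ.- seq y n ∣
      <⟨ ℚP.+-mono-< (hx m n (ℕP.m⊔n≤o⇒m≤o M N m≥) (ℕP.m⊔n≤o⇒m≤o M N n≥))
                     (hy m n (ℕP.m⊔n≤o⇒n≤o M N m≥) (ℕP.m⊔n≤o⇒n≤o M N n≥)) ⟩
    ℚ.½ ℚ.* ε ℚ.+ ℚ.½ ℚ.* ε
      ≡⟨ half+half ε ⟩
    ε ∎
  where
  open ℚP.≤-Reasoning
  open +-*-Solver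
  regroup : ∀ a b c d → (a ℚ.+ b) ℚ.- (c ℚ.+ d) ≡ (a ℚ.- c) ℚ.+ (b ℚ.- d)
  regroup = solve 4 (λ a b c d → (a :+ b) :- (c :+ d) := (a :- c) :+ (b :- d)) refl

-ℝ_ : ℝ → ℝ
-ℝ x = mkℝ (λ n → ℚ.- seq x n) λ ε 0<ε →
  let (N , h) = cauchy x ε 0<ε
  in N , λ m n m≥ n≥ → subst (ℚ._< ε)
       (trans (sym (ℚP.∣-p∣≡∣p∣ (seq x m ℚ.- seq x n)))
              (cong ∣_∣ (ℚP.neg-distrib-+ (seq x m) (ℚ.- seq x n))))
       (h m n m≥ n≥)

_-ℝ_ : ℝ → ℝ → ℝ
x -ℝ y = x +ℝ (-ℝ y)

_*ℝ_ : ℝ → ℝ → ℝ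
x *ℝ y = mkℝ (λ n → seq x n ℚ.* seq y n) λ ε 0<ε →
  let (K , 0<K , Nx , bx)    = bounded x
      (L , 0<L , Ny , by)    = bounded y
      (K⁻¹ , 0<K⁻¹ , KK⁻¹≡1) = recip 0<K
      (L⁻¹ , 0<L⁻¹ , LL⁻¹≡1) = recip 0<L
      δ = ℚ.½ ℚ.* ε
      (M , hx) = cauchy x (L⁻¹ ℚ.* δ) (0<* 0<L⁻¹ (half-pos 0<ε))
      (N , hy) = cauchy y (K⁻¹ ℚ.* δ) (0<* 0<K⁻¹ (half-pos 0<ε))
  in (Nx ℕ.⊔ Ny) ℕ.⊔ (M ℕ.⊔ N) , λ m n m≥ n≥ →
  let m≥₁ = ℕP.m⊔n≤o⇒m≤o (Nx ℕ.⊔ Ny) (M ℕ.⊔ N) m≥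
      m≥₂ = ℕP.m⊔n≤o⇒n≤o (Nx ℕ.⊔ Ny) (M ℕ.⊔ N) m≥
      n≥₁ = ℕP.m⊔n≤o⇒m≤o (Nx ℕ.⊔ Ny) (M ℕ.⊔ N) n≥
      n≥₂ = ℕP.m⊔n≤o⇒n≤o (Nx ℕ.⊔ Ny) (M ℕ.⊔ N) n≥
      a = seq x m ; b = seq y m ; c = seq x n ; d = seq y n
  in begin-strict
    ∣ a ℚ.* b ℚ.- c ℚ.* d ∣
      ≡⟨ cong ∣_∣ (regroup a b c d) ⟩
    ∣ a ℚ.* (b ℚ.- d) ℚ.+ d ℚ.* (a ℚ.- c) ∣
      ≤⟨ ℚP.∣p+q∣≤∣p∣+∣q∣ (a ℚ.* (b ℚ.- d)) (d ℚ.* (a ℚ.- c)) ⟩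
    ∣ a ℚ.* (b ℚ.- d) ∣ ℚ.+ ∣ d ℚ.* (a ℚ.- c) ∣
      ≡⟨ cong₂ ℚ._+_ (ℚP.∣p*q∣≡∣p∣*∣q∣ a (b ℚ.- d)) (ℚP.∣p*q∣≡∣p∣*∣q∣ d (a ℚ.- c)) ⟩
    ∣ a ∣ ℚ.* ∣ b ℚ.- d ∣ ℚ.+ ∣ d ∣ ℚ.* ∣ a ℚ.- c ∣
      <⟨ ℚP.+-mono-<
           (scaled 0<K KK⁻¹≡1 (bx m (ℕP.m⊔n≤o⇒m≤o Nx Ny m≥₁))
             (hy m n (ℕP.m⊔n≤o⇒n≤o M N m≥₂) (ℕP.m⊔n≤o⇒n≤o M N n≥₂)))
           (scaled 0<L LL⁻¹≡1 (by n (ℕP.m⊔n≤o⇒n≤o Nx Ny n≥₁))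
             (hx m n (ℕP.m⊔n≤o⇒m≤o M N m≥₂) (ℕP.m⊔n≤o⇒m≤o M N n≥₂))) ⟩
    δ ℚ.+ δ
      ≡⟨ half+half ε ⟩
    ε ∎
  where
  open ℚP.≤-Reasoning
  open +-*-Solver
  regroup : ∀ a b c d →
    a ℚ.* b ℚ.- c ℚ.* d ≡ a ℚ.* (b ℚ.- d) ℚ.+ d ℚ.* (a ℚ.- c)
  regroup = solve 4 (λ a b c d →
    a :* b :- c :* d := a :* (b :- d) :+ d :* (a :- c)) refl
  scaled : ∀ {K K⁻¹ δ a b} → 0ℚ ℚ.< K → K ℚ.* K⁻¹ ≡ 1ℚ → ∣ a ∣ ℚ.≤ K →
           ∣ b ∣ ℚ.< K⁻¹ ℚ.* δ → ∣ a ∣ ℚ.* ∣ b ∣ ℚ.< δ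
  scaled {K} {K⁻¹} {δ} {a} {b} 0<K KK⁻¹≡1 a≤K b< = begin-strict
    ∣ a ∣ ℚ.* ∣ b ∣   ≤⟨ ℚP.*-monoʳ-≤-nonNeg ∣ b ∣ {{ℚP.∣-∣-nonNeg b}} a≤K ⟩
    K ℚ.* ∣ b ∣       <⟨ ℚP.*-monoʳ-<-pos K {{0<pos 0<K}} b< ⟩
    K ℚ.* (K⁻¹ ℚ.* δ) ≡⟨ ℚP.*-assoc K K⁻¹ δ ⟨
    K ℚ.* K⁻¹ ℚ.* δ   ≡⟨ cong (ℚ._* δ) KK⁻¹≡1 ⟩
    1ℚ ℚ.* δ          ≡⟨ ℚP.*-identityˡ δ ⟩
    δ                 ∎

_^ℝ_ : ℝ → ℕ → ℝ
x ^ℝ zero  = 1ℝ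
x ^ℝ suc n = x *ℝ x ^ℝ n

inv₀ : ℚ → ℚ
inv₀ q with q ℚ.≟ 0ℚ
... | yes _  = 0ℚ
... | no q≢0 = (ℚ.1/ q) {{ℚ.≢-nonZero q≢0}}

inv₀-inverse : ∀ q → q ≢ 0ℚ → q ℚ.* inv₀ q ≡ 1ℚ
inv₀-inverse q q≢0 with q ℚ.≟ 0ℚ
... | yes q≡0 = contradiction q≡0 q≢0
... | no q≢0′ = ℚP.*-inverseʳ q {{ℚ.≢-nonZero q≢0′}}

away : ∀ x → x #ℝ 0ℝ → ∃[ δ ] 0ℚ ℚ.< δ × ∃[ N ] ∀ n → N ℕ.≤ n → δ ℚ.≤ ∣ seq x n ∣
away x (inj₁ (δ , 0<δ , N , h)) = δ , 0<δ , N , λ n N≤n →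
  let s = seq x n
      δ≤-s : δ ℚ.≤ ℚ.- s
      δ≤-s = subst₂ ℚ._≤_ (cancel s δ) (ℚP.+-identityʳ _)
               (ℚP.+-monoʳ-≤ (ℚ.- s) (h n N≤n))
  in ℚP.≤-trans δ≤-s (ℚP.≤-reflexive (trans
       (sym (ℚP.0≤p⇒∣p∣≡p (ℚP.≤-trans (ℚP.<⇒≤ 0<δ) δ≤-s))) (ℚP.∣-p∣≡∣p∣ s)))
  where
  open +-*-Solver
  cancel : ∀ s d → ℚ.- s ℚ.+ (s ℚ.+ d) ≡ d
  cancel = solve 2 (λ s d → :- s :+ (s :+ d) := d) refl
away x (inj₂ (δ , 0<δ , N , h)) = δ , 0<δ , N , λ n N≤n →
  let δ≤s = subst (ℚ._≤ seq x n) (ℚP.+-identityˡ δ) (h n N≤n)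
  in ℚP.≤-trans δ≤s (ℚP.≤-reflexive (sym
       (ℚP.0≤p⇒∣p∣≡p (ℚP.≤-trans (ℚP.<⇒≤ 0<δ) δ≤s))))

inv₀-close : ∀ {δ ε a b} → 0ℚ ℚ.< δ → δ ℚ.≤ ∣ a ∣ → δ ℚ.≤ ∣ b ∣ →
             ∣ a ℚ.- b ∣ ℚ.< δ ℚ.* δ ℚ.* ε → ∣ inv₀ a ℚ.- inv₀ b ∣ ℚ.< ε
inv₀-close {δ} {ε} {a} {b} 0<δ δ≤a δ≤b ab< =
  ℚP.*-cancelˡ-<-nonNeg (δ ℚ.* δ)
    {{ℚP.pos⇒nonNeg (δ ℚ.* δ) {{0<pos (0<* 0<δ 0<δ)}}}} (begin-strict
      δ ℚ.* δ ℚ.* ∣ d ∣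
        ≤⟨ ℚP.*-monoʳ-≤-nonNeg ∣ d ∣ {{ℚP.∣-∣-nonNeg d}}
             (*-mono-≤-nonNeg (ℚP.<⇒≤ 0<δ) (∣∣-nonNeg a) δ≤a δ≤b) ⟩
      ∣ a ∣ ℚ.* ∣ b ∣ ℚ.* ∣ d ∣
        ≡⟨ cong (ℚ._* ∣ d ∣) (ℚP.∣p*q∣≡∣p∣*∣q∣ a b) ⟨
      ∣ a ℚ.* b ∣ ℚ.* ∣ d ∣
        ≡⟨ ℚP.∣p*q∣≡∣p∣*∣q∣ (a ℚ.* b) d ⟨
      ∣ a ℚ.* b ℚ.* d ∣
        ≡⟨ cong ∣_∣ (clear a b (inv₀ a) (inv₀ b)) ⟩
      ∣ b ℚ.* (a ℚ.* inv₀ a) ℚ.- a ℚ.* (b ℚ.* inv₀ b) ∣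
        ≡⟨ cong₂ (λ s t → ∣ b ℚ.* s ℚ.- a ℚ.* t ∣)
             (inv₀-inverse a (nonzero δ≤a)) (inv₀-inverse b (nonzero δ≤b)) ⟩
      ∣ b ℚ.* 1ℚ ℚ.- a ℚ.* 1ℚ ∣
        ≡⟨ cong ∣_∣ (swap a b) ⟩
      ∣ ℚ.- (a ℚ.- b) ∣
        ≡⟨ ℚP.∣-p∣≡∣p∣ (a ℚ.- b) ⟩
      ∣ a ℚ.- b ∣
        <⟨ ab< ⟩
      δ ℚ.* δ ℚ.* ε ∎)
  where
  open ℚP.≤-Reasoning
  open +-*-Solver
  d = inv₀ a ℚ.- inv₀ b
  nonzero : ∀ {c} → δ ℚ.≤ ∣ c ∣ → c ≢ 0ℚ
  nonzero δ≤c refl = ℚP.<-irrefl refl (ℚP.<-≤-trans 0<δ δ≤c)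
  clear : ∀ a b s t → a ℚ.* b ℚ.* (s ℚ.- t) ≡ b ℚ.* (a ℚ.* s) ℚ.- a ℚ.* (b ℚ.* t)
  clear = solve 4 (λ a b s t →
    a :* b :* (s :- t) := b :* (a :* s) :- a :* (b :* t)) refl
  swap : ∀ a b → b ℚ.* 1ℚ ℚ.- a ℚ.* 1ℚ ≡ ℚ.- (a ℚ.- b)
  swap = solve 2 (λ a b →
    b :* con 1ℚ :- a :* con 1ℚ := :- (a :- b)) refl

-- The finitely many terms of x that may vanish are inverted to 0.
invℝ : (x : ℝ) → x #ℝ 0ℝ → ℝ
invℝ x x#0 = mkℝ (λ n → inv₀ (seq x n)) λ ε 0<ε →
  let (δ , 0<δ , M , a) = away x x#0
      (N , h) = cauchy x (δ ℚ.* δ ℚ.* ε) (0<* (0<* 0<δ 0<δ) 0<ε)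
  in M ℕ.⊔ N , λ m n m≥ n≥ → inv₀-close 0<δ
       (a m (ℕP.m⊔n≤o⇒m≤o M N m≥)) (a n (ℕP.m⊔n≤o⇒m≤o M N n≥))
       (h m n (ℕP.m⊔n≤o⇒n≤o M N m≥) (ℕP.m⊔n≤o⇒n≤o M N n≥))

*ℝ-invℝ : ∀ x x#0 → x *ℝ invℝ x x#0 ≃ℝ 1ℝ
*ℝ-invℝ x x#0 ε 0<ε =
  let (δ , 0<δ , M , a) = away x x#0
  in M , λ n n≥ → subst (ℚ._< ε)
       (sym (cong (λ t → ∣ t ℚ.- 1ℚ ∣)
         (inv₀-inverse (seq x n) λ x≡0 → ℚP.<-irrefl refl
           (ℚP.<-≤-trans 0<δ (subst (λ t → δ ℚ.≤ ∣ t ∣) x≡0 (a n n≥))))))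
       0<ε

------------------------------------------------------------------------
-- Critical exponents

-- The constructive supremum; it implies being a least upper bound, and is
-- classically equivalent to it.
record IsSupremum (P : ℚ → Set) (s : ℝ) : Set where
  field
    upperBound  : ∀ q → P q → fromℚ q ≤ℝ s
    approximate : ∀ y → y <ℝ s → ∃[ q ] P q × y <ℝ fromℚ q

IsCriticalExponent : InfiniteWord → ℝ → Set
IsCriticalExponent x = IsSupremum (IsExpOfFactor x)

IsTheZeroOf : (ℝ → ℝ) → ℝ → Set
IsTheZeroOf f x = f x ≃ℝ 0ℝ × (∀ y → f y ≃ℝ 0ℝ → y ≃ℝ x)

{-# OPTIONS --safe #-}

-- 𝐁 is the letter 0 followed by the image under h = π ∘ κ of the Tribonacci
-- word, the fixed point of τ : 0 ↦ 01, 1 ↦ 02, 2 ↦ 0.  A repetition with period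
-- p is a pair of cuts of a word at distance p, and the excess of the maximal
-- repetition through them is the number of letters on which the words to the
-- left and to the right of the two cuts agree.  Two cuts of an image under π, κ
-- or τ either disagree almost at once on both sides, or can be moved together to
-- block boundaries; then they come from two cuts of the preimage, and the excess
-- only grows by a bounded overhang at either end.  Hence a repetition of excess
-- above 2p has period P n = |h (τⁿ 2)| for some n and excess at most S n + 6,
-- where S n = P 1 + ... + P n, and such repetitions with excess S n do occur.
--
-- P satisfies the Tribonacci recurrence, so that 2 S n + 14 = P (n + 2) + P n and
-- the exponents tend to 1 + (ψ² + 1) / 2 = 2 + 1 / (ψ - 1).  Taking
-- ψ = lim P (m + 1) / P m, comparing an exponent with the limit means comparing it
-- with 2 + P m / Q m, Q m = P (m + 1) - P m, for large m.  For fixed n the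
-- difference is a solution of the recurrence in m, and its initial values are
-- minors of P, which satisfy the reciprocal recurrence in n.

module Submission where

open import Defs
open import Data.Fin using (Fin; zero; suc; _≟_; toℕ; fromℕ<)
open import Data.Fin.Patterns using (0F; 1F; 2F)
open import Data.Fin.Properties using (all?; toℕ<n; toℕ-fromℕ<; toℕ-injective)
open import Data.Integer as ℤ using (ℤ)
import Data.Integer.Properties as ℤ
import Data.Integer.Solver as ℤ-Solver
open import Data.List using (List; []; _∷_; _++_; _ʳ++_; reverse; concatMap; length; replicate; lookup; take; drop)
import Data.List.Properties as List
open import Data.List.Relation.Binary.Prefix.Heterogeneous using ([]; _∷_)
import Data.Nat as ℕ
open import Data.Nat using (ℕ)
open import Data.Nat.Induction using (<-rec)
open import Data.Nat.Properties hiding (_≟_)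
open import Data.Nat.Tactic.RingSolver using (solve-∀)
open import Data.Product using (∃; ∃-syntax; _×_; _,_; proj₁; proj₂)
open import Data.Rational as ℚ using (ℚ; 0ℚ; 1ℚ; mkℚ; _/_)
open import Data.Rational.Literals using (fromℤ)
import Data.Rational.Properties as ℚ
import Data.Rational.Solver as ℚ-Solver
open import Data.Rational.Unnormalised as ℚᵘ using (mkℚᵘ; *≡*)
import Data.Rational.Unnormalised.Properties as ℚᵘ
open import Data.Sum using (_⊎_; inj₁; inj₂)
open import Function using (_∘_; const)
open import Relation.Binary.PropositionalEquality
open import Relation.Nullary using (Dec; yes; no; contradiction)
open import Relation.Nullary.Decidable using (_×-dec_; _→-dec_)
open import Relation.Unary using (Decidable)

-- Quadratic and cubic identities for Tribonacci sequences

module Minors where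
  open import Data.Integer using (ℤ; +_; _+_; _-_; _*_)
  open import Data.Integer.Solver using (module +-*-Solver)
  open +-*-Solver

  -- The sign of gap u v s t compares s / (t - s) with (v - u) / 2u.
  gap : ℤ → ℤ → ℤ → ℤ → ℤ
  gap u v s t = + 2 * u * s - (v - u) * (t - s)

  gap′ : ∀ {n} → Polynomial n → Polynomial n → Polynomial n → Polynomial n → Polynomial n
  gap′ u v s t = con (+ 2) :* u :* s :- (v :- u) :* (t :- s)

  module Recurrences (p : ℕ → ℤ) (p-rec : ∀ n → p (3 ℕ.+ n) ≡ p n + p (1 ℕ.+ n) + p (2 ℕ.+ n)) where

    -- Up to sign, `A` and `D` are 2 by 2 minors formed from terms of `p`. By the recurrence, `g₀ n`
    -- and `g₂ n` both equal `- D n`, and `g₁ n` equals `- A n - A (1 + n)`.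
    A D g₀ g₁ g₂ : ℕ → ℤ
    A n = p (1 ℕ.+ n) * p (1 ℕ.+ n) - p n * p (2 ℕ.+ n)
    D n = p (1 ℕ.+ n) * p (2 ℕ.+ n) - p n * p (3 ℕ.+ n)
    g₀ n = gap (p n) (p (2 ℕ.+ n)) (p n) (p (1 ℕ.+ n))
    g₁ n = gap (p n) (p (2 ℕ.+ n)) (p (1 ℕ.+ n)) (p (2 ℕ.+ n))
    g₂ n = gap (p n) (p (2 ℕ.+ n)) (p (2 ℕ.+ n)) (p (3 ℕ.+ n))

    -- The roots of X³ - X² - X - 1 have product 1, so a product of two of them is the inverse of
    -- the third. In a minor the squares of roots cancel and only such products remain, which gives
    -- the recurrence of the reciprocal polynomial. The same holds for `D`, `g₀`, `g₁` and `g₂`.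
    A-rec : ∀ n → A (3 ℕ.+ n) ≡ A n - A (1 ℕ.+ n) - A (2 ℕ.+ n)
    A-rec n = identity (p n) (p (1 ℕ.+ n)) (p-rec n) (p-rec (1 ℕ.+ n)) (p-rec (2 ℕ.+ n))
      where
      identity : ∀ a b {c d e f} → d ≡ a + b + c → e ≡ b + c + d → f ≡ c + d + e →
        e * e - d * f ≡ (b * b - a * c) - (c * c - b * d) - (d * d - c * e)
      identity a b {c} refl refl refl = solve 3 (λ a b c →
          let d = a :+ b :+ c; e = b :+ c :+ d; f = c :+ d :+ e in
          e :* e :- d :* f :=
          (b :* b :- a :* c) :- (c :* c :- b :* d) :- (d :* d :- c :* e)) refl a b c

    D-rec : ∀ n → D (3 ℕ.+ n) ≡ D n - D (1 ℕ.+ n) - D (2 ℕ.+ n)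
    D-rec n = identity (p n) (p (1 ℕ.+ n)) (p-rec n) (p-rec (1 ℕ.+ n)) (p-rec (2 ℕ.+ n)) (p-rec (3 ℕ.+ n))
      where
      identity : ∀ a b {c d e f g} →
        d ≡ a + b + c → e ≡ b + c + d → f ≡ c + d + e → g ≡ d + e + f →
        e * f - d * g ≡ (b * c - a * d) - (c * d - b * e) - (d * e - c * f)
      identity a b {c} refl refl refl refl = solve 3 (λ a b c →
          let d = a :+ b :+ c; e = b :+ c :+ d; f = c :+ d :+ e; g = d :+ e :+ f in
          e :* f :- d :* g :=
          (b :* c :- a :* d) :- (c :* d :- b :* e) :- (d :* e :- c :* f)) refl a b c

    g₀-rec : ∀ n → g₀ (3 ℕ.+ n) ≡ g₀ n - g₀ (1 ℕ.+ n) - g₀ (2 ℕ.+ n)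
    g₀-rec n = identity (p n) (p (1 ℕ.+ n)) (p-rec n) (p-rec (1 ℕ.+ n)) (p-rec (2 ℕ.+ n))
      where
      identity : ∀ a b {c d e f} → d ≡ a + b + c → e ≡ b + c + d → f ≡ c + d + e →
        gap d f d e ≡ gap a c a b - gap b d b c - gap c e c d
      identity a b {c} refl refl refl = solve 3 (λ a b c →
          let d = a :+ b :+ c; e = b :+ c :+ d; f = c :+ d :+ e in
          gap′ d f d e :=
          gap′ a c a b :- gap′ b d b c :- gap′ c e c d) refl a b c

    g₁-rec : ∀ n → g₁ (3 ℕ.+ n) ≡ g₁ n - g₁ (1 ℕ.+ n) - g₁ (2 ℕ.+ n)
    g₁-rec n = identity (p n) (p (1 ℕ.+ n)) (p-rec n) (p-rec (1 ℕ.+ n)) (p-rec (2 ℕ.+ n))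
      where
      identity : ∀ a b {c d e f} → d ≡ a + b + c → e ≡ b + c + d → f ≡ c + d + e →
        gap d f e f ≡ gap a c b c - gap b d c d - gap c e d e
      identity a b {c} refl refl refl = solve 3 (λ a b c →
          let d = a :+ b :+ c; e = b :+ c :+ d; f = c :+ d :+ e in
          gap′ d f e f :=
          gap′ a c b c :- gap′ b d c d :- gap′ c e d e) refl a b c

    g₂-rec : ∀ n → g₂ (3 ℕ.+ n) ≡ g₂ n - g₂ (1 ℕ.+ n) - g₂ (2 ℕ.+ n)
    g₂-rec n = identity (p n) (p (1 ℕ.+ n)) (p-rec n) (p-rec (1 ℕ.+ n)) (p-rec (2 ℕ.+ n)) (p-rec (3 ℕ.+ n))
      where
      identity : ∀ a b {c d e f g} →
        d ≡ a + b + c → e ≡ b + c + d → f ≡ c + d + e → g ≡ d + e + f →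
        gap d f f g ≡ gap a c c d - gap b d d e - gap c e e f
      identity a b {c} refl refl refl refl = solve 3 (λ a b c →
          let d = a :+ b :+ c; e = b :+ c :+ d; f = c :+ d :+ e; g = d :+ e :+ f in
          gap′ d f f g :=
          gap′ a c c d :- gap′ b d d e :- gap′ c e e f) refl a b c

    -- `gap` is linear in its last two arguments taken together.
    gap-rec : ∀ u v n → gap u v (p (3 ℕ.+ n)) (p (4 ℕ.+ n)) ≡
      gap u v (p n) (p (1 ℕ.+ n)) + gap u v (p (1 ℕ.+ n)) (p (2 ℕ.+ n)) + gap u v (p (2 ℕ.+ n)) (p (3 ℕ.+ n))
    gap-rec u v n = identity (p n) (p (1 ℕ.+ n)) (p-rec n) (p-rec (1 ℕ.+ n))
      where
      identity : ∀ a b {c d e} → d ≡ a + b + c → e ≡ b + c + d →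
        gap u v d e ≡ gap u v a b + gap u v b c + gap u v c d
      identity a b {c} refl refl = solve 5 (λ u v a b c →
          let d = a :+ b :+ c; e = b :+ c :+ d in
          gap′ u v d e :=
          gap′ u v a b :+ gap′ u v b c :+ gap′ u v c d) refl u v a b c

    -- The left side is a³ times the value of X³ - X² - X - 1 at b / a. Written through minors it
    -- becomes quadratic in size, since the minors of `P` are later bounded by multiples of `P`.
    cubic : ∀ n → let a = p n; b = p (1 ℕ.+ n) in
      b * b * b - b * b * a - b * a * a - a * a * a ≡ a * D n + (b - a) * A n
    cubic n = identity (p n) (p (1 ℕ.+ n)) (p-rec n)
      where
      identity : ∀ a b {c d} → d ≡ a + b + c →
        b * b * b - b * b * a - b * a * a - a * a * a ≡
        a * (b * c - a * d) + (b - a) * (b * b - a * c)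
      identity a b {c} refl = solve 3 (λ a b c →
          let d = a :+ b :+ c in
          b :* b :* b :- b :* b :* a :- b :* a :* a :- a :* a :* a :=
          a :* (b :* c :- a :* d) :+ (b :- a) :* (b :* b :- a :* c)) refl a b c

open import Data.Nat hiding (_≟_; _/_)

private
  variable
    m n : ℕ

-- Agreement of words and cuts of images

weight : (Fin n → ℕ) → List (Fin n) → ℕ
weight ω []      = 0
weight ω (x ∷ w) = ω x + weight ω w

weight-++ : ∀ (ω : Fin n → ℕ) u v → weight ω (u ++ v) ≡ weight ω u + weight ω v
weight-++ ω []      v = refl
weight-++ ω (x ∷ u) v = trans (cong (ω x +_) (weight-++ ω u v))
                              (sym (+-assoc (ω x) _ _))

weight-ʳ++ : ∀ (ω : Fin n → ℕ) u v → weight ω (u ʳ++ v) ≡ weight ω u + weight ω v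
weight-ʳ++ ω []      v = refl
weight-ʳ++ ω (x ∷ u) v = trans (weight-ʳ++ ω u (x ∷ v))
                               (swap (weight ω u) (ω x) (weight ω v))
  where
  swap : ∀ a b c → a + (b + c) ≡ b + a + c
  swap = solve-∀

weight-reverse : ∀ (ω : Fin n → ℕ) w → weight ω (reverse w) ≡ weight ω w
weight-reverse ω w = trans (weight-ʳ++ ω w []) (+-identityʳ _)

weight-concatMap : ∀ (ω : Fin n → ℕ) (σ : Fin m → List (Fin n)) w →
                   weight ω (concatMap σ w) ≡ weight (weight ω ∘ σ) w
weight-concatMap ω σ []      = refl
weight-concatMap ω σ (a ∷ w) = trans (weight-++ ω (σ a) _)
                                     (cong (weight ω (σ a) +_) (weight-concatMap ω σ w))

weight-length : (w : List (Fin n)) → weight (const 1) w ≡ length w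
weight-length []      = refl
weight-length (x ∷ w) = cong suc (weight-length w)

-- The weight of the longest common prefix, plus a bonus depending on the first
-- pair of distinct letters if there is one.
agree : (Fin n → ℕ) → (Fin n → Fin n → ℕ) → List (Fin n) → List (Fin n) → ℕ
agree ω ε []      t       = 0
agree ω ε (x ∷ s) []      = 0
agree ω ε (x ∷ s) (y ∷ t) with x ≟ y
... | yes _ = ω x + agree ω ε s t
... | no  _ = ε x y

agree-[]ʳ : ∀ (ω : Fin n → ℕ) ε s → agree ω ε s [] ≡ 0
agree-[]ʳ ω ε []      = refl
agree-[]ʳ ω ε (x ∷ s) = refl

agree-∷ : ∀ (ω : Fin n → ℕ) ε x s t →
          agree ω ε (x ∷ s) (x ∷ t) ≡ ω x + agree ω ε s t
agree-∷ ω ε x s t with x ≟ x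
... | yes _ = refl
... | no x≢x = contradiction refl x≢x

agree-++ : ∀ (ω : Fin n → ℕ) ε u s t →
           agree ω ε (u ++ s) (u ++ t) ≡ weight ω u + agree ω ε s t
agree-++ ω ε []      s t = refl
agree-++ ω ε (x ∷ u) s t = begin
  agree ω ε (x ∷ u ++ s) (x ∷ u ++ t)     ≡⟨ agree-∷ ω ε x (u ++ s) (u ++ t) ⟩
  ω x + agree ω ε (u ++ s) (u ++ t)       ≡⟨ cong (ω x +_) (agree-++ ω ε u s t) ⟩
  ω x + (weight ω u + agree ω ε s t)      ≡⟨ +-assoc (ω x) _ _ ⟨
  ω x + weight ω u + agree ω ε s t        ∎
  where open ≡-Reasoning

AgreeBound : (Fin n → ℕ) → (Fin n → Fin n → ℕ) → (Fin m → List (Fin n)) →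
             (Fin m → Fin m → ℕ) → Set
AgreeBound ω ε σ ε′ = ∀ a b s t → a ≢ b →
  agree ω ε (σ a ++ concatMap σ s) (σ b ++ concatMap σ t) ≤ ε′ a b

-- A common prefix has a common image, and `bound` takes over at the first pair of distinct letters.
-- Where one word ends, its image ends too, and no bonus is due on either side.
agree-concatMap : ∀ {ω : Fin n → ℕ} {ε} {σ : Fin m → List (Fin n)} {ε′} →
  AgreeBound ω ε σ ε′ → ∀ s t →
  agree ω ε (concatMap σ s) (concatMap σ t) ≤ agree (weight ω ∘ σ) ε′ s t
agree-concatMap bound [] t = z≤n
agree-concatMap {ω = ω} {ε} {σ} bound (a ∷ s) [] = ≤-reflexive (agree-[]ʳ ω ε (σ a ++ concatMap σ s))
agree-concatMap {ω = ω} {ε} {σ} bound (a ∷ s) (b ∷ t) with a ≟ b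
... | no a≢b = bound a b s t a≢b
... | yes refl = ≤-trans (≤-reflexive (agree-++ ω ε (σ a) _ _))
                         (+-monoʳ-≤ (weight ω (σ a)) (agree-concatMap bound s t))

data Mismatch {n} : List (Fin n) → List (Fin n) → Set where
  []ˡ    : ∀ {t} → Mismatch [] t
  []ʳ    : ∀ {s} → Mismatch s []
  differ : ∀ {x y s t} → x ≢ y → Mismatch (x ∷ s) (y ∷ t)

Mismatch-sym : ∀ {s t : List (Fin n)} → Mismatch s t → Mismatch t s
Mismatch-sym []ˡ = []ʳ
Mismatch-sym []ʳ = []ˡ
Mismatch-sym (differ x≢y) = differ (x≢y ∘ sym)

Mismatch⇒agree≤ : ∀ {ω : Fin n → ℕ} {ε e s t} → (∀ x y → ε x y ≤ e) →
                  Mismatch s t → agree ω ε s t ≤ e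
Mismatch⇒agree≤ ε≤e []ˡ = z≤n
Mismatch⇒agree≤ {ω = ω} {ε} ε≤e ([]ʳ {s}) = ≤-trans (≤-reflexive (agree-[]ʳ ω ε s)) z≤n
Mismatch⇒agree≤ ε≤e (differ {x} {y} x≢y) with x ≟ y
... | yes x≡y = contradiction x≡y x≢y
... | no _    = ε≤e x y

-- A cut of a word is given by the reversed left part and the right part.
data Cut (σ : Fin m → List (Fin n)) (W : List (Fin m)) : List (Fin n) → List (Fin n) → Set where
  edge   : ∀ l s → l ʳ++ s ≡ W → Cut σ W (concatMap (reverse ∘ σ) l) (concatMap σ s)
  inside : ∀ {a c x d y} l s → l ʳ++ (a ∷ s) ≡ W → σ a ≡ (c ∷ x) ++ (d ∷ y) →
           Cut σ W ((c ∷ x) ʳ++ concatMap (reverse ∘ σ) l) ((d ∷ y) ++ concatMap σ s)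

-- Of two prefixes of one word the shorter is a prefix of the longer. Ties fall under the first
-- alternative, so the overlap in the second is nonempty, as needed for a cut strictly inside a
-- block.
++-split : ∀ {A : Set} (u v : List A) {s w} → u ++ s ≡ v ++ w →
           (∃[ u′ ] u ≡ v ++ u′ × u′ ++ s ≡ w) ⊎
           (∃[ d ] ∃[ y ] v ≡ u ++ d ∷ y × s ≡ (d ∷ y) ++ w)
++-split u       []      eq = inj₁ (u , refl , eq)
++-split []      (d ∷ v) eq = inj₂ (d , v , refl , eq)
++-split (x ∷ u) (y ∷ v) eq with List.∷-injective eq
... | refl , eq′ with ++-split u v eq′
...   | inj₁ (u′ , refl , p)   = inj₁ (u′ , refl , p)
...   | inj₂ (d , y , refl , p) = inj₂ (d , y , refl , p)

-- A scan of the preimage from the left: `l` holds the letters whose images already lie wholly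
-- before the cut, and `u` is the rest of the text before it.
cut-from : ∀ (σ : Fin m → List (Fin n)) {W} l w u s → l ʳ++ w ≡ W → u ++ s ≡ concatMap σ w →
           Cut σ W (u ʳ++ concatMap (reverse ∘ σ) l) s
cut-from σ l [] [] [] W≡ refl = edge l [] W≡
cut-from σ l (a ∷ w) u s W≡ eq with ++-split u (σ a) eq
... | inj₁ (u′ , refl , eq′) =
  subst (λ t → Cut σ _ t s)
    (trans (cong (u′ ʳ++_) (sym (List.ʳ++-defn (σ a)))) (sym (List.++-ʳ++ (σ a))))
    (cut-from σ (a ∷ l) w u′ s W≡ eq′)
cut-from σ l (a ∷ w) []      s W≡ eq | inj₂ (d , y , eq₁ , refl) =
  subst (Cut σ _ _) eq′ (edge l (a ∷ w) W≡)
  where eq′ = cong (_++ concatMap σ w) eq₁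
cut-from σ l (a ∷ w) (c ∷ u) s W≡ eq | inj₂ (d , y , eq₁ , refl) =
  inside l w W≡ eq₁

cut : ∀ (σ : Fin m → List (Fin n)) W l s → l ʳ++ s ≡ concatMap σ W → Cut σ W l s
cut σ W l s eq = subst (λ t → Cut σ W t s)
  (trans (List.ʳ++-defn (reverse l)) (trans (List.++-identityʳ _) (List.reverse-involutive l)))
  (cut-from σ [] W (reverse l) s refl (trans (sym (List.ʳ++-defn l)) eq))

-- A pair of cuts can be moved by a common factor to cuts at block boundaries.
data Aligns (σ : Fin m → List (Fin n)) (W : List (Fin m)) :
            List (Fin n) → List (Fin n) → List (Fin n) → List (Fin n) → Set where
  aligned : ∀ l₁ s₁ l₂ s₂ → l₁ ʳ++ s₁ ≡ W → l₂ ʳ++ s₂ ≡ W →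
            Aligns σ W (concatMap (reverse ∘ σ) l₁) (concatMap σ s₁)
                       (concatMap (reverse ∘ σ) l₂) (concatMap σ s₂)
  left    : ∀ x {l₁ s₁ l₂ s₂} → Aligns σ W l₁ (x ∷ s₁) l₂ (x ∷ s₂) →
            Aligns σ W (x ∷ l₁) s₁ (x ∷ l₂) s₂
  right   : ∀ x {l₁ s₁ l₂ s₂} → Aligns σ W (x ∷ l₁) s₁ (x ∷ l₂) s₂ →
            Aligns σ W l₁ (x ∷ s₁) l₂ (x ∷ s₂)

Aligns-sym : ∀ {σ : Fin m → List (Fin n)} {W l₁ s₁ l₂ s₂} →
             Aligns σ W l₁ s₁ l₂ s₂ → Aligns σ W l₂ s₂ l₁ s₁
Aligns-sym (aligned l₁ s₁ l₂ s₂ p q) = aligned l₂ s₂ l₁ s₁ q p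
Aligns-sym (left x A)  = left x (Aligns-sym A)
Aligns-sym (right x A) = right x (Aligns-sym A)

-- Weights stand for lengths of the final binary images, so the distance `p` keeps its value while
-- the cuts are pulled back through the morphisms.
record Cuts (ω : Fin n → ℕ) (W : List (Fin n)) (p : ℕ) : Set where
  field
    {l₁ s₁ l₂ s₂} : List (Fin n)
    cut₁     : l₁ ʳ++ s₁ ≡ W
    cut₂     : l₂ ʳ++ s₂ ≡ W
    distance : weight ω l₁ + p ≡ weight ω l₂

score : ∀ {ω : Fin n → ℕ} {W p} (εᴸ εᴿ : Fin n → Fin n → ℕ) → Cuts ω W p → ℕ
score {ω = ω} εᴸ εᴿ C = agree ω εᴸ l₁ l₂ + agree ω εᴿ s₁ s₂
  where open Cuts C

module _ {ω : Fin n → ℕ} {σ : Fin m → List (Fin n)} {εᴸ εᴿ εᴸ′ εᴿ′}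
         (boundᴸ : AgreeBound ω εᴸ (reverse ∘ σ) εᴸ′) (boundᴿ : AgreeBound ω εᴿ σ εᴿ′) where

  private
    weight-cong : ∀ {f g : Fin m → ℕ} → (∀ a → f a ≡ g a) → ∀ w → weight f w ≡ weight g w
    weight-cong f≡g []      = refl
    weight-cong f≡g (a ∷ w) = cong₂ _+_ (f≡g a) (weight-cong f≡g w)

    agree-cong : ∀ {f g : Fin m → ℕ} {ε} → (∀ a → f a ≡ g a) → ∀ s t → agree f ε s t ≡ agree g ε s t
    agree-cong f≡g []      t  = refl
    agree-cong f≡g (x ∷ s) [] = refl
    agree-cong f≡g (x ∷ s) (y ∷ t) with x ≟ y
    ... | yes _ = cong₂ _+_ (f≡g x) (agree-cong f≡g s t)
    ... | no  _ = refl

    weightᴸ : ∀ l → weight ω (concatMap (reverse ∘ σ) l) ≡ weight (weight ω ∘ σ) l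
    weightᴸ l = trans (weight-concatMap ω _ l) (weight-cong (λ a → weight-reverse ω (σ a)) l)

  -- Moving both cuts across a common letter only transfers its weight from one agreement to the
  -- other and changes both positions equally. Once the cuts are at block boundaries,
  -- `agree-concatMap` applies on each side.
  descend : ∀ {W p l₁ s₁ l₂ s₂} → Aligns σ W l₁ s₁ l₂ s₂ → weight ω l₁ + p ≡ weight ω l₂ →
            ∃ λ (C : Cuts (weight ω ∘ σ) W p) →
              agree ω εᴸ l₁ l₂ + agree ω εᴿ s₁ s₂ ≤ score εᴸ′ εᴿ′ C
  descend {p = p} (aligned l₁ s₁ l₂ s₂ c₁ c₂) d =
    record { l₁ = l₁ ; s₁ = s₁ ; l₂ = l₂ ; s₂ = s₂ ; cut₁ = c₁ ; cut₂ = c₂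
           ; distance = trans (cong (_+ p) (sym (weightᴸ l₁))) (trans d (weightᴸ l₂)) } ,
    +-mono-≤ (≤-trans (agree-concatMap boundᴸ l₁ l₂)
                      (≤-reflexive (agree-cong (λ a → weight-reverse ω (σ a)) l₁ l₂)))
             (agree-concatMap boundᴿ s₁ s₂)
  descend (left x {l₁} {s₁} {l₂} {s₂} A) d
    with C , le ← descend A (+-cancelˡ-≡ (ω x) _ _ (trans (sym (+-assoc (ω x) _ _)) d))
    = C , ≤-trans (≤-reflexive (begin
      agree ω εᴸ (x ∷ l₁) (x ∷ l₂) + agree ω εᴿ s₁ s₂
        ≡⟨ cong (_+ agree ω εᴿ s₁ s₂) (agree-∷ ω εᴸ x l₁ l₂) ⟩
      ω x + agree ω εᴸ l₁ l₂ + agree ω εᴿ s₁ s₂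
        ≡⟨ swap (ω x) (agree ω εᴸ l₁ l₂) (agree ω εᴿ s₁ s₂) ⟩
      agree ω εᴸ l₁ l₂ + (ω x + agree ω εᴿ s₁ s₂)
        ≡⟨ cong (agree ω εᴸ l₁ l₂ +_) (agree-∷ ω εᴿ x s₁ s₂) ⟨
      agree ω εᴸ l₁ l₂ + agree ω εᴿ (x ∷ s₁) (x ∷ s₂) ∎)) le
    where
    open ≡-Reasoning
    swap : ∀ a b c → a + b + c ≡ b + (a + c)
    swap = solve-∀
  descend {p = p} (right x {l₁} {s₁} {l₂} {s₂} A) d
    with C , le ← descend A (trans (+-assoc (ω x) _ _) (cong (ω x +_) d))
    = C , ≤-trans (≤-reflexive (begin
      agree ω εᴸ l₁ l₂ + agree ω εᴿ (x ∷ s₁) (x ∷ s₂)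
        ≡⟨ cong (agree ω εᴸ l₁ l₂ +_) (agree-∷ ω εᴿ x s₁ s₂) ⟩
      agree ω εᴸ l₁ l₂ + (ω x + agree ω εᴿ s₁ s₂)
        ≡⟨ swap (ω x) (agree ω εᴸ l₁ l₂) (agree ω εᴿ s₁ s₂) ⟨
      ω x + agree ω εᴸ l₁ l₂ + agree ω εᴿ s₁ s₂
        ≡⟨ cong (_+ agree ω εᴿ s₁ s₂) (agree-∷ ω εᴸ x l₁ l₂) ⟨
      agree ω εᴸ (x ∷ l₁) (x ∷ l₂) + agree ω εᴿ s₁ s₂ ∎)) le
    where
    open ≡-Reasoning
    swap : ∀ a b c → a + b + c ≡ b + (a + c)
    swap = solve-∀

-- Desubstitution for π, κ and τ

-- A letter of the intermediate alphabet is the number of 0's following a 1.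
π : Fin 3 → Word
π a = 1F ∷ replicate (toℕ a) 0F

-- The first letter is split off, here and in `τ`, so that the image of a variable letter reduces to
-- a cons with a known head; `marked` relies on this.
κ : Fin 3 → List (Fin 3)
κ a = 2F ∷ tail a
  where
  tail : Fin 3 → List (Fin 3)
  tail 0F = 1F ∷ 0F ∷ []
  tail 1F = 1F ∷ []
  tail 2F = []

τ : Fin 3 → List (Fin 3)
τ a = 0F ∷ tail a
  where
  tail : Fin 3 → List (Fin 3)
  tail 0F = 1F ∷ []
  tail 1F = 2F ∷ []
  tail 2F = []

-- `τ a` ends in `rotate a`. Also, after the initial 0 of `τ a` the next letter is `rotate a`: for
-- the letter 2 it is the 0 that opens the following image.
rotate : Fin 3 → Fin 3
rotate 0F = 1F
rotate 1F = 2F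
rotate 2F = 0F

data Cutπ (W : List (Fin 3)) : Word → Word → Set where
  edge : ∀ l s → l ʳ++ s ≡ W → Cutπ W (concatMap (reverse ∘ π) l) (concatMap π s)
  1∣0  : ∀ l s → l ʳ++ (1F ∷ s) ≡ W →
         Cutπ W (1F ∷ concatMap (reverse ∘ π) l) (0F ∷ concatMap π s)
  1∣00 : ∀ l s → l ʳ++ (2F ∷ s) ≡ W →
         Cutπ W (1F ∷ concatMap (reverse ∘ π) l) (0F ∷ 0F ∷ concatMap π s)
  10∣0 : ∀ l s → l ʳ++ (2F ∷ s) ≡ W →
         Cutπ W (0F ∷ 1F ∷ concatMap (reverse ∘ π) l) (0F ∷ concatMap π s)

cutπ : ∀ {W l s} → Cut π W l s → Cutπ W l s
cutπ (edge l s eq) = edge l s eq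
cutπ (inside {0F} {x = []} l s eq ())
cutπ (inside {0F} {x = _ ∷ _} l s eq ())
cutπ (inside {1F} {x = []} l s eq refl) = 1∣0 l s eq
cutπ (inside {1F} {x = _ ∷ []} l s eq ())
cutπ (inside {1F} {x = _ ∷ _ ∷ _} l s eq ())
cutπ (inside {2F} {x = []} l s eq refl) = 1∣00 l s eq
cutπ (inside {2F} {x = _ ∷ []} l s eq refl) = 10∣0 l s eq
cutπ (inside {2F} {x = _ ∷ _ ∷ []} l s eq ())
cutπ (inside {2F} {x = _ ∷ _ ∷ _ ∷ _} l s eq ())

data Cutκ (W : List (Fin 3)) : List (Fin 3) → List (Fin 3) → Set where
  edge : ∀ l s → l ʳ++ s ≡ W → Cutκ W (concatMap (reverse ∘ κ) l) (concatMap κ s)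
  2∣1  : ∀ l s → l ʳ++ (1F ∷ s) ≡ W →
         Cutκ W (2F ∷ concatMap (reverse ∘ κ) l) (1F ∷ concatMap κ s)
  2∣10 : ∀ l s → l ʳ++ (0F ∷ s) ≡ W →
         Cutκ W (2F ∷ concatMap (reverse ∘ κ) l) (1F ∷ 0F ∷ concatMap κ s)
  21∣0 : ∀ l s → l ʳ++ (0F ∷ s) ≡ W →
         Cutκ W (1F ∷ 2F ∷ concatMap (reverse ∘ κ) l) (0F ∷ concatMap κ s)

cutκ : ∀ {W l s} → Cut κ W l s → Cutκ W l s
cutκ (edge l s eq) = edge l s eq
cutκ (inside {2F} {x = []} l s eq ())
cutκ (inside {2F} {x = _ ∷ _} l s eq ())
cutκ (inside {1F} {x = []} l s eq refl) = 2∣1 l s eq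
cutκ (inside {1F} {x = _ ∷ []} l s eq ())
cutκ (inside {1F} {x = _ ∷ _ ∷ _} l s eq ())
cutκ (inside {0F} {x = []} l s eq refl) = 2∣10 l s eq
cutκ (inside {0F} {x = _ ∷ []} l s eq refl) = 21∣0 l s eq
cutκ (inside {0F} {x = _ ∷ _ ∷ []} l s eq ())
cutκ (inside {0F} {x = _ ∷ _ ∷ _ ∷ _} l s eq ())

data Cutτ (W : List (Fin 3)) : List (Fin 3) → List (Fin 3) → Set where
  edge : ∀ l s → l ʳ++ s ≡ W → Cutτ W (concatMap (reverse ∘ τ) l) (concatMap τ s)
  0∣1  : ∀ l s → l ʳ++ (0F ∷ s) ≡ W →
         Cutτ W (0F ∷ concatMap (reverse ∘ τ) l) (1F ∷ concatMap τ s)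
  0∣2  : ∀ l s → l ʳ++ (1F ∷ s) ≡ W →
         Cutτ W (0F ∷ concatMap (reverse ∘ τ) l) (2F ∷ concatMap τ s)

cutτ : ∀ {W l s} → Cut τ W l s → Cutτ W l s
cutτ (edge l s eq) = edge l s eq
cutτ (inside {0F} {x = []} l s eq refl) = 0∣1 l s eq
cutτ (inside {0F} {x = _ ∷ []} l s eq ())
cutτ (inside {0F} {x = _ ∷ _ ∷ _} l s eq ())
cutτ (inside {1F} {x = []} l s eq refl) = 0∣2 l s eq
cutτ (inside {1F} {x = _ ∷ []} l s eq ())
cutτ (inside {1F} {x = _ ∷ _ ∷ _} l s eq ())
cutτ (inside {2F} {x = []} l s eq ())
cutτ (inside {2F} {x = _ ∷ _} l s eq ())

Mismatched : (l₁ s₁ l₂ s₂ : List (Fin n)) → Set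
Mismatched l₁ s₁ l₂ s₂ = Mismatch l₁ l₂ × Mismatch s₁ s₂

⊎-sym : ∀ {σ : Fin m → List (Fin n)} {W l₁ s₁ l₂ s₂} →
  Mismatched l₁ s₁ l₂ s₂ ⊎ Aligns σ W l₁ s₁ l₂ s₂ →
  Mismatched l₂ s₂ l₁ s₁ ⊎ Aligns σ W l₂ s₂ l₁ s₁
⊎-sym (inj₁ (p , q)) = inj₁ (Mismatch-sym p , Mismatch-sym q)
⊎-sym (inj₂ A)       = inj₂ (Aligns-sym A)

marked : ∀ {ρ : Fin m → List (Fin n)} {x y t} → x ≢ y → ∀ s →
         Mismatch (concatMap (λ a → x ∷ ρ a) s) (y ∷ t)
marked x≢y []      = []ˡ
marked x≢y (_ ∷ _) = differ x≢y

-- To the right of a boundary stands 0 or nothing, to the right of an inner cut 1 or 2, so the right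
-- parts always mismatch. On the left an inner cut follows 0, and a boundary follows 0 only after
-- the block τ 2 = 0; then one step to the left reaches two boundaries.
edge-syncτ : ∀ {W} l₁ s₁ {l₂ s₂} → l₁ ʳ++ s₁ ≡ W → Cutτ W l₂ s₂ →
  Mismatched (concatMap (reverse ∘ τ) l₁) (concatMap τ s₁) l₂ s₂ ⊎
  Aligns τ W (concatMap (reverse ∘ τ) l₁) (concatMap τ s₁) l₂ s₂
edge-syncτ l₁ s₁ e₁ (edge l₂ s₂ e₂) = inj₂ (aligned l₁ s₁ l₂ s₂ e₁ e₂)
edge-syncτ [] s₁ e₁ (0∣1 l₂ s₂ e₂) = inj₁ ([]ˡ , marked (λ ()) s₁)
edge-syncτ (0F ∷ l₁) s₁ e₁ (0∣1 l₂ s₂ e₂) = inj₁ (differ (λ ()) , marked (λ ()) s₁)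
edge-syncτ (1F ∷ l₁) s₁ e₁ (0∣1 l₂ s₂ e₂) = inj₁ (differ (λ ()) , marked (λ ()) s₁)
edge-syncτ (2F ∷ l₁) s₁ e₁ (0∣1 l₂ s₂ e₂) =
  inj₂ (left 0F (aligned l₁ (2F ∷ s₁) l₂ (0F ∷ s₂) e₁ e₂))
edge-syncτ [] s₁ e₁ (0∣2 l₂ s₂ e₂) = inj₁ ([]ˡ , marked (λ ()) s₁)
edge-syncτ (0F ∷ l₁) s₁ e₁ (0∣2 l₂ s₂ e₂) = inj₁ (differ (λ ()) , marked (λ ()) s₁)
edge-syncτ (1F ∷ l₁) s₁ e₁ (0∣2 l₂ s₂ e₂) = inj₁ (differ (λ ()) , marked (λ ()) s₁)
edge-syncτ (2F ∷ l₁) s₁ e₁ (0∣2 l₂ s₂ e₂) =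
  inj₂ (left 0F (aligned l₁ (2F ∷ s₁) l₂ (1F ∷ s₂) e₁ e₂))

syncτ : ∀ {W l₁ s₁ l₂ s₂} → Cutτ W l₁ s₁ → Cutτ W l₂ s₂ →
        Mismatched l₁ s₁ l₂ s₂ ⊎ Aligns τ W l₁ s₁ l₂ s₂
syncτ (edge l₁ s₁ e₁) c₂ = edge-syncτ l₁ s₁ e₁ c₂
syncτ c₁ (edge l₂ s₂ e₂) = ⊎-sym (edge-syncτ l₂ s₂ e₂ c₁)
syncτ (0∣1 l₁ s₁ e₁) (0∣1 l₂ s₂ e₂) =
  inj₂ (left 0F (aligned l₁ (0F ∷ s₁) l₂ (0F ∷ s₂) e₁ e₂))
syncτ (0∣1 l₁ s₁ e₁) (0∣2 l₂ s₂ e₂) =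
  inj₂ (left 0F (aligned l₁ (0F ∷ s₁) l₂ (1F ∷ s₂) e₁ e₂))
syncτ (0∣2 l₁ s₁ e₁) (0∣1 l₂ s₂ e₂) =
  inj₂ (left 0F (aligned l₁ (1F ∷ s₁) l₂ (0F ∷ s₂) e₁ e₂))
syncτ (0∣2 l₁ s₁ e₁) (0∣2 l₂ s₂ e₂) =
  inj₂ (left 0F (aligned l₁ (1F ∷ s₁) l₂ (1F ∷ s₂) e₁ e₂))

-- The argument for τ applies with the marker 2 in place of 0. As `κ a` ends in `a`, the last letter
-- before the boundary tells which block to step back over.
edge-syncκ : ∀ {W} l₁ s₁ {l₂ s₂} → l₁ ʳ++ s₁ ≡ W → Cutκ W l₂ s₂ →
  Mismatched (concatMap (reverse ∘ κ) l₁) (concatMap κ s₁) l₂ s₂ ⊎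
  Aligns κ W (concatMap (reverse ∘ κ) l₁) (concatMap κ s₁) l₂ s₂
edge-syncκ l₁ s₁ e₁ (edge l₂ s₂ e₂) = inj₂ (aligned l₁ s₁ l₂ s₂ e₁ e₂)
edge-syncκ [] s₁ e₁ (2∣1 l₂ s₂ e₂) = inj₁ ([]ˡ , marked (λ ()) s₁)
edge-syncκ (0F ∷ l₁) s₁ e₁ (2∣1 l₂ s₂ e₂) = inj₁ (differ (λ ()) , marked (λ ()) s₁)
edge-syncκ (1F ∷ l₁) s₁ e₁ (2∣1 l₂ s₂ e₂) = inj₁ (differ (λ ()) , marked (λ ()) s₁)
edge-syncκ (2F ∷ l₁) s₁ e₁ (2∣1 l₂ s₂ e₂) =
  inj₂ (left 2F (aligned l₁ (2F ∷ s₁) l₂ (1F ∷ s₂) e₁ e₂))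
edge-syncκ [] s₁ e₁ (2∣10 l₂ s₂ e₂) = inj₁ ([]ˡ , marked (λ ()) s₁)
edge-syncκ (0F ∷ l₁) s₁ e₁ (2∣10 l₂ s₂ e₂) = inj₁ (differ (λ ()) , marked (λ ()) s₁)
edge-syncκ (1F ∷ l₁) s₁ e₁ (2∣10 l₂ s₂ e₂) = inj₁ (differ (λ ()) , marked (λ ()) s₁)
edge-syncκ (2F ∷ l₁) s₁ e₁ (2∣10 l₂ s₂ e₂) =
  inj₂ (left 2F (aligned l₁ (2F ∷ s₁) l₂ (0F ∷ s₂) e₁ e₂))
edge-syncκ [] s₁ e₁ (21∣0 l₂ s₂ e₂) = inj₁ ([]ˡ , marked (λ ()) s₁)
edge-syncκ (0F ∷ l₁) s₁ e₁ (21∣0 l₂ s₂ e₂) = inj₁ (differ (λ ()) , marked (λ ()) s₁)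
edge-syncκ (1F ∷ l₁) s₁ e₁ (21∣0 l₂ s₂ e₂) =
  inj₂ (left 1F (left 2F (aligned l₁ (1F ∷ s₁) l₂ (0F ∷ s₂) e₁ e₂)))
edge-syncκ (2F ∷ l₁) s₁ e₁ (21∣0 l₂ s₂ e₂) = inj₁ (differ (λ ()) , marked (λ ()) s₁)

syncκ : ∀ {W l₁ s₁ l₂ s₂} → Cutκ W l₁ s₁ → Cutκ W l₂ s₂ →
        Mismatched l₁ s₁ l₂ s₂ ⊎ Aligns κ W l₁ s₁ l₂ s₂
syncκ (edge l₁ s₁ e₁) c₂ = edge-syncκ l₁ s₁ e₁ c₂
syncκ c₁ (edge l₂ s₂ e₂) = ⊎-sym (edge-syncκ l₂ s₂ e₂ c₁)
syncκ (2∣1 l₁ s₁ e₁) (2∣1 l₂ s₂ e₂) =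
  inj₂ (left 2F (aligned l₁ (1F ∷ s₁) l₂ (1F ∷ s₂) e₁ e₂))
syncκ (2∣1 l₁ s₁ e₁) (2∣10 l₂ s₂ e₂) =
  inj₂ (left 2F (aligned l₁ (1F ∷ s₁) l₂ (0F ∷ s₂) e₁ e₂))
syncκ (2∣10 l₁ s₁ e₁) (2∣10 l₂ s₂ e₂) =
  inj₂ (left 2F (aligned l₁ (0F ∷ s₁) l₂ (0F ∷ s₂) e₁ e₂))
syncκ (21∣0 l₁ s₁ e₁) (21∣0 l₂ s₂ e₂) =
  inj₂ (left 1F (left 2F (aligned l₁ (0F ∷ s₁) l₂ (0F ∷ s₂) e₁ e₂)))
syncκ (2∣1 _ _ _)  (21∣0 _ _ _) = inj₁ (differ (λ ()) , differ (λ ()))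
syncκ (2∣10 _ _ _) (21∣0 _ _ _) = inj₁ (differ (λ ()) , differ (λ ()))
syncκ (2∣10 l₁ s₁ e₁) (2∣1 l₂ s₂ e₂) =
  inj₂ (left 2F (aligned l₁ (0F ∷ s₁) l₂ (1F ∷ s₂) e₁ e₂))
syncκ (21∣0 _ _ _) (2∣1 _ _ _)  = inj₁ (differ (λ ()) , differ (λ ()))
syncκ (21∣0 _ _ _) (2∣10 _ _ _) = inj₁ (differ (λ ()) , differ (λ ()))

common : Word → Word → ℕ
common = agree (const 1) (λ _ _ → 0)

common-sym : ∀ s t → common s t ≡ common t s
common-sym []      []      = refl
common-sym []      (y ∷ t) = refl
common-sym (x ∷ s) []      = refl
common-sym (x ∷ s) (y ∷ t) with x ≟ y | y ≟ x
... | yes _   | yes _   = cong suc (common-sym s t)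
... | yes x≡y | no y≢x  = contradiction (sym x≡y) y≢x
... | no x≢y  | yes y≡x = contradiction (sym y≡x) x≢y
... | no _    | no _    = refl

Mismatch⇒common≡0 : ∀ {s t} → Mismatch s t → common s t ≡ 0
Mismatch⇒common≡0 s≁t = n≤0⇒n≡0 (Mismatch⇒agree≤ (λ _ _ → z≤n) s≁t)

-- Cuts of an image under π need not disagree at once: inside or at the end of a block 100 they may
-- share a single 0 on one side. An excess of 1 is still harmless.
record Short (l₁ s₁ l₂ s₂ : Word) : Set where
  constructor short
  field
    common≤1 : common l₁ l₂ + common s₁ s₂ ≤ 1

private
  mismatched : ∀ {l₁ s₁ l₂ s₂} → Mismatch l₁ l₂ → Mismatch s₁ s₂ → Short l₁ s₁ l₂ s₂
  mismatched l≁ s≁ = short (subst₂ (λ a b → a + b ≤ 1) (sym (Mismatch⇒common≡0 l≁))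
                                   (sym (Mismatch⇒common≡0 s≁)) z≤n)

Short-sym : ∀ {W l₁ s₁ l₂ s₂} → Short l₁ s₁ l₂ s₂ ⊎ Aligns π W l₁ s₁ l₂ s₂ →
            Short l₂ s₂ l₁ s₁ ⊎ Aligns π W l₂ s₂ l₁ s₁
Short-sym {l₁ = l₁} {s₁} {l₂} {s₂} (inj₁ (short p)) =
  inj₁ (short (subst₂ (λ a b → a + b ≤ 1) (common-sym l₁ l₂) (common-sym s₁ s₂) p))
Short-sym (inj₂ A) = inj₂ (Aligns-sym A)

edge-syncπ : ∀ {W} l₁ s₁ {l₂ s₂} → l₁ ʳ++ s₁ ≡ W → Cutπ W l₂ s₂ →
  Short (concatMap (reverse ∘ π) l₁) (concatMap π s₁) l₂ s₂ ⊎
  Aligns π W (concatMap (reverse ∘ π) l₁) (concatMap π s₁) l₂ s₂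
edge-syncπ l₁ s₁ e₁ (edge l₂ s₂ e₂) = inj₂ (aligned l₁ s₁ l₂ s₂ e₁ e₂)
edge-syncπ [] s₁ e₁ (1∣0 l₂ s₂ e₂) = inj₁ (mismatched []ˡ (marked (λ ()) s₁))
edge-syncπ (0F ∷ l₁) s₁ e₁ (1∣0 l₂ s₂ e₂) =
  inj₂ (left 1F (aligned l₁ (0F ∷ s₁) l₂ (1F ∷ s₂) e₁ e₂))
edge-syncπ (1F ∷ l₁) s₁ e₁ (1∣0 l₂ s₂ e₂) = inj₁ (mismatched (differ (λ ())) (marked (λ ()) s₁))
edge-syncπ (2F ∷ l₁) s₁ e₁ (1∣0 l₂ s₂ e₂) = inj₁ (mismatched (differ (λ ())) (marked (λ ()) s₁))
edge-syncπ [] s₁ e₁ (1∣00 l₂ s₂ e₂) = inj₁ (mismatched []ˡ (marked (λ ()) s₁))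
edge-syncπ (0F ∷ l₁) s₁ e₁ (1∣00 l₂ s₂ e₂) =
  inj₂ (left 1F (aligned l₁ (0F ∷ s₁) l₂ (2F ∷ s₂) e₁ e₂))
edge-syncπ (1F ∷ l₁) s₁ e₁ (1∣00 l₂ s₂ e₂) = inj₁ (mismatched (differ (λ ())) (marked (λ ()) s₁))
edge-syncπ (2F ∷ l₁) s₁ e₁ (1∣00 l₂ s₂ e₂) = inj₁ (mismatched (differ (λ ())) (marked (λ ()) s₁))
edge-syncπ [] s₁ e₁ (10∣0 l₂ s₂ e₂) = inj₁ (mismatched []ˡ (marked (λ ()) s₁))
edge-syncπ (0F ∷ l₁) s₁ e₁ (10∣0 l₂ s₂ e₂) = inj₁ (mismatched (differ (λ ())) (marked (λ ()) s₁))
edge-syncπ (1F ∷ l₁) s₁ e₁ (10∣0 l₂ s₂ e₂) =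
  inj₂ (left 0F (left 1F (aligned l₁ (1F ∷ s₁) l₂ (2F ∷ s₂) e₁ e₂)))
edge-syncπ (2F ∷ l₁) s₁ e₁ (10∣0 l₂ s₂ e₂) =
  inj₁ (short (≤-reflexive (cong suc (Mismatch⇒common≡0 (marked {t = concatMap π s₂} (λ ()) s₁)))))

syncπ : ∀ {W l₁ s₁ l₂ s₂} → Cutπ W l₁ s₁ → Cutπ W l₂ s₂ →
        Short l₁ s₁ l₂ s₂ ⊎ Aligns π W l₁ s₁ l₂ s₂
syncπ (edge l₁ s₁ e₁) c₂ = edge-syncπ l₁ s₁ e₁ c₂
syncπ c₁ (edge l₂ s₂ e₂) = Short-sym (edge-syncπ l₂ s₂ e₂ c₁)
syncπ (1∣0 l₁ s₁ e₁) (1∣0 l₂ s₂ e₂) =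
  inj₂ (left 1F (aligned l₁ (1F ∷ s₁) l₂ (1F ∷ s₂) e₁ e₂))
syncπ (1∣0 l₁ s₁ e₁) (1∣00 l₂ s₂ e₂) =
  inj₂ (left 1F (aligned l₁ (1F ∷ s₁) l₂ (2F ∷ s₂) e₁ e₂))
syncπ (1∣00 l₁ s₁ e₁) (1∣00 l₂ s₂ e₂) =
  inj₂ (left 1F (aligned l₁ (2F ∷ s₁) l₂ (2F ∷ s₂) e₁ e₂))
syncπ (10∣0 l₁ s₁ e₁) (10∣0 l₂ s₂ e₂) =
  inj₂ (left 0F (left 1F (aligned l₁ (2F ∷ s₁) l₂ (2F ∷ s₂) e₁ e₂)))
-- The letters to the left are 1 and 0, so the cuts move to the right instead, over the last 0 of
-- their blocks.
syncπ (1∣0 l₁ s₁ e₁) (10∣0 l₂ s₂ e₂) =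
  inj₂ (right 0F (aligned (1F ∷ l₁) s₁ (2F ∷ l₂) s₂ e₁ e₂))
syncπ (1∣00 l₁ s₁ e₁) (1∣0 l₂ s₂ e₂) =
  inj₂ (left 1F (aligned l₁ (2F ∷ s₁) l₂ (1F ∷ s₂) e₁ e₂))
syncπ (10∣0 l₁ s₁ e₁) (1∣0 l₂ s₂ e₂) =
  inj₂ (right 0F (aligned (2F ∷ l₁) s₁ (1F ∷ l₂) s₂ e₁ e₂))
syncπ (1∣00 l₁ s₁ e₁) (10∣0 l₂ s₂ e₂) =
  inj₁ (short (≤-reflexive (cong suc (Mismatch⇒common≡0
    (Mismatch-sym (marked {t = concatMap π s₁} (λ ()) s₂))))))
syncπ (10∣0 l₁ s₁ e₁) (1∣00 l₂ s₂ e₂) =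
  inj₁ (short (≤-reflexive (cong suc (Mismatch⇒common≡0 (marked {t = concatMap π s₂} (λ ()) s₁)))))

-- Excess of the repetitions in images of the Tribonacci word

-- These are the overhangs past two distinct letters. On the left, 10 and 100 share a final 0, and κ
-- preserves last letters. On the right, π gives the common prefix 1 or 10, and κ gives 21 of weight
-- 5 or 2 of weight 3, plus the overhang under π of the letters that follow.
bonusᴸ bonusπ bonusκ : Fin 3 → Fin 3 → ℕ
bonusᴸ 1F 2F = 1
bonusᴸ 2F 1F = 1
bonusᴸ _  _  = 0
bonusπ 1F 2F = 2
bonusπ 2F 1F = 2
bonusπ _  _  = 1
bonusκ 0F 1F = 6
bonusκ 1F 0F = 6
bonusκ _  _  = 5

ω₁ : Fin 3 → ℕ
ω₁ = weight (const 1) ∘ π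

-- `ω n a` is the length of h (τⁿ a).
ω : ℕ → Fin 3 → ℕ
ω zero    = weight ω₁ ∘ κ
ω (suc n) = weight (ω n) ∘ τ

εᴸ εᴿ : ℕ → Fin 3 → Fin 3 → ℕ
εᴸ zero    a b = bonusᴸ a b
εᴸ (suc n) a b = εᴸ n (rotate a) (rotate b)
εᴿ zero    a b = bonusκ a b
εᴿ (suc n) a b = ω n 0F + εᴿ n (rotate a) (rotate b)

boundπᴸ : AgreeBound (const 1) (λ _ _ → 0) (reverse ∘ π) bonusᴸ
boundπᴸ 0F 0F s t a≢a = contradiction refl a≢a
boundπᴸ 0F 1F s t _   = z≤n
boundπᴸ 0F 2F s t _   = z≤n
boundπᴸ 1F 0F s t _   = z≤n
boundπᴸ 1F 1F s t a≢a = contradiction refl a≢a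
boundπᴸ 1F 2F s t _   = ≤-refl
boundπᴸ 2F 0F s t _   = z≤n
boundπᴸ 2F 1F s t _   = ≤-refl
boundπᴸ 2F 2F s t a≢a = contradiction refl a≢a

boundπᴿ : AgreeBound (const 1) (λ _ _ → 0) π bonusπ
boundπᴿ 0F 0F s       t       a≢a = contradiction refl a≢a
boundπᴿ 0F 1F []      t       _   = ≤-refl
boundπᴿ 0F 1F (_ ∷ s) t       _   = ≤-refl
boundπᴿ 0F 2F []      t       _   = ≤-refl
boundπᴿ 0F 2F (_ ∷ s) t       _   = ≤-refl
boundπᴿ 1F 0F s       []      _   = ≤-refl
boundπᴿ 1F 0F s       (_ ∷ t) _   = ≤-refl
boundπᴿ 1F 1F s       t       a≢a = contradiction refl a≢a
boundπᴿ 1F 2F []      t       _   = ≤-refl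
boundπᴿ 1F 2F (_ ∷ s) t       _   = ≤-refl
boundπᴿ 2F 0F s       []      _   = ≤-refl
boundπᴿ 2F 0F s       (_ ∷ t) _   = ≤-refl
boundπᴿ 2F 1F s       []      _   = ≤-refl
boundπᴿ 2F 1F s       (_ ∷ t) _   = ≤-refl
boundπᴿ 2F 2F s       t       a≢a = contradiction refl a≢a

boundκᴸ : AgreeBound ω₁ bonusᴸ (reverse ∘ κ) bonusᴸ
boundκᴸ 0F 0F s t a≢a = contradiction refl a≢a
boundκᴸ 0F 1F s t _   = ≤-refl
boundκᴸ 0F 2F s t _   = ≤-refl
boundκᴸ 1F 0F s t _   = ≤-refl
boundκᴸ 1F 1F s t a≢a = contradiction refl a≢a
boundκᴸ 1F 2F s t _   = ≤-refl
boundκᴸ 2F 0F s t _   = ≤-refl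
boundκᴸ 2F 1F s t _   = ≤-refl
boundκᴸ 2F 2F s t a≢a = contradiction refl a≢a

boundκᴿ : AgreeBound ω₁ bonusπ κ bonusκ
boundκᴿ 0F 0F s       t       a≢a = contradiction refl a≢a
boundκᴿ 0F 1F s       []      _   = n≤1+n 5
boundκᴿ 0F 1F s       (_ ∷ t) _   = ≤-refl
boundκᴿ 0F 2F s       []      _   = m≤m+n 3 2
boundκᴿ 0F 2F s       (_ ∷ t) _   = ≤-refl
boundκᴿ 1F 0F []      t       _   = n≤1+n 5
boundκᴿ 1F 0F (_ ∷ s) t       _   = ≤-refl
boundκᴿ 1F 1F s       t       a≢a = contradiction refl a≢a
boundκᴿ 1F 2F s       []      _   = m≤m+n 3 2
boundκᴿ 1F 2F s       (_ ∷ t) _   = ≤-refl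
boundκᴿ 2F 0F []      t       _   = m≤m+n 3 2
boundκᴿ 2F 0F (_ ∷ s) t       _   = ≤-refl
boundκᴿ 2F 1F []      t       _   = m≤m+n 3 2
boundκᴿ 2F 1F (_ ∷ s) t       _   = ≤-refl
boundκᴿ 2F 2F s       t       a≢a = contradiction refl a≢a

boundτᴸ : ∀ n → AgreeBound (ω n) (εᴸ n) (reverse ∘ τ) (εᴸ (suc n))
boundτᴸ n 0F 0F s t a≢a = contradiction refl a≢a
boundτᴸ n 0F 1F s t _   = ≤-refl
boundτᴸ n 0F 2F s t _   = ≤-refl
boundτᴸ n 1F 0F s t _   = ≤-refl
boundτᴸ n 1F 1F s t a≢a = contradiction refl a≢a
boundτᴸ n 1F 2F s t _   = ≤-refl
boundτᴸ n 2F 0F s t _   = ≤-refl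
boundτᴸ n 2F 1F s t _   = ≤-refl
boundτᴸ n 2F 2F s t a≢a = contradiction refl a≢a

boundτᴿ : ∀ n → AgreeBound (ω n) (εᴿ n) τ (εᴿ (suc n))
boundτᴿ n 0F 0F s       t       a≢a = contradiction refl a≢a
boundτᴿ n 0F 1F s       t       _   = ≤-refl
boundτᴿ n 0F 2F s       []      _   = +-monoʳ-≤ (ω n 0F) z≤n
boundτᴿ n 0F 2F s       (_ ∷ t) _   = ≤-refl
boundτᴿ n 1F 0F s       t       _   = ≤-refl
boundτᴿ n 1F 1F s       t       a≢a = contradiction refl a≢a
boundτᴿ n 1F 2F s       []      _   = +-monoʳ-≤ (ω n 0F) z≤n
boundτᴿ n 1F 2F s       (_ ∷ t) _   = ≤-refl
boundτᴿ n 2F 0F []      t       _   = +-monoʳ-≤ (ω n 0F) z≤n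
boundτᴿ n 2F 0F (_ ∷ s) t       _   = ≤-refl
boundτᴿ n 2F 1F []      t       _   = +-monoʳ-≤ (ω n 0F) z≤n
boundτᴿ n 2F 1F (_ ∷ s) t       _   = ≤-refl
boundτᴿ n 2F 2F s       t       a≢a = contradiction refl a≢a

-- The total overhang gained on the right from n applications of τ: each contributes the initial 0
-- shared by all images.
S : ℕ → ℕ
S zero    = 0
S (suc n) = ω n 0F + S n

εᴸ≤1 : ∀ n a b → εᴸ n a b ≤ 1
εᴸ≤1 (suc n) a b = εᴸ≤1 n (rotate a) (rotate b)
εᴸ≤1 zero 0F b  = z≤n
εᴸ≤1 zero 1F 0F = z≤n
εᴸ≤1 zero 1F 1F = z≤n
εᴸ≤1 zero 1F 2F = ≤-refl
εᴸ≤1 zero 2F 0F = z≤n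
εᴸ≤1 zero 2F 1F = ≤-refl
εᴸ≤1 zero 2F 2F = z≤n

εᴿ≤ : ∀ n a b → εᴿ n a b ≤ S n + 6
εᴿ≤ (suc n) a b = ≤-trans (+-monoʳ-≤ (ω n 0F) (εᴿ≤ n (rotate a) (rotate b)))
                          (≤-reflexive (sym (+-assoc (ω n 0F) (S n) 6)))
εᴿ≤ zero 0F 0F = n≤1+n 5
εᴿ≤ zero 0F 1F = ≤-refl
εᴿ≤ zero 0F 2F = n≤1+n 5
εᴿ≤ zero 1F 0F = ≤-refl
εᴿ≤ zero 1F 1F = n≤1+n 5
εᴿ≤ zero 1F 2F = n≤1+n 5
εᴿ≤ zero 2F b  = n≤1+n 5

-- The letters around an occurrence of the period word 2 are both 0, and
-- 0 = rotate 2; these two bonuses are never maximal together.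
εᴸ+εᴿ≤ : ∀ n a → εᴸ n (rotate a) a + εᴿ n a (rotate a) ≤ S n + 6
εᴸ+εᴿ≤ zero 0F = ≤-refl
εᴸ+εᴿ≤ zero 1F = ≤-refl
εᴸ+εᴿ≤ zero 2F = n≤1+n 5
εᴸ+εᴿ≤ (suc n) a = begin
  εᴸ n (rotate (rotate a)) (rotate a) + (ω n 0F + εᴿ n (rotate a) (rotate (rotate a)))
    ≡⟨ swap (εᴸ n (rotate (rotate a)) (rotate a)) (ω n 0F) _ ⟩
  ω n 0F + (εᴸ n (rotate (rotate a)) (rotate a) + εᴿ n (rotate a) (rotate (rotate a)))
    ≤⟨ +-monoʳ-≤ (ω n 0F) (εᴸ+εᴿ≤ n (rotate a)) ⟩
  ω n 0F + (S n + 6)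
    ≡⟨ +-assoc (ω n 0F) (S n) 6 ⟨
  S (suc n) + 6 ∎
  where
  open ≤-Reasoning
  swap : ∀ a b c → a + (b + c) ≡ b + (a + c)
  swap = solve-∀

-- These inequalities ensure that every nonempty period word other than the single letter 2 has
-- weight at least `ω 1F`.
record Ordered (ω : Fin 3 → ℕ) : Set where
  field
    ω₂≤ω₁  : ω 2F ≤ ω 1F
    ω₁≤ω₀  : ω 1F ≤ ω 0F
    ω₁≤2ω₂ : ω 1F ≤ ω 2F + ω 2F

  ω₂≤ : ∀ a → ω 2F ≤ ω a
  ω₂≤ 0F = ≤-trans ω₂≤ω₁ ω₁≤ω₀
  ω₂≤ 1F = ω₂≤ω₁
  ω₂≤ 2F = ≤-refl

ordered : ∀ n → Ordered (ω n)
ordered zero = record { ω₂≤ω₁ = m≤m+n 3 2 ; ω₁≤ω₀ = m≤m+n 5 1 ; ω₁≤2ω₂ = m≤m+n 5 1 }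
ordered (suc n) = record
  { ω₂≤ω₁ = +-monoʳ-≤ (ω n 0F) z≤n
  ; ω₁≤ω₀ = +-monoʳ-≤ (ω n 0F) (+-monoˡ-≤ 0 ω₂≤ω₁)
  ; ω₁≤2ω₂ = +-mono-≤ (m≤m+n (ω n 0F) 0) (+-monoˡ-≤ 0 (ω₂≤ 0F))
  }
  where open Ordered (ordered n)

-- `S n + 7` bounds the sum of a left and a right bonus. In the induction step one copy of `ω n 1F`
-- is enlarged to `ω n 0F` and the other to twice `ω n 2F`, which together with the new summand
-- makes twice the next `ω 1F`.
S+7≤2ω₁ : ∀ n → S n + 7 ≤ 2 * ω n 1F
S+7≤2ω₁ zero    = m≤m+n 7 3
S+7≤2ω₁ (suc n) = begin
  ω n 0F + S n + 7                                  ≡⟨ +-assoc (ω n 0F) (S n) 7 ⟩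
  ω n 0F + (S n + 7)                                ≤⟨ +-monoʳ-≤ (ω n 0F) (S+7≤2ω₁ n) ⟩
  ω n 0F + (ω n 1F + (ω n 1F + 0))                  ≤⟨ +-monoʳ-≤ (ω n 0F) (+-mono-≤ ω₁≤ω₀ (+-monoˡ-≤ 0 ω₁≤2ω₂)) ⟩
  ω n 0F + (ω n 0F + (ω n 2F + ω n 2F + 0))         ≡⟨ regroup (ω n 0F) (ω n 2F) ⟩
  2 * (ω n 0F + (ω n 2F + 0))                       ∎
  where
  open ≤-Reasoning
  open Ordered (ordered n)
  regroup : ∀ a b → a + (a + (b + b + 0)) ≡ 2 * (a + (b + 0))
  regroup = solve-∀

-- The first alternative means exponent at most 3, which is below the limit; only the periods in the
-- second can exceed it.
Good : ℕ → ℕ → Set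
Good ℓ p = ℓ ≤ 2 * p ⊎ ∃[ n ] ℓ ≤ S n + 6 × ω n 2F ≡ p

Good-mono : ∀ {k ℓ p} → k ≤ ℓ → Good ℓ p → Good k p
Good-mono k≤ℓ (inj₁ le)            = inj₁ (≤-trans k≤ℓ le)
Good-mono k≤ℓ (inj₂ (n , le , eq)) = inj₂ (n , ≤-trans k≤ℓ le , eq)

record Between (ω : Fin n → ℕ) (l₁ s₁ l₂ s₂ : List (Fin n)) (p : ℕ) : Set where
  constructor between
  field
    d      : Fin n
    y      : List (Fin n)
    l₂≡    : l₂ ≡ (d ∷ y) ʳ++ l₁
    s₁≡    : s₁ ≡ (d ∷ y) ++ s₂
    p≡     : p ≡ weight ω (d ∷ y)

Cuts⇒Between : ∀ {ω : Fin n → ℕ} {W p} → 0 < p → (C : Cuts ω W p) →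
               Between ω (Cuts.l₁ C) (Cuts.s₁ C) (Cuts.l₂ C) (Cuts.s₂ C) p
Cuts⇒Between {ω = ω} {p = p} 0<p
  record { l₁ = l₁ ; s₁ = s₁ ; l₂ = l₂ ; s₂ = s₂ ; cut₁ = cut₁ ; cut₂ = cut₂ ; distance = distance }
  with ++-split (reverse l₁) (reverse l₂)
         (trans (sym (List.ʳ++-defn l₁)) (trans cut₁ (trans (sym cut₂) (List.ʳ++-defn l₂))))
... | inj₁ (u , eq , _) = contradiction shorter (<⇒≱ longer)
  where
  open ≤-Reasoning
  shorter : weight ω l₂ ≤ weight ω l₁
  shorter = begin
    weight ω l₂                          ≡⟨ weight-reverse ω l₂ ⟨
    weight ω (reverse l₂)                ≤⟨ m≤m+n _ _ ⟩
    weight ω (reverse l₂) + weight ω u   ≡⟨ weight-++ ω (reverse l₂) u ⟨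
    weight ω (reverse l₂ ++ u)           ≡⟨ cong (weight ω) eq ⟨
    weight ω (reverse l₁)                ≡⟨ weight-reverse ω l₁ ⟩
    weight ω l₁                          ∎
  longer : weight ω l₁ < weight ω l₂
  longer = ≤-trans (m<m+n (weight ω l₁) 0<p) (≤-reflexive distance)
... | inj₂ (d , y , eq , s₁≡) = between d y l₂≡ s₁≡
    (+-cancelˡ-≡ (weight ω l₁) _ _ (begin
      weight ω l₁ + p                     ≡⟨ distance ⟩
      weight ω l₂                         ≡⟨ cong (weight ω) l₂≡ ⟩
      weight ω ((d ∷ y) ʳ++ l₁)           ≡⟨ weight-ʳ++ ω (d ∷ y) l₁ ⟩
      weight ω (d ∷ y) + weight ω l₁      ≡⟨ +-comm (weight ω (d ∷ y)) _ ⟩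
      weight ω l₁ + weight ω (d ∷ y)      ∎))
  where
  open ≡-Reasoning
  l₂≡ : l₂ ≡ (d ∷ y) ʳ++ l₁
  l₂≡ = begin
    l₂                                ≡⟨ List.reverse-involutive l₂ ⟨
    reverse (reverse l₂)              ≡⟨ cong reverse eq ⟩
    reverse (reverse l₁ ++ d ∷ y)     ≡⟨ List.++-ʳ++ (reverse l₁) ⟩
    (d ∷ y) ʳ++ reverse (reverse l₁)  ≡⟨ cong ((d ∷ y) ʳ++_) (List.reverse-involutive l₁) ⟩
    (d ∷ y) ʳ++ l₁                    ∎

-- In an image under τ the letter 2 occurs only at the end of τ 1 = 02, so a cut behind it is a
-- block boundary.
around-2 : ∀ {W l l₁ s₂} → l ≡ 2F ∷ l₁ → Cutτ W l s₂ →
           (∃[ l′ ] l₁ ≡ 0F ∷ l′) × (s₂ ≡ [] ⊎ ∃[ s′ ] s₂ ≡ 0F ∷ s′)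
around-2 eq (edge (1F ∷ l) s _) with refl ← eq = (_ , refl) , right-of s
  where
  right-of : ∀ s → concatMap τ s ≡ [] ⊎ ∃[ s′ ] concatMap τ s ≡ 0F ∷ s′
  right-of []      = inj₁ refl
  right-of (_ ∷ _) = inj₂ (_ , refl)
around-2 () (edge [] s _)
around-2 () (edge (0F ∷ l) s _)
around-2 () (edge (2F ∷ l) s _)
around-2 () (0∣1 _ _ _)
around-2 () (0∣2 _ _ _)

-- Both agreements are mere bonuses, with sum at most `S n + 7`. If the period word weighs at least
-- `ω n 1F`, this is at most twice the period. Otherwise the period word is 2; by `around-2` the
-- comparisons are 0 with 2 on the left and, unless the word ends there, 2 with 0 on the right, so
-- `εᴸ+εᴿ≤` saves one unit.
mismatchτ : ∀ n {W p l₁ s₁ l₂ s₂} → Mismatched l₁ s₁ l₂ s₂ → Cutτ W l₂ s₂ →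
            Between (ω n) l₁ s₁ l₂ s₂ p →
            Good (agree (ω n) (εᴸ n) l₁ l₂ + agree (ω n) (εᴿ n) s₁ s₂) p
mismatchτ n {p = p} {l₁} {s₁} {l₂} {s₂} (l≁ , s≁) c₂ (between d y refl refl p≡) = go d y refl
  where
  open Ordered (ordered n)
  open ≤-Reasoning
  long : ω n 1F ≤ p →
         Good (agree (ω n) (εᴸ n) l₁ l₂ + agree (ω n) (εᴿ n) s₁ s₂) p
  long ω₁≤p = inj₁ (begin
    agree (ω n) (εᴸ n) l₁ l₂ + agree (ω n) (εᴿ n) s₁ s₂
      ≤⟨ +-mono-≤ (Mismatch⇒agree≤ (εᴸ≤1 n) l≁) (Mismatch⇒agree≤ (εᴿ≤ n) s≁) ⟩
    1 + (S n + 6) ≡⟨ +-suc (S n) 6 ⟨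
    S n + 7       ≤⟨ S+7≤2ω₁ n ⟩
    2 * ω n 1F    ≤⟨ *-monoʳ-≤ 2 ω₁≤p ⟩
    2 * p         ∎)
  go : ∀ d′ y′ → d ∷ y ≡ d′ ∷ y′ →
       Good (agree (ω n) (εᴸ n) l₁ l₂ + agree (ω n) (εᴿ n) s₁ s₂) p
  go 0F y′ refl = long (≤-trans (m≤n⇒m≤n+o _ ω₁≤ω₀) (≤-reflexive (sym p≡)))
  go 1F y′ refl = long (≤-trans (m≤m+n _ _) (≤-reflexive (sym p≡)))
  go 2F (e ∷ y′) refl = long (begin
    ω n 1F                                ≤⟨ ω₁≤2ω₂ ⟩
    ω n 2F + ω n 2F                       ≤⟨ +-monoʳ-≤ (ω n 2F) (m≤n⇒m≤n+o _ (ω₂≤ e)) ⟩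
    ω n 2F + (ω n e + weight (ω n) y′)    ≡⟨ p≡ ⟨
    p                                     ∎)
  go 2F [] refl with around-2 refl c₂
  ... | (l′ , refl) , inj₂ (s′ , refl) =
    inj₂ (n , εᴸ+εᴿ≤ n 2F , trans (sym (+-identityʳ _)) (sym p≡))
  ... | (l′ , refl) , inj₁ refl =
    inj₂ (n , (begin
      εᴸ n 0F 2F + 0              ≤⟨ +-monoʳ-≤ (εᴸ n 0F 2F) z≤n ⟩
      εᴸ n 0F 2F + εᴿ n 2F 0F     ≤⟨ εᴸ+εᴿ≤ n 2F ⟩
      S n + 6                     ∎) , trans (sym (+-identityʳ _)) (sym p≡))

τ^ : ℕ → List (Fin 3) → List (Fin 3)
τ^ zero    w = w
τ^ (suc n) w = concatMap τ (τ^ n w)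

-- Two distinct cuts of a one-letter word are its two ends, so on each side one of the parts is
-- empty.
singleton-score : ∀ {p l₁ s₁ l₂ s₂} {ω : Fin n → ℕ} {ε₁ ε₂ a} → Between ω l₁ s₁ l₂ s₂ p →
  l₁ ʳ++ s₁ ≡ a ∷ [] → agree ω ε₁ l₁ l₂ + agree ω ε₂ s₁ s₂ ≡ 0
singleton-score {l₁ = []} (between d [] refl refl _) refl = refl
singleton-score {l₁ = x ∷ l₁} (between d y refl refl _) eq = contradiction
  (trans (sym (List.length-ʳ++ (x ∷ l₁))) (cong length eq))
  (λ eq′ → m+1+n≢0 (length l₁) (suc-injective eq′))

-- `N` counts the applications of τ still to be undone, `n` those already absorbed into the weights.
goodτ : ∀ N n {p} → 0 < p → (C : Cuts (ω n) (τ^ N (0F ∷ [])) p) → Good (score (εᴸ n) (εᴿ n) C) p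
goodτ zero n {p} 0<p C = inj₁ (≤-trans
  (≤-reflexive (singleton-score {l₁ = l₁} (Cuts⇒Between 0<p C) cut₁)) z≤n)
  where open Cuts C
goodτ (suc N) n 0<p C with syncτ (cutτ (cut τ (τ^ N (0F ∷ [])) l₁ s₁ cut₁)) (cutτ (cut τ (τ^ N (0F ∷ [])) l₂ s₂ cut₂))
  where open Cuts C
... | inj₁ ≁ = mismatchτ n ≁ (cutτ (cut τ (τ^ N (0F ∷ [])) l₂ s₂ cut₂)) (Cuts⇒Between 0<p C)
  where open Cuts C
... | inj₂ A with C′ , le ← descend (boundτᴸ n) (boundτᴿ n) A (Cuts.distance C)
    = Good-mono le (goodτ N (suc n) 0<p C′)

-- The bonuses add up to at most 3, which suffices for periods from 2 on. Period 1 forces the period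
-- word 0, and a mismatch against 0 has left bonus 0 and right bonus at most 1.
mismatchκ : ∀ {p l₁ s₁ l₂ s₂} → Mismatched l₁ s₁ l₂ s₂ → Between ω₁ l₁ s₁ l₂ s₂ p →
            agree ω₁ bonusᴸ l₁ l₂ + agree ω₁ bonusπ s₁ s₂ ≤ 2 * p
mismatchκ {p} {l₁} {s₁} {l₂} {s₂} (l≁ , s≁) (between d y refl refl p≡) = go d y refl
  where
  open ≤-Reasoning
  bonusᴸ≤ : ∀ a b → bonusᴸ a b ≤ 1
  bonusᴸ≤ = εᴸ≤1 0
  bonusπ≤ : ∀ a b → bonusπ a b ≤ 2
  bonusπ≤ 0F b  = m≤m+n 1 1
  bonusπ≤ 1F 0F = m≤m+n 1 1
  bonusπ≤ 1F 1F = m≤m+n 1 1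
  bonusπ≤ 1F 2F = ≤-refl
  bonusπ≤ 2F 0F = m≤m+n 1 1
  bonusπ≤ 2F 1F = ≤-refl
  bonusπ≤ 2F 2F = m≤m+n 1 1
  1≤ω₁ : ∀ a → 1 ≤ ω₁ a
  1≤ω₁ a = s≤s z≤n
  long : 2 ≤ p → agree ω₁ bonusᴸ l₁ l₂ + agree ω₁ bonusπ s₁ s₂ ≤ 2 * p
  long 2≤p = begin
    agree ω₁ bonusᴸ l₁ l₂ + agree ω₁ bonusπ s₁ s₂
      ≤⟨ +-mono-≤ (Mismatch⇒agree≤ bonusᴸ≤ l≁) (Mismatch⇒agree≤ bonusπ≤ s≁) ⟩
    3      ≤⟨ n≤1+n 3 ⟩
    4      ≤⟨ *-monoʳ-≤ 2 2≤p ⟩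
    2 * p  ∎
  shortᴸ : ∀ l → Mismatch l (0F ∷ l) → agree ω₁ bonusᴸ l (0F ∷ l) ≤ 0
  shortᴸ [] _ = z≤n
  shortᴸ (0F ∷ l) (differ x≢x) = contradiction refl x≢x
  shortᴸ (1F ∷ l) _ = z≤n
  shortᴸ (2F ∷ l) _ = z≤n
  shortᴿ : ∀ s → Mismatch (0F ∷ s) s → agree ω₁ bonusπ (0F ∷ s) s ≤ 1
  shortᴿ [] _ = z≤n
  shortᴿ (0F ∷ l) (differ x≢x) = contradiction refl x≢x
  shortᴿ (1F ∷ l) _ = ≤-refl
  shortᴿ (2F ∷ l) _ = ≤-refl
  go : ∀ d′ y′ → d ∷ y ≡ d′ ∷ y′ → agree ω₁ bonusᴸ l₁ l₂ + agree ω₁ bonusπ s₁ s₂ ≤ 2 * p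
  go 0F [] refl = begin
    agree ω₁ bonusᴸ l₁ l₂ + agree ω₁ bonusπ s₁ s₂  ≤⟨ +-mono-≤ (shortᴸ l₁ l≁) (shortᴿ s₂ s≁) ⟩
    1                                              ≤⟨ n≤1+n 1 ⟩
    2                                              ≡⟨ cong (2 *_) p≡ ⟨
    2 * p                                          ∎
  go 0F (e ∷ y′) refl = long (≤-trans (+-monoʳ-≤ 1 (m≤n⇒m≤n+o _ (1≤ω₁ e))) (≤-reflexive (sym p≡)))
  go 1F y′ refl = long (≤-trans (m≤m+n _ _) (≤-reflexive (sym p≡)))
  go 2F y′ refl = long (≤-trans (m≤m+n 2 _) (≤-reflexive (sym p≡)))

goodκ : ∀ N {p} → 0 < p → (C : Cuts ω₁ (concatMap κ (τ^ N (0F ∷ []))) p) → Good (score bonusᴸ bonusπ C) p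
goodκ N 0<p C with syncκ (cutκ (cut κ _ l₁ s₁ cut₁)) (cutκ (cut κ _ l₂ s₂ cut₂))
  where open Cuts C
... | inj₁ ≁ = inj₁ (mismatchκ ≁ (Cuts⇒Between 0<p C))
  where open Cuts C
... | inj₂ A with C′ , le ← descend boundκᴸ boundκᴿ A (Cuts.distance C)
    = Good-mono le (goodτ N 0 0<p C′)

h : List (Fin 3) → Word
h w = concatMap π (concatMap κ w)

good : ∀ N {p l₁ s₁ l₂ s₂} → 0 < p → l₁ ʳ++ s₁ ≡ h (τ^ N (0F ∷ [])) → l₂ ʳ++ s₂ ≡ h (τ^ N (0F ∷ [])) →
       length l₁ + p ≡ length l₂ → Good (common l₁ l₂ + common s₁ s₂) p
good N {p} {l₁} {s₁} {l₂} {s₂} 0<p cut₁ cut₂ distance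
  with syncπ (cutπ (cut π _ l₁ s₁ cut₁)) (cutπ (cut π _ l₂ s₂ cut₂))
... | inj₁ (short le) = inj₁ (≤-trans le (≤-trans 0<p (m≤m+n p _)))
... | inj₂ A with C′ , le ← descend boundπᴸ boundπᴿ A
                   (trans (cong (_+ p) (weight-length l₁)) (trans distance (sym (weight-length l₂))))
    = Good-mono le (goodκ N 0<p C′)

-- Periods of the factors of 𝐁

-- Kimberling's block substitution, read on the coded words: it sends the blocks 1, 10, 100 to 10,
-- 100, 100101.
φ : Fin 3 → List (Fin 3)
φ 0F = 1F ∷ []
φ 1F = 2F ∷ []
φ 2F = 2F ∷ 1F ∷ 0F ∷ []

step-π : ∀ d → step (concatMap π d) ≡ concatMap π (concatMap φ d)
step-π []           = refl
step-π (0F ∷ d)     = cong (λ w → 1F ∷ 0F ∷ w) (step-π d)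
step-π (1F ∷ [])    = refl
step-π (1F ∷ c ∷ d) = cong (λ w → 1F ∷ 0F ∷ 0F ∷ w) (step-π (c ∷ d))
step-π (2F ∷ d)     = cong (λ w → 1F ∷ 0F ∷ 0F ∷ 1F ∷ 0F ∷ 1F ∷ w) (step-π d)

step-0π : ∀ d → step (0F ∷ concatMap π d) ≡ 0F ∷ concatMap π (concatMap φ d)
step-0π []      = refl
step-0π (c ∷ d) = cong (0F ∷_) (step-π (c ∷ d))

-- Thus κ intertwines τ with φ, which turns iteration of `step` into iteration of τ.
φκ≡κτ : ∀ w → concatMap φ (concatMap κ w) ≡ concatMap κ (concatMap τ w)
φκ≡κτ []       = refl
φκ≡κτ (0F ∷ w) = cong (λ v → 2F ∷ 1F ∷ 0F ∷ 2F ∷ 1F ∷ v) (φκ≡κτ w)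
φκ≡κτ (1F ∷ w) = cong (λ v → 2F ∷ 1F ∷ 0F ∷ 2F ∷ v) (φκ≡κτ w)
φκ≡κτ (2F ∷ w) = cong (λ v → 2F ∷ 1F ∷ 0F ∷ v) (φκ≡κτ w)

B≡0h : ∀ n → B (2 + n) ≡ 0F ∷ h (τ^ n (1F ∷ []))
B≡0h zero    = refl
B≡0h (suc n) = trans (cong step (B≡0h n))
  (trans (step-0π (concatMap κ (τ^ n (1F ∷ [])))) (cong (λ d → 0F ∷ concatMap π d) (φκ≡κτ (τ^ n (1F ∷ [])))))

h-++ : ∀ u v → h (u ++ v) ≡ h u ++ h v
h-++ u v = trans (cong (concatMap π) (List.concatMap-++ κ u v)) (List.concatMap-++ π (concatMap κ u) _)

τ^-++ : ∀ n u v → τ^ n (u ++ v) ≡ τ^ n u ++ τ^ n v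
τ^-++ zero    u v = refl
τ^-++ (suc n) u v = trans (cong (concatMap τ) (τ^-++ n u v)) (List.concatMap-++ τ (τ^ n u) _)

τ^-+ : ∀ m n w → τ^ (m + n) w ≡ τ^ m (τ^ n w)
τ^-+ zero    n w = refl
τ^-+ (suc m) n w = cong (concatMap τ) (τ^-+ m n w)

-- Each application of τ rotates the last letter, and `rotate` has order 3.
τ^-last : ∀ m → ∃[ w ] τ^ (1 + m * 3) (0F ∷ []) ≡ w ++ 1F ∷ []
τ^-last zero = 0F ∷ [] , refl
τ^-last (suc m) with w , eq ← τ^-last m =
  _ , trans (cong (τ^ 3) eq) (trans (τ^-++ 3 w (1F ∷ []))
    (sym (List.++-assoc (τ^ 3 w) (0F ∷ 1F ∷ 0F ∷ 2F ∷ 0F ∷ []) (1F ∷ []))))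

-- τⁿ⁺¹ 0 is τⁿ 0 followed by τⁿ 1. For n = 1 + 3m the first part ends in 1, and the final 0 of h 1
-- = 10010 supplies the 0 that precedes the image in `B≡0h`.
B-suffix : ∀ m → ∃[ z ] h (τ^ (2 + m * 3) (0F ∷ [])) ≡ z ++ B (3 + m * 3)
B-suffix m with w , eq ← τ^-last m = h w ++ 1F ∷ 0F ∷ 0F ∷ 1F ∷ [] , (begin
  h (τ^ (2 + k) (0F ∷ []))
    ≡⟨ cong (λ n → h (τ^ n (0F ∷ []))) (+-comm (1 + k) 1) ⟨
  h (τ^ ((1 + k) + 1) (0F ∷ []))
    ≡⟨ cong h (τ^-+ (1 + k) 1 (0F ∷ [])) ⟩
  h (τ^ (1 + k) (0F ∷ 1F ∷ []))
    ≡⟨ cong h (τ^-++ (1 + k) (0F ∷ []) (1F ∷ [])) ⟩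
  h (τ^ (1 + k) (0F ∷ []) ++ τ^ (1 + k) (1F ∷ []))
    ≡⟨ cong (λ v → h (v ++ τ^ (1 + k) (1F ∷ []))) eq ⟩
  h ((w ++ 1F ∷ []) ++ τ^ (1 + k) (1F ∷ []))
    ≡⟨ h-++ (w ++ 1F ∷ []) _ ⟩
  h (w ++ 1F ∷ []) ++ h (τ^ (1 + k) (1F ∷ []))
    ≡⟨ cong (_++ h (τ^ (1 + k) (1F ∷ []))) (h-++ w (1F ∷ [])) ⟩
  (h w ++ 1F ∷ 0F ∷ 0F ∷ 1F ∷ 0F ∷ []) ++ h (τ^ (1 + k) (1F ∷ []))
    ≡⟨ List.++-assoc (h w) _ _ ⟩
  h w ++ 1F ∷ 0F ∷ 0F ∷ 1F ∷ 0F ∷ h (τ^ (1 + k) (1F ∷ []))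
    ≡⟨ List.++-assoc (h w) _ _ ⟨
  (h w ++ 1F ∷ 0F ∷ 0F ∷ 1F ∷ []) ++ 0F ∷ h (τ^ (1 + k) (1F ∷ []))
    ≡⟨ cong ((h w ++ 1F ∷ 0F ∷ 0F ∷ 1F ∷ []) ++_) (B≡0h (1 + k)) ⟨
  (h w ++ 1F ∷ 0F ∷ 0F ∷ 1F ∷ []) ++ B (3 + k) ∎)
  where
  open ≡-Reasoning
  k = m * 3

-- Occurrences and periods in terms of prefixes

⊑⇒++ : ∀ {u w} → u ⊑ w → ∃[ b ] w ≡ u ++ b
⊑⇒++ []         = _ , refl
⊑⇒++ (refl ∷ p) with b , eq ← ⊑⇒++ p = b , cong (_ ∷_) eq

++⇒⊑ : ∀ u {v x y} → u ++ x ≡ v ++ y → length u ≤ length v → u ⊑ v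
++⇒⊑ []      eq _ = []
++⇒⊑ (a ∷ u) {b ∷ v} eq (s≤s le) with refl , eq′ ← List.∷-injective eq = refl ∷ ++⇒⊑ u eq′ le

lookup⇒⊑ : ∀ u w → length u ≤ length w →
           (∀ i j → toℕ i ≡ toℕ j → lookup u i ≡ lookup w j) → u ⊑ w
lookup⇒⊑ []      w       _        _  = []
lookup⇒⊑ (a ∷ u) (b ∷ w) (s≤s le) eq =
  eq zero zero refl ∷ lookup⇒⊑ u w le (λ i j i≡j → eq (suc i) (suc j) (cong suc i≡j))

OccursAt⇒++ : ∀ (x : InfiniteWord) i {w W} → OccursAt 0 W x → OccursAt i w x →
              i + length w ≤ length W → ∃[ a ] ∃[ b ] W ≡ a ++ w ++ b
OccursAt⇒++ x zero {w} {W} W-occ w-occ le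
  with b , eq ← ⊑⇒++ (lookup⇒⊑ w W le λ i j i≡j →
                  trans (w-occ i) (trans (cong x i≡j) (sym (W-occ j))))
  = [] , b , eq
OccursAt⇒++ x (suc i) {w} {d ∷ W} W-occ w-occ (s≤s le)
  with a , b , eq ← OccursAt⇒++ (x ∘ suc) i {w} {W} (W-occ ∘ suc) w-occ le = d ∷ a , b , cong (d ∷_) eq

++⇒OccursAt : ∀ (x : InfiniteWord) a {w b} → OccursAt 0 (a ++ w ++ b) x → OccursAt (length a) w x
++⇒OccursAt x [] {w} {b} occ j = trans
  (⊑-lookup (++⇒⊑ w {w ++ b} {b} {[]} (sym (List.++-identityʳ _)) (List.length-++-≤ˡ w)) j j′ (sym j′≡j))
  (trans (occ j′) (cong x j′≡j))
  where
  j<n = ≤-trans (toℕ<n j) (List.length-++-≤ˡ w {b})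
  j′ = fromℕ< j<n
  j′≡j : toℕ j′ ≡ toℕ j
  j′≡j = toℕ-fromℕ< j<n
++⇒OccursAt x (_ ∷ a) {w} {b} occ = ++⇒OccursAt (x ∘ suc) a {w} {b} (occ ∘ suc)

factor⇒B : ∀ {w i} → OccursAt i w 𝐁 → ∃[ m ] ∃[ a ] ∃[ b ] B (3 + m * 3) ≡ a ++ w ++ b
factor⇒B {w} {i} occ = k , OccursAt⇒++ 𝐁 i {w} (𝐁-prefixes (3 + k * 3) (s≤s (s≤s z≤n))) occ (begin
  k                      ≤⟨ m≤m*n k 3 ⟩
  k * 3                  ≤⟨ n≤1+n _ ⟩
  1 + k * 3              ≤⟨ <⇒≤ (length-B (1 + k * 3)) ⟩
  length (B (3 + k * 3)) ∎)
  where
  open ≤-Reasoning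
  k = i + length w

lookup-++ʳ : ∀ (v : Word) {u} (i : Fin (length u)) (j : Fin (length (v ++ u))) →
             toℕ j ≡ toℕ i + length v → lookup (v ++ u) j ≡ lookup u i
lookup-++ʳ [] i j eq rewrite toℕ-injective (trans eq (+-identityʳ _)) = refl
lookup-++ʳ (c ∷ v) i zero eq with () ← trans eq (+-suc (toℕ i) (length v))
lookup-++ʳ (c ∷ v) i (suc j) eq =
  lookup-++ʳ v i j (suc-injective (trans eq (+-suc (toℕ i) (length v))))

-- Dropping the first `p` letters shifts every index by the period, so what remains is a border. In
-- this form a period can be read off from two cuts.
HasPeriod⇒⊑ : ∀ {w p} → HasPeriod w p → p ≤ length w →
              ∃[ v ] ∃[ u ] w ≡ v ++ u × length v ≡ p × u ⊑ w
HasPeriod⇒⊑ {w} {p} (_ , per) p≤n = v , u , sym eq , length-v , u⊑w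
  where
  v = take p w
  u = drop p w
  eq : v ++ u ≡ w
  eq = List.take++drop≡id p w
  length-v : length v ≡ p
  length-v = trans (List.length-take p w) (m≤n⇒m⊓n≡m p≤n)
  u⊑ : ∀ w′ → v ++ u ≡ w′ → u ⊑ w′
  u⊑ w′ refl = lookup⇒⊑ u (v ++ u) (List.length-++-≤ʳ u {v}) λ i j i≡j →
    let k<n = subst (toℕ i + length v <_) (trans (+-comm (length u) (length v)) (sym (List.length-++ v)))
                (+-monoˡ-< (length v) (toℕ<n i))
        k   = fromℕ< k<n
        k≡  = toℕ-fromℕ< k<n
    in trans (sym (lookup-++ʳ v i k k≡))
             (sym (per′ j k (trans k≡ (cong₂ _+_ i≡j length-v))))
    where
    per′ : ∀ (i j : Fin (length (v ++ u))) → toℕ j ≡ toℕ i + p → lookup (v ++ u) i ≡ lookup (v ++ u) j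
    per′ = subst (λ w″ → ∀ (i j : Fin (length w″)) → toℕ j ≡ toℕ i + p → lookup w″ i ≡ lookup w″ j)
             (sym eq) per
  u⊑w : u ⊑ w
  u⊑w = u⊑ w eq

⊑⇒HasPeriod : ∀ v u → u ⊑ v ++ u → 0 < length v → HasPeriod (v ++ u) (length v)
⊑⇒HasPeriod v u u⊑vu 0<v = >-nonZero 0<v , λ i j eq →
  let i<u = +-cancelʳ-< (length v) (toℕ i) (length u)
              (subst₂ _<_ eq (trans (List.length-++ v) (+-comm (length v) _)) (toℕ<n j))
      k   = fromℕ< i<u
      k≡i = toℕ-fromℕ< i<u
  in sym (trans (lookup-++ʳ v k j (trans eq (cong (_+ length v) (sym k≡i)))) (⊑-lookup u⊑vu k i k≡i))

common-⊑ : ∀ {u w} b c → u ⊑ w → length u ≤ common (w ++ b) (u ++ c)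
common-⊑ b c []                   = z≤n
common-⊑ b c (_∷_ {x} refl u⊑w) =
  ≤-trans (s≤s (common-⊑ b c u⊑w)) (≤-reflexive (sym (agree-∷ (const 1) (λ _ _ → 0) x _ _)))

-- The cuts are placed at the start of `w` and `p` letters later. The texts to their right begin
-- with `w` and with `u`, hence agree at least along `u`.
period-bound : ∀ {w p} → IsFactorOf w 𝐁 → HasPeriod w p → p ≤ length w →
               Good (length w ∸ p) p
period-bound {w} {p} (i , occ) per p≤n
  with HasPeriod⇒⊑ {w} per p≤n | factor⇒B {w} {i} occ
... | v , u , refl , refl , u⊑w | m , a , b , B≡ with z , h≡ ← B-suffix m =
  Good-mono (≤-trans (≤-reflexive (trans (cong (_∸ length v) (List.length-++ v)) (m+n∸m≡n (length v) _)))
              (≤-trans (common-⊑ b b u⊑w) (m≤n+m _ (common l₁ l₂))))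
    (good (2 + m * 3) {l₁ = l₁} {s₁} {l₂} {s₂} (>-nonZero⁻¹ (length v) {{proj₁ per}}) cut₁ cut₂ distance)
  where
  open ≡-Reasoning
  l₁ = reverse (z ++ a)
  l₂ = v ʳ++ l₁
  s₁ = (v ++ u) ++ b
  s₂ = u ++ b
  cut₁ : l₁ ʳ++ s₁ ≡ h (τ^ (2 + m * 3) (0F ∷ []))
  cut₁ = begin
    l₁ ʳ++ s₁                 ≡⟨ List.ʳ++-ʳ++ (z ++ a) ⟩
    (z ++ a) ++ s₁            ≡⟨ List.++-assoc z a s₁ ⟩
    z ++ a ++ s₁              ≡⟨ cong (z ++_) B≡ ⟨
    z ++ B (3 + m * 3)        ≡⟨ h≡ ⟨
    h (τ^ (2 + m * 3) (0F ∷ [])) ∎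
  cut₂ : l₂ ʳ++ s₂ ≡ h (τ^ (2 + m * 3) (0F ∷ []))
  cut₂ = begin
    l₂ ʳ++ s₂            ≡⟨ List.ʳ++-ʳ++ v ⟩
    l₁ ʳ++ (v ++ u ++ b) ≡⟨ cong (l₁ ʳ++_) (List.++-assoc v u b) ⟨
    l₁ ʳ++ s₁            ≡⟨ cut₁ ⟩
    h (τ^ (2 + m * 3) (0F ∷ [])) ∎
  distance : length l₁ + length v ≡ length l₂
  distance = trans (+-comm (length l₁) _) (sym (List.length-ʳ++ v))

-- U m is a common prefix of the images of 2010 and 010 under τ^ (m * 3).
U : ℕ → List (Fin 3)
U zero    = []
U (suc m) = τ^ 3 (U m) ++ 0F ∷ 1F ∷ 0F ∷ 2F ∷ 0F ∷ 1F ∷ 0F ∷ []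

-- The pair 2010, 010 reproduces itself: its images under τ³ share the prefix 0102010 and continue
-- with 2010 and 010 respectively.
U-prefix-2010 : ∀ m → ∃[ r ] τ^ (m * 3) (2F ∷ 0F ∷ 1F ∷ 0F ∷ []) ≡ U m ++ 2F ∷ 0F ∷ 1F ∷ 0F ∷ r
U-prefix-2010 zero = [] , refl
U-prefix-2010 (suc m) with r , eq ← U-prefix-2010 m =
  _ , trans (cong (τ^ 3) eq) (trans (τ^-++ 3 (U m) _)
        (sym (List.++-assoc (τ^ 3 (U m)) (0F ∷ 1F ∷ 0F ∷ 2F ∷ 0F ∷ 1F ∷ 0F ∷ []) _)))

U-prefix-010 : ∀ m → ∃[ r ] τ^ (m * 3) (0F ∷ 1F ∷ 0F ∷ []) ≡ U m ++ 0F ∷ 1F ∷ 0F ∷ r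
U-prefix-010 zero = [] , refl
U-prefix-010 (suc m) with r , eq ← U-prefix-010 m =
  _ , trans (cong (τ^ 3) eq) (trans (τ^-++ 3 (U m) _)
        (sym (List.++-assoc (τ^ 3 (U m)) (0F ∷ 1F ∷ 0F ∷ 2F ∷ 0F ∷ 1F ∷ 0F ∷ []) _)))

weight-τ^ : ∀ m n w → weight (ω n) (τ^ m w) ≡ weight (ω (m + n)) w
weight-τ^ zero    n w = refl
weight-τ^ (suc m) n w = begin
  weight (ω n) (concatMap τ (τ^ m w))   ≡⟨ weight-concatMap (ω n) τ (τ^ m w) ⟩
  weight (ω (suc n)) (τ^ m w)           ≡⟨ weight-τ^ m (suc n) w ⟩
  weight (ω (m + suc n)) w              ≡⟨ cong (λ k → weight (ω k) w) (+-suc m n) ⟩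
  weight (ω (suc m + n)) w              ∎
  where open ≡-Reasoning

length-h : ∀ w → length (h w) ≡ weight (ω 0) w
length-h w = trans (sym (weight-length (h w)))
  (trans (weight-concatMap (const 1) π (concatMap κ w)) (weight-concatMap ω₁ κ w))

-- The added word 0102010 has the same letter counts as 0, τ 0 and τ² 0 together, so its weight
-- consists of three consecutive summands of `S`.
weight-U : ∀ m n → weight (ω n) (U m) + S n ≡ S (m * 3 + n)
weight-U zero    n = refl
weight-U (suc m) n = begin
  weight (ω n) (U (suc m)) + S n
    ≡⟨ cong (_+ S n) (weight-++ (ω n) (τ^ 3 (U m)) _) ⟩
  weight (ω n) (τ^ 3 (U m)) + weight (ω n) (0F ∷ 1F ∷ 0F ∷ 2F ∷ 0F ∷ 1F ∷ 0F ∷ []) + S n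
    ≡⟨ cong (λ x → x + weight (ω n) (0F ∷ 1F ∷ 0F ∷ 2F ∷ 0F ∷ 1F ∷ 0F ∷ []) + S n) (weight-τ^ 3 n (U m)) ⟩
  weight (ω (3 + n)) (U m) + weight (ω n) (0F ∷ 1F ∷ 0F ∷ 2F ∷ 0F ∷ 1F ∷ 0F ∷ []) + S n
    ≡⟨ regroup (weight (ω (3 + n)) (U m)) (ω n 0F) (ω n 1F) (ω n 2F) (S n) ⟩
  weight (ω (3 + n)) (U m) + S (3 + n)
    ≡⟨ weight-U m (3 + n) ⟩
  S (m * 3 + (3 + n))
    ≡⟨ cong S (shift (m * 3) n) ⟩
  S (suc m * 3 + n) ∎
  where
  open ≡-Reasoning
  regroup : ∀ x a b c s → x + (a + (b + (a + (c + (a + (b + (a + 0))))))) + s ≡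
    x + (((a + (b + 0)) + ((a + (c + 0)) + 0)) + ((a + (b + 0)) + (a + s)))
  regroup = solve-∀
  shift : ∀ k n → k + (3 + n) ≡ 3 + k + n
  shift = solve-∀

-- τᵏ (2010) begins with `U m`, and also with τᵏ 2 followed by `U m`; hence `U m` is a border and
-- the length of h (τᵏ 2) is a period.
repetition : ∀ m → ∃[ w ] IsFactorOf w 𝐁 × HasPeriod w (ω (m * 3) 2F) ×
             length w ≡ ω (m * 3) 2F + S (m * 3)
repetition m with r , eq₂ ← U-prefix-2010 m | r′ , eq₀ ← U-prefix-010 m =
  w , (length a , ++⇒OccursAt 𝐁 a {w} {b} B-occ) , per ,
  trans (List.length-++ (h v)) (cong₂ _+_ length-v length-u)
  where
  open ≡-Reasoning
  k = m * 3
  v = τ^ k (2F ∷ [])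
  w = h v ++ h (U m)
  length-v : length (h v) ≡ ω k 2F
  length-v = begin
    length (h v)               ≡⟨ length-h v ⟩
    weight (ω 0) v             ≡⟨ weight-τ^ k 0 (2F ∷ []) ⟩
    ω (k + 0) 2F + 0           ≡⟨ +-identityʳ _ ⟩
    ω (k + 0) 2F               ≡⟨ cong (λ n → ω n 2F) (+-identityʳ k) ⟩
    ω k 2F                     ∎
  length-u : length (h (U m)) ≡ S k
  length-u = begin
    length (h (U m))           ≡⟨ length-h (U m) ⟩
    weight (ω 0) (U m)         ≡⟨ +-identityʳ _ ⟨
    weight (ω 0) (U m) + 0     ≡⟨ weight-U m 0 ⟩
    S (k + 0)                  ≡⟨ cong S (+-identityʳ k) ⟩
    S k                        ∎
  image-2010 : h (τ^ k (2F ∷ 0F ∷ 1F ∷ 0F ∷ [])) ≡ w ++ h (0F ∷ 1F ∷ 0F ∷ r′)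
  image-2010 = begin
    h (τ^ k (2F ∷ 0F ∷ 1F ∷ 0F ∷ []))           ≡⟨ cong h (τ^-++ k (2F ∷ []) (0F ∷ 1F ∷ 0F ∷ [])) ⟩
    h (v ++ τ^ k (0F ∷ 1F ∷ 0F ∷ []))           ≡⟨ cong (λ x → h (v ++ x)) eq₀ ⟩
    h (v ++ U m ++ 0F ∷ 1F ∷ 0F ∷ r′)           ≡⟨ h-++ v _ ⟩
    h v ++ h (U m ++ 0F ∷ 1F ∷ 0F ∷ r′)         ≡⟨ cong (h v ++_) (h-++ (U m) _) ⟩
    h v ++ h (U m) ++ h (0F ∷ 1F ∷ 0F ∷ r′)     ≡⟨ List.++-assoc (h v) _ _ ⟨
    w ++ h (0F ∷ 1F ∷ 0F ∷ r′)                  ∎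
  u⊑w : h (U m) ⊑ w
  u⊑w = ++⇒⊑ (h (U m)) {w} (trans (sym (h-++ (U m) (2F ∷ 0F ∷ 1F ∷ 0F ∷ r)))
               (trans (cong h (sym eq₂)) image-2010)) (List.length-++-≤ʳ (h (U m)) {h v})
  per : HasPeriod w (ω k 2F)
  per = subst (HasPeriod w) length-v (⊑⇒HasPeriod (h v) (h (U m)) u⊑w
    (subst (0 <_) (sym length-v) (≤-trans (s≤s z≤n) (ω-pos k 2F))))
    where
    ω-pos : ∀ n a → 1 ≤ ω n a
    ω-pos zero    a = s≤s z≤n
    ω-pos (suc n) a = ≤-trans (ω-pos n 0F) (m≤m+n _ _)
  a b : Word
  a = 0F ∷ h (τ^ k (0F ∷ 1F ∷ 0F ∷ []))
  b = h (0F ∷ 1F ∷ 0F ∷ r′) ++ h (τ^ k (0F ∷ 1F ∷ 0F ∷ 2F ∷ []))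
  -- τ⁴ 1 = 01020100102 is 010, 2010, 0102 in succession, which exhibits the factor 2010.
  B≡ : B (2 + (k + 4)) ≡ a ++ w ++ b
  B≡ = begin
    B (2 + (k + 4))
      ≡⟨ B≡0h (k + 4) ⟩
    0F ∷ h (τ^ (k + 4) (1F ∷ []))
      ≡⟨ cong (λ x → 0F ∷ h x) (τ^-+ k 4 (1F ∷ [])) ⟩
    0F ∷ h (τ^ k (x ++ y ++ z))
      ≡⟨ cong (λ x → 0F ∷ h x) (trans (τ^-++ k x (y ++ z)) (cong (τ^ k x ++_) (τ^-++ k y z))) ⟩
    0F ∷ h (τ^ k x ++ τ^ k y ++ τ^ k z)
      ≡⟨ cong (0F ∷_) (trans (h-++ (τ^ k x) _) (cong (h (τ^ k x) ++_) (h-++ (τ^ k y) _))) ⟩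
    a ++ h (τ^ k y) ++ h (τ^ k z)
      ≡⟨ cong (λ t → a ++ t ++ h (τ^ k z)) image-2010 ⟩
    a ++ (w ++ h (0F ∷ 1F ∷ 0F ∷ r′)) ++ h (τ^ k z)
      ≡⟨ cong (a ++_) (List.++-assoc w _ _) ⟩
    a ++ w ++ b ∎
    where
    x = 0F ∷ 1F ∷ 0F ∷ []
    y = 2F ∷ 0F ∷ 1F ∷ 0F ∷ []
    z = 0F ∷ 1F ∷ 0F ∷ 2F ∷ []
  B-occ : OccursAt 0 (a ++ w ++ b) 𝐁
  B-occ = subst (λ W → OccursAt 0 W 𝐁) B≡ (𝐁-prefixes (2 + (k + 4)) (s≤s (s≤s z≤n)))

-- Least periods by bounded search

module _ {P : ℕ → Set} (P? : Decidable P) where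

  least : ∀ n → P n → ∃[ m ] m ≤ n × P m × (∀ k → P k → m ≤ k)
  least = <-rec _ λ n rec Pn → search n rec Pn (anyUpTo? P? n)
    where
    Least : ℕ → Set
    Least n = ∃[ m ] m ≤ n × P m × (∀ k → P k → m ≤ k)
    search : ∀ n → (∀ {m} → m < n → P m → Least m) → P n → Dec (∃ λ m → m < n × P m) → Least n
    search n rec Pn (yes (m , m<n , Pm)) with k , k≤m , min ← rec m<n Pm =
      k , ≤-trans k≤m (<⇒≤ m<n) , min
    search n rec Pn (no none) = n , ≤-refl , Pn , λ k Pk → ≮⇒≥ λ k<n → none (k , k<n , Pk)

HasPeriod? : ∀ w → Decidable (HasPeriod w)
HasPeriod? w p = nonZero? p ×-dec
  all? λ i → all? λ j → (toℕ j ℕ.≟ toℕ i + p) →-dec (lookup w i ≟ lookup w j)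

-- Exponents refer to the least period, while the construction provides only some period; passing to
-- the least one can only raise the quotient.
smallest-period : ∀ {w p} → HasPeriod w p → ∃[ q ] q ≤ p × IsPer w q
smallest-period {w} {p} per with q , q≤p , per-q , min ← least (HasPeriod? w) p per =
  q , q≤p , record { period = per-q ; minimal = min }

-- Tribonacci sequences

trib : ℕ → ℕ → ℕ → ℕ → ℕ
trib a b c zero    = a
trib a b c (suc n) = trib b c (a + b + c) n

Tribonacci : (ℕ → ℕ) → Set
Tribonacci f = ∀ n → f (3 + n) ≡ f n + f (1 + n) + f (2 + n)

trib-rec : ∀ a b c → Tribonacci (trib a b c)
trib-rec a b c zero    = refl
trib-rec a b c (suc n) = trib-rec b c (a + b + c) n

-- P n = |h (τⁿ 2)|, and Q n = P (n + 1) - P n.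
P Q : ℕ → ℕ
P = trib 3 6 11
Q = trib 3 5 9

P-rec : Tribonacci P
P-rec = trib-rec 3 6 11

Q-rec : Tribonacci Q
Q-rec = trib-rec 3 5 9

distrib : ∀ a x y z → a * (x + y + z) ≡ a * x + a * y + a * z
distrib = solve-∀

ind₃ : ∀ (R : ℕ → Set) → R 0 → R 1 → R 2 →
       (∀ n → R n → R (1 + n) → R (2 + n) → R (3 + n)) → ∀ n → R n
ind₃ R r₀ r₁ r₂ step zero    = r₀
ind₃ R r₀ r₁ r₂ step (suc n) = ind₃ (R ∘ suc) r₁ r₂ (step 0 r₀ r₁ r₂) (step ∘ suc) n

-- The coefficients of the recurrence are nonnegative, so a linear inequality needs checking at
-- three consecutive indices only.
Tribonacci-≤ : ∀ f g a b → Tribonacci f → Tribonacci g →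
  a * f 0 ≤ b * g 0 → a * f 1 ≤ b * g 1 → a * f 2 ≤ b * g 2 → ∀ n → a * f n ≤ b * g n
Tribonacci-≤ f g a b f-rec g-rec le₀ le₁ le₂ =
  ind₃ (λ n → a * f n ≤ b * g n) le₀ le₁ le₂ λ n r₀ r₁ r₂ → begin
    a * f (3 + n)                             ≡⟨ cong (a *_) (f-rec n) ⟩
    a * (f n + f (1 + n) + f (2 + n))         ≡⟨ distrib a (f n) (f (1 + n)) (f (2 + n)) ⟩
    a * f n + a * f (1 + n) + a * f (2 + n)   ≤⟨ +-mono-≤ (+-mono-≤ r₀ r₁) r₂ ⟩
    b * g n + b * g (1 + n) + b * g (2 + n)   ≡⟨ distrib b (g n) (g (1 + n)) (g (2 + n)) ⟨
    b * (g n + g (1 + n) + g (2 + n))         ≡⟨ cong (b *_) (g-rec n) ⟨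
    b * g (3 + n)                             ∎
  where open ≤-Reasoning

-- Absolute values reduce both sign patterns of the recurrence to this one inequality.
dominated : ∀ (f : ℕ → ℤ) (g : ℕ → ℕ) →
  (∀ n → ℤ.∣ f (3 + n) ∣ ≤ ℤ.∣ f n ∣ + ℤ.∣ f (1 + n) ∣ + ℤ.∣ f (2 + n) ∣) → Tribonacci g →
  ℤ.∣ f 0 ∣ ≤ g 0 → ℤ.∣ f 1 ∣ ≤ g 1 → ℤ.∣ f 2 ∣ ≤ g 2 → ∀ n → ℤ.∣ f n ∣ ≤ g n
dominated f g f-rec g-rec le₀ le₁ le₂ =
  ind₃ (λ n → ℤ.∣ f n ∣ ≤ g n) le₀ le₁ le₂ λ n r₀ r₁ r₂ →
    ≤-trans (f-rec n) (≤-trans (+-mono-≤ (+-mono-≤ r₀ r₁) r₂) (≤-reflexive (sym (g-rec n))))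

-- τ 2 = 0 and τ² 2 = 01, so the three equations describe the lengths at n, n + 1 and n + 2; only
-- jointly do they pass through the induction.
P≡ω : ∀ n → ω n 2F ≡ P n × ω n 0F ≡ P (1 + n) × ω n 0F + ω n 1F ≡ P (2 + n)
P≡ω zero = refl , refl , refl
P≡ω (suc n) with e₂ , e₀ , e₁ ← P≡ω n =
  trans (+-identityʳ _) e₀ ,
  trans (cong (ω n 0F +_) (+-identityʳ _)) e₁ ,
  (begin
    ω n 0F + (ω n 1F + 0) + (ω n 0F + (ω n 2F + 0)) ≡⟨ regroup (ω n 0F) (ω n 1F) (ω n 2F) ⟩
    ω n 2F + ω n 0F + (ω n 0F + ω n 1F)             ≡⟨ cong₂ _+_ (cong₂ _+_ e₂ e₀) e₁ ⟩
    P n + P (1 + n) + P (2 + n)                     ≡⟨ P-rec n ⟨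
    P (3 + n)                                       ∎)
  where
  open ≡-Reasoning
  regroup : ∀ a b c → a + (b + 0) + (a + (c + 0)) ≡ c + a + (a + b)
  regroup = solve-∀

-- Increasing n adds `2 * P (1 + n)` on both sides, by the recurrence. The constant is P 2 + P 0 =
-- 11 + 3.
2S+14≡ : ∀ n → 2 * S n + 14 ≡ P (2 + n) + P n
2S+14≡ zero = refl
2S+14≡ (suc n) = begin
  2 * (ω n 0F + S n) + 14                      ≡⟨ cong (λ x → 2 * (x + S n) + 14) (proj₁ (proj₂ (P≡ω n))) ⟩
  2 * (P (1 + n) + S n) + 14                   ≡⟨ regroup (P (1 + n)) (S n) ⟩
  (2 * S n + 14) + 2 * P (1 + n)               ≡⟨ cong (_+ 2 * P (1 + n)) (2S+14≡ n) ⟩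
  P (2 + n) + P n + 2 * P (1 + n)              ≡⟨ regroup′ (P n) (P (1 + n)) (P (2 + n)) ⟩
  P n + P (1 + n) + P (2 + n) + P (1 + n)      ≡⟨ cong (_+ P (1 + n)) (P-rec n) ⟨
  P (3 + n) + P (1 + n)                        ∎
  where
  open ≡-Reasoning
  regroup : ∀ x s → 2 * (x + s) + 14 ≡ (2 * s + 14) + 2 * x
  regroup = solve-∀
  regroup′ : ∀ a b c → c + a + 2 * b ≡ a + b + c + b
  regroup′ = solve-∀

P-suc : ∀ n → P (1 + n) ≡ P n + Q n
P-suc = ind₃ _ refl refl refl λ n r₀ r₁ r₂ → begin
  P (4 + n)
    ≡⟨ P-rec (1 + n) ⟩
  P (1 + n) + P (2 + n) + P (3 + n)
    ≡⟨ cong₂ _+_ (cong₂ _+_ r₀ r₁) r₂ ⟩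
  P n + Q n + (P (1 + n) + Q (1 + n)) + (P (2 + n) + Q (2 + n))
    ≡⟨ regroup (P n) (P (1 + n)) (P (2 + n)) (Q n) (Q (1 + n)) (Q (2 + n)) ⟩
  P n + P (1 + n) + P (2 + n) + (Q n + Q (1 + n) + Q (2 + n))
    ≡⟨ cong₂ _+_ (P-rec n) (Q-rec n) ⟨
  P (3 + n) + Q (3 + n) ∎
  where
  open ≡-Reasoning
  regroup : ∀ a b c x y z → a + x + (b + y) + (c + z) ≡ a + b + c + (x + y + z)
  regroup = solve-∀

-- Bounds for the minors of P and for the gaps

p : ℕ → ℤ
p n = ℤ.+ P n

p-rec : ∀ n → p (3 + n) ≡ p n ℤ.+ p (1 + n) ℤ.+ p (2 + n)
p-rec n = trans (cong ℤ.+_ (P-rec n)) (trans (ℤ.pos-+ (P n + P (1 + n)) _)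
            (cong (ℤ._+ p (2 + n)) (ℤ.pos-+ (P n) _)))

Tribonacci-scale : ∀ c f → Tribonacci f → Tribonacci (λ n → c * f n)
Tribonacci-scale c f f-rec n = trans (cong (c *_) (f-rec n)) (distrib c (f n) (f (1 + n)) (f (2 + n)))

open Minors using (gap; gap′)
open Minors.Recurrences p p-rec

∣i+j+k∣≤ : ∀ i j k → ℤ.∣ i ℤ.+ j ℤ.+ k ∣ ≤ ℤ.∣ i ∣ + ℤ.∣ j ∣ + ℤ.∣ k ∣
∣i+j+k∣≤ i j k = ≤-trans (ℤ.∣i+j∣≤∣i∣+∣j∣ (i ℤ.+ j) k) (+-monoˡ-≤ ℤ.∣ k ∣ (ℤ.∣i+j∣≤∣i∣+∣j∣ i j))

∣i-j-k∣≤ : ∀ i j k → ℤ.∣ i ℤ.- j ℤ.- k ∣ ≤ ℤ.∣ i ∣ + ℤ.∣ j ∣ + ℤ.∣ k ∣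
∣i-j-k∣≤ i j k = ≤-trans (ℤ.∣i-j∣≤∣i∣+∣j∣ (i ℤ.- j) k) (+-monoˡ-≤ ℤ.∣ k ∣ (ℤ.∣i-j∣≤∣i∣+∣j∣ i j))

dominated⁻ : ∀ (f : ℕ → ℤ) (g : ℕ → ℕ) →
  (∀ n → f (3 + n) ≡ f n ℤ.- f (1 + n) ℤ.- f (2 + n)) → Tribonacci g →
  ℤ.∣ f 0 ∣ ≤ g 0 → ℤ.∣ f 1 ∣ ≤ g 1 → ℤ.∣ f 2 ∣ ≤ g 2 → ∀ n → ℤ.∣ f n ∣ ≤ g n
dominated⁻ f g f-rec = dominated f g λ n →
  ≤-trans (≤-reflexive (cong ℤ.∣_∣ (f-rec n))) (∣i-j-k∣≤ (f n) _ _)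

dominated⁺ : ∀ (f : ℕ → ℤ) (g : ℕ → ℕ) →
  (∀ n → f (3 + n) ≡ f n ℤ.+ f (1 + n) ℤ.+ f (2 + n)) → Tribonacci g →
  ℤ.∣ f 0 ∣ ≤ g 0 → ℤ.∣ f 1 ∣ ≤ g 1 → ℤ.∣ f 2 ∣ ≤ g 2 → ∀ n → ℤ.∣ f n ∣ ≤ g n
dominated⁺ f g f-rec = dominated f g λ n →
  ≤-trans (≤-reflexive (cong ℤ.∣_∣ (f-rec n))) (∣i+j+k∣≤ (f n) _ _)

∣A∣≤ : ∀ n → ℤ.∣ A n ∣ ≤ P n
∣A∣≤ = dominated⁻ A P A-rec P-rec (m≤m+n 3 0) (m≤m+n 1 5) (m≤m+n 7 4)

∣D∣≤ : ∀ n → ℤ.∣ D n ∣ ≤ 2 * P n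
∣D∣≤ = dominated⁻ D (λ n → 2 * P n) D-rec (Tribonacci-scale 2 P P-rec) (m≤m+n 6 0) (m≤m+n 2 10) (m≤m+n 8 14)

∣g₀∣≤ : ∀ n → ℤ.∣ g₀ n ∣ ≤ 2 * Q n
∣g₀∣≤ = dominated⁻ g₀ (λ n → 2 * Q n) g₀-rec (Tribonacci-scale 2 Q Q-rec) (m≤m+n 6 0) (m≤m+n 2 8) (m≤m+n 8 10)

∣g₁∣≤ : ∀ n → ℤ.∣ g₁ n ∣ ≤ 2 * Q (1 + n)
∣g₁∣≤ = dominated⁻ g₁ (λ n → 2 * Q (1 + n)) g₁-rec (Tribonacci-scale 2 (λ n → Q (1 + n)) (λ n → Q-rec (1 + n))) (m≤m+n 4 6) (m≤m+n 6 12) (m≤m+n 2 32)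

∣g₂∣≤ : ∀ n → ℤ.∣ g₂ n ∣ ≤ 2 * Q (2 + n)
∣g₂∣≤ = dominated⁻ g₂ (λ n → 2 * Q (2 + n)) g₂-rec (Tribonacci-scale 2 (λ n → Q (2 + n)) (λ n → Q-rec (2 + n))) (m≤m+n 6 12) (m≤m+n 2 32) (m≤m+n 8 54)

-- For fixed `n` this is a Tribonacci sequence in `k` with initial terms `g₀ n`, `g₁ n`, `g₂ n`. The
-- factor 2 is uniform in `n`.
∣gap∣≤ : ∀ n k → ℤ.∣ gap (p n) (p (2 + n)) (p (k + n)) (p (1 + k + n)) ∣ ≤ 2 * Q (k + n)
∣gap∣≤ n = dominated⁺ (λ k → gap (p n) (p (2 + n)) (p (k + n)) (p (1 + k + n))) (λ k → 2 * Q (k + n))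
  (λ k → gap-rec (p n) (p (2 + n)) (k + n)) (λ k → Tribonacci-scale 2 Q Q-rec (k + n))
  (∣g₀∣≤ n) (∣g₁∣≤ n) (∣g₂∣≤ n)

close : ∀ x y {g N} → ℤ.+ x ℤ.+ g ≡ ℤ.+ y → ℤ.∣ g ∣ ≤ N → x ≤ y + N × y ≤ x + N
close x y {g} {N} eq g≤N =
  ≤-trans (≤-trans (≤-reflexive (cong ℤ.∣_∣ x≡)) (ℤ.∣i-j∣≤∣i∣+∣j∣ (ℤ.+ y) g)) (+-monoʳ-≤ y g≤N) ,
  ≤-trans (≤-trans (≤-reflexive (cong ℤ.∣_∣ (sym eq))) (ℤ.∣i+j∣≤∣i∣+∣j∣ (ℤ.+ x) g)) (+-monoʳ-≤ x g≤N)
  where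
  open ℤ-Solver.+-*-Solver
  cancel : ∀ x g → x ≡ x ℤ.+ g ℤ.- g
  cancel = solve 2 (λ x g → x := x :+ g :- g) refl
  x≡ : ℤ.+ x ≡ ℤ.+ y ℤ.- g
  x≡ = trans (cancel (ℤ.+ x) g) (cong (ℤ._- g) eq)

gap-identity : ∀ u v s q → ℤ.+ (v * q) ℤ.+ gap (ℤ.+ u) (ℤ.+ v) (ℤ.+ s) (ℤ.+ (s + q)) ≡
               ℤ.+ (2 * u * s + u * q)
gap-identity u v s q = begin
  ℤ.+ (v * q) ℤ.+ gap (ℤ.+ u) (ℤ.+ v) (ℤ.+ s) (ℤ.+ (s + q))
    ≡⟨ cong₂ (λ a b → a ℤ.+ gap (ℤ.+ u) (ℤ.+ v) (ℤ.+ s) b) (ℤ.pos-* v q) (ℤ.pos-+ s q) ⟩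
  ℤ.+ v ℤ.* ℤ.+ q ℤ.+ gap (ℤ.+ u) (ℤ.+ v) (ℤ.+ s) (ℤ.+ s ℤ.+ ℤ.+ q)
    ≡⟨ identity (ℤ.+ u) (ℤ.+ v) (ℤ.+ s) (ℤ.+ q) ⟩
  ℤ.+ 2 ℤ.* ℤ.+ u ℤ.* ℤ.+ s ℤ.+ ℤ.+ u ℤ.* ℤ.+ q
    ≡⟨ cong₂ ℤ._+_ (trans (ℤ.pos-* (2 * u) s) (cong (ℤ._* ℤ.+ s) (ℤ.pos-* 2 u))) (ℤ.pos-* u q) ⟨
  ℤ.+ (2 * u * s) ℤ.+ ℤ.+ (u * q)
    ≡⟨ ℤ.pos-+ (2 * u * s) (u * q) ⟨
  ℤ.+ (2 * u * s + u * q) ∎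
  where
  open ≡-Reasoning
  open ℤ-Solver.+-*-Solver
  identity : ∀ u v s q → v ℤ.* q ℤ.+ gap u v s (s ℤ.+ q) ≡ ℤ.+ 2 ℤ.* u ℤ.* s ℤ.+ u ℤ.* q
  identity = solve 4 (λ u v s q →
    v :* q :+ gap′ u v s (s :+ q) := con (ℤ.+ 2) :* u :* s :+ u :* q) refl

-- With m = k + n: the quotients (P (n + 2) - P n) / (2 P n) and P m / Q m differ by at most 1 / P
-- n.
P-close : ∀ n k → P (2 + n) * Q (k + n) ≤ 2 * P n * P (k + n) + P n * Q (k + n) + 2 * Q (k + n) ×
                  2 * P n * P (k + n) + P n * Q (k + n) ≤ P (2 + n) * Q (k + n) + 2 * Q (k + n)
P-close n k = close (P (2 + n) * Q (k + n)) (2 * P n * P (k + n) + P n * Q (k + n))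
  {gap (p n) (p (2 + n)) (p (k + n)) (ℤ.+ (P (k + n) + Q (k + n)))}
  (gap-identity (P n) (P (2 + n)) (P (k + n)) (Q (k + n)))
  (subst (λ t → ℤ.∣ gap (p n) (p (2 + n)) (p (k + n)) (ℤ.+ t) ∣ ≤ 2 * Q (k + n))
         (P-suc (k + n)) (∣gap∣≤ n k))

Q≤P : ∀ n → Q n ≤ P n
Q≤P n = subst₂ _≤_ (*-identityˡ _) (*-identityˡ _)
  (Tribonacci-≤ Q P 1 1 Q-rec P-rec (m≤m+n 3 0) (m≤m+n 5 1) (m≤m+n 9 2) n)

9P≤5P : ∀ n → 9 * P n ≤ 5 * P (1 + n)
9P≤5P = Tribonacci-≤ P (λ n → P (1 + n)) 9 5 P-rec (λ n → P-rec (1 + n)) (m≤m+n 27 3) (m≤m+n 54 1) (m≤m+n 99 1)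

n<P : ∀ n → n < P n
n<P = ind₃ (λ n → n < P n) (s≤s z≤n) (s≤s (s≤s z≤n)) (s≤s (s≤s (s≤s z≤n))) λ n r₀ r₁ r₂ → begin
  4 + n                          ≡⟨ +-comm 1 (3 + n) ⟩
  (3 + n) + 1                    ≤⟨ +-mono-≤ r₂ (≤-trans (s≤s z≤n) r₁) ⟩
  P (2 + n) + P (1 + n)          ≡⟨ +-comm (P (2 + n)) _ ⟩
  P (1 + n) + P (2 + n)          ≤⟨ +-monoˡ-≤ (P (2 + n)) (m≤n+m (P (1 + n)) (P n)) ⟩
  P n + P (1 + n) + P (2 + n)    ≡⟨ P-rec n ⟨
  P (3 + n)                      ∎
  where open ≤-Reasoning

P≢0 : ∀ n → NonZero (P n)
P≢0 n = >-nonZero (≤-trans (s≤s z≤n) (n<P n))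

Q≢0 : ∀ n → NonZero (Q n)
Q≢0 n = >-nonZero (ind₃ (λ n → 0 < Q n) (s≤s z≤n) (s≤s z≤n) (s≤s z≤n) (λ n r₀ _ _ → begin-strict
  0                              <⟨ r₀ ⟩
  Q n                            ≤⟨ m≤m+n (Q n) (Q (1 + n)) ⟩
  Q n + Q (1 + n)                ≤⟨ m≤m+n _ (Q (2 + n)) ⟩
  Q n + Q (1 + n) + Q (2 + n)    ≡⟨ Q-rec n ⟨
  Q (3 + n)                      ∎) n)
  where open ≤-Reasoning

cubic≤ : ∀ n → let a = p n; b = p (1 + n) in
  ℤ.∣ b ℤ.* b ℤ.* b ℤ.- b ℤ.* b ℤ.* a ℤ.- b ℤ.* a ℤ.* a ℤ.- a ℤ.* a ℤ.* a ∣ ≤ 3 * (P n * P n)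
cubic≤ n = begin
  ℤ.∣ b ℤ.* b ℤ.* b ℤ.- b ℤ.* b ℤ.* a ℤ.- b ℤ.* a ℤ.* a ℤ.- a ℤ.* a ℤ.* a ∣
    ≡⟨ cong ℤ.∣_∣ (cubic n) ⟩
  ℤ.∣ a ℤ.* D n ℤ.+ (b ℤ.- a) ℤ.* A n ∣
    ≤⟨ ℤ.∣i+j∣≤∣i∣+∣j∣ (a ℤ.* D n) _ ⟩
  ℤ.∣ a ℤ.* D n ∣ + ℤ.∣ (b ℤ.- a) ℤ.* A n ∣
    ≡⟨ cong₂ _+_ (ℤ.abs-* a (D n)) (ℤ.abs-* (b ℤ.- a) (A n)) ⟩
  P n * ℤ.∣ D n ∣ + ℤ.∣ b ℤ.- a ∣ * ℤ.∣ A n ∣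
    ≡⟨ cong (λ x → P n * ℤ.∣ D n ∣ + ℤ.∣ x ∣ * ℤ.∣ A n ∣) b-a ⟩
  P n * ℤ.∣ D n ∣ + Q n * ℤ.∣ A n ∣
    ≤⟨ +-mono-≤ (*-monoʳ-≤ (P n) (∣D∣≤ n)) (*-mono-≤ (Q≤P n) (∣A∣≤ n)) ⟩
  P n * (2 * P n) + P n * P n
    ≡⟨ regroup (P n) ⟩
  3 * (P n * P n) ∎
  where
  open ≤-Reasoning
  a = p n
  b = p (1 + n)
  regroup : ∀ x → x * (2 * x) + x * x ≡ 3 * (x * x)
  regroup = solve-∀
  open ℤ-Solver.+-*-Solver
  cancel : ∀ x y → x ℤ.+ y ℤ.- x ≡ y
  cancel = solve 2 (λ x y → x :+ y :- x := y) refl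
  b-a : b ℤ.- a ≡ ℤ.+ Q n
  b-a = trans (cong (λ t → ℤ.+ t ℤ.- a) (P-suc n)) (trans (cong (ℤ._- a) (ℤ.pos-+ (P n) (Q n))) (cancel a (ℤ.+ Q n)))

-- The numerator of 2 + P m / Q m.
K : ℕ → ℕ
K n = P n + 2 * Q n

-- A period longer than `w` gives exponent below 1, and an excess of at most `2 * q` gives at most
-- 3, which K m / Q m reaches because Q m is at most P m. The special periods are handled by
-- `P-close`.
exponent≤ : ∀ {w q} → IsFactorOf w 𝐁 → HasPeriod w q →
            ∃[ n ] ∀ k → length w * Q (k + n) ≤ q * K (k + n)
exponent≤ {w} {q} fac per with q ≤? length w
... | no q≰w = 0 , λ k → *-mono-≤ (≰⇒≥ q≰w) (≤-trans (m≤m+n (Q (k + 0)) _) (m≤n+m _ (P (k + 0))))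
... | yes q≤w with period-bound {w} fac per q≤w
...   | inj₁ ℓ≤2q = 0 , λ k → let m = k + 0 in begin
  length w * Q m                ≤⟨ *-monoˡ-≤ (Q m) (≤-trans (≤-reflexive (sym (m+[n∸m]≡n q≤w))) (+-monoʳ-≤ q ℓ≤2q)) ⟩
  (q + 2 * q) * Q m             ≡⟨ regroup q (Q m) ⟩
  q * (Q m + 2 * Q m)           ≤⟨ *-monoʳ-≤ q (+-monoˡ-≤ (2 * Q m) (Q≤P m)) ⟩
  q * K m                       ∎
  where
  open ≤-Reasoning
  regroup : ∀ q x → (q + 2 * q) * x ≡ q * (x + 2 * x)
  regroup = solve-∀
...   | inj₂ (n , ℓ≤ , refl) = n , λ k → let m = k + n in *-cancelˡ-≤ 2 (+-cancelʳ-≤ (2 * Q m) _ _ (begin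
  2 * (length w * Q m) + 2 * Q m                               ≡⟨ regroup₁ (length w) (Q m) ⟩
  (2 * length w + 2) * Q m                                     ≤⟨ *-monoˡ-≤ (Q m) 2L+2≤ ⟩
  (P (2 + n) + 3 * P n) * Q m                                  ≡⟨ *-distribʳ-+ (Q m) (P (2 + n)) _ ⟩
  P (2 + n) * Q m + 3 * P n * Q m                              ≤⟨ +-monoˡ-≤ (3 * P n * Q m) (proj₁ (P-close n k)) ⟩
  2 * P n * P m + P n * Q m + 2 * Q m + 3 * P n * Q m          ≡⟨ regroup₂ (P n) (P m) (Q m) ⟩
  2 * (P n * K m) + 2 * Q m                                    ≡⟨ cong (λ x → 2 * (x * K m) + 2 * Q m) (proj₁ (P≡ω n)) ⟨
  2 * (ω n 2F * K m) + 2 * Q m                                 ∎))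
  where
  open ≤-Reasoning
  regroup₁ : ∀ l x → 2 * (l * x) + 2 * x ≡ (2 * l + 2) * x
  regroup₁ = solve-∀
  regroup₂ : ∀ a b x → 2 * a * b + a * x + 2 * x + 3 * a * x ≡ 2 * (a * (b + 2 * x)) + 2 * x
  regroup₂ = solve-∀
  regroup₃ : ∀ a s → 2 * (a + (s + 6)) + 2 ≡ (2 * s + 14) + 2 * a
  regroup₃ = solve-∀
  regroup₄ : ∀ a c → c + a + 2 * a ≡ c + 3 * a
  regroup₄ = solve-∀
  -- The overhang 6, doubled, leaves 2 of the constant 14 to spare, and this 2 pays exactly for the
  -- error `2 * Q m` in `P-close`.
  2L+2≤ : 2 * length w + 2 ≤ P (2 + n) + 3 * P n
  2L+2≤ = begin
    2 * length w + 2                     ≡⟨ cong (λ x → 2 * x + 2) (m+[n∸m]≡n q≤w) ⟨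
    2 * (q + (length w ∸ q)) + 2         ≤⟨ +-monoˡ-≤ 2 (*-monoʳ-≤ 2 (+-monoʳ-≤ q ℓ≤)) ⟩
    2 * (q + (S n + 6)) + 2              ≡⟨ regroup₃ q (S n) ⟩
    (2 * S n + 14) + 2 * q               ≡⟨ cong₂ (λ x y → x + 2 * y) (2S+14≡ n) (proj₁ (P≡ω n)) ⟩
    P (2 + n) + P n + 2 * P n            ≡⟨ regroup₄ (P n) (P (2 + n)) ⟩
    P (2 + n) + 3 * P n                  ∎

-- The loss 8 is half of 14 + 2, from `2S+14≡` and the error in `P-close`. Divided by the period it
-- vanishes in the limit, since `q` can be made arbitrarily large.
exponent≥ : ∀ j → ∃[ w ] ∃[ q ] IsFactorOf w 𝐁 × HasPeriod w q × j ≤ q × q ≤ length w ×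
            ∃[ n ] ∀ k → q * K (k + n) ≤ (length w + 8) * Q (k + n)
exponent≥ j with w , fac , per , eq ← repetition j =
  w , ω N 2F , fac , per , j≤ , ≤-trans (m≤m+n _ (S N)) (≤-reflexive (sym eq)) , N , λ k → let m = k + N in *-cancelˡ-≤ 2 (begin
    2 * (ω N 2F * K m)                                 ≡⟨ cong (λ x → 2 * (x * K m)) (proj₁ (P≡ω N)) ⟩
    2 * (P N * K m)                                    ≡⟨ regroup₁ (P N) (P m) (Q m) ⟩
    2 * P N * P m + P N * Q m + 3 * P N * Q m          ≤⟨ +-monoˡ-≤ (3 * P N * Q m) (proj₂ (P-close N k)) ⟩
    P (2 + N) * Q m + 2 * Q m + 3 * P N * Q m          ≡⟨ regroup₂ (P N) (P (2 + N)) (Q m) ⟩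
    (P (2 + N) + P N + 2 * P N + 2) * Q m              ≡⟨ cong (λ x → (x + 2 * P N + 2) * Q m) (2S+14≡ N) ⟨
    (2 * S N + 14 + 2 * P N + 2) * Q m                 ≡⟨ regroup₃ (S N) (P N) (Q m) ⟩
    2 * ((P N + S N + 8) * Q m)                        ≡⟨ cong (λ x → 2 * ((x + S N + 8) * Q m)) (proj₁ (P≡ω N)) ⟨
    2 * ((ω N 2F + S N + 8) * Q m)                     ≡⟨ cong (λ x → 2 * ((x + 8) * Q m)) eq ⟨
    2 * ((length w + 8) * Q m)                         ∎)
  where
  open ≤-Reasoning
  N = j * 3
  j≤ : j ≤ ω N 2F
  j≤ = begin
    j        ≤⟨ m≤m*n j 3 ⟩
    N        ≤⟨ <⇒≤ (n<P N) ⟩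
    P N      ≡⟨ proj₁ (P≡ω N) ⟨
    ω N 2F   ∎
  regroup₁ : ∀ a b x → 2 * (a * (b + 2 * x)) ≡ 2 * a * b + a * x + 3 * a * x
  regroup₁ = solve-∀
  regroup₂ : ∀ a c x → c * x + 2 * x + 3 * a * x ≡ (c + a + 2 * a + 2) * x
  regroup₂ = solve-∀
  regroup₃ : ∀ s a x → (2 * s + 14 + 2 * a + 2) * x ≡ 2 * ((a + s + 8) * x)
  regroup₃ = solve-∀

K-rec : Tribonacci K
K-rec n = trans (cong₂ (λ x y → x + 2 * y) (P-rec n) (Q-rec n))
                (regroup (P n) (P (1 + n)) (P (2 + n)) (Q n) (Q (1 + n)) (Q (2 + n)))
  where
  regroup : ∀ a b c x y z → a + b + c + 2 * (x + y + z) ≡ a + 2 * x + (b + 2 * y) + (c + 2 * z)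
  regroup = solve-∀

-- From index 32 on the quotients K / Q are accurate enough for the claimed digits. The three
-- initial inequalities are evaluated by `_≤ᵇ_`.
K/Q≥ : ∀ k → 319148788395 * Q (k + 32) ≤ 100000000000 * K (k + 32)
K/Q≥ = Tribonacci-≤ (λ k → Q (k + 32)) (λ k → K (k + 32)) 319148788395 100000000000 (λ k → Q-rec (k + 32)) (λ k → K-rec (k + 32))
         (≤ᵇ⇒≤ _ _ _) (≤ᵇ⇒≤ _ _ _) (≤ᵇ⇒≤ _ _ _)

K/Q≤ : ∀ k → 10000000000000 * K (k + 32) ≤ 31914878839599 * Q (k + 32)
K/Q≤ = Tribonacci-≤ (λ k → K (k + 32)) (λ k → Q (k + 32)) 10000000000000 31914878839599 (λ k → K-rec (k + 32)) (λ k → Q-rec (k + 32))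
         (≤ᵇ⇒≤ _ _ _) (≤ᵇ⇒≤ _ _ _) (≤ᵇ⇒≤ _ _ _)

-- Rational and real numbers

ι : ℕ → ℚ
ι n = fromℤ (ℤ.+ n)

fromℤ-+ : ∀ a b → fromℤ (a ℤ.+ b) ≡ fromℤ a ℚ.+ fromℤ b
fromℤ-+ a b = ℚ.toℚᵘ-injective (ℚᵘ.≃-trans (*≡* (identity a b))
  (ℚᵘ.≃-sym (ℚ.toℚᵘ-homo-+ (fromℤ a) (fromℤ b))))
  where
  open ℤ-Solver.+-*-Solver
  identity : ∀ a b → (a ℤ.+ b) ℤ.* ℤ.+ 1 ≡ (a ℤ.* ℤ.+ 1 ℤ.+ b ℤ.* ℤ.+ 1) ℤ.* ℤ.+ 1
  identity = solve 2 (λ a b → (a :+ b) :* con (ℤ.+ 1) :=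
    (a :* con (ℤ.+ 1) :+ b :* con (ℤ.+ 1)) :* con (ℤ.+ 1)) refl

fromℤ-* : ∀ a b → fromℤ (a ℤ.* b) ≡ fromℤ a ℚ.* fromℤ b
fromℤ-* a b = ℚ.toℚᵘ-injective (ℚᵘ.≃-trans (*≡* refl)
  (ℚᵘ.≃-sym (ℚ.toℚᵘ-homo-* (fromℤ a) (fromℤ b))))

fromℤ-neg : ∀ a → fromℤ (ℤ.- a) ≡ ℚ.- fromℤ a
fromℤ-neg (ℤ.+ zero)    = refl
fromℤ-neg ℤ.+[1+ n ]    = refl
fromℤ-neg ℤ.-[1+ n ]    = refl

fromℤ-- : ∀ a b → fromℤ (a ℤ.- b) ≡ fromℤ a ℚ.- fromℤ b
fromℤ-- a b = trans (fromℤ-+ a (ℤ.- b)) (cong (fromℤ a ℚ.+_) (fromℤ-neg b))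

fromℤ-abs : ∀ a → ℚ.∣ fromℤ a ∣ ≡ ι ℤ.∣ a ∣
fromℤ-abs (ℤ.+ zero) = refl
fromℤ-abs ℤ.+[1+ n ] = refl
fromℤ-abs ℤ.-[1+ n ] = refl

ι-+ : ∀ m n → ι (m + n) ≡ ι m ℚ.+ ι n
ι-+ m n = trans (cong fromℤ (ℤ.pos-+ m n)) (fromℤ-+ (ℤ.+ m) (ℤ.+ n))

ι-* : ∀ m n → ι (m * n) ≡ ι m ℚ.* ι n
ι-* m n = trans (cong fromℤ (ℤ.pos-* m n)) (fromℤ-* (ℤ.+ m) (ℤ.+ n))

ι-mono : ∀ {m n} → m ≤ n → ι m ℚ.≤ ι n
ι-mono {m} {n} m≤n = ℚ.*≤* (subst₂ ℤ._≤_ (sym (ℤ.*-identityʳ (ℤ.+ m))) (sym (ℤ.*-identityʳ (ℤ.+ n)))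
  (ℤ.+≤+ m≤n))

ι-mono-< : ∀ {m n} → m < n → ι m ℚ.< ι n
ι-mono-< {m} {n} m<n = ℚ.*<* (subst₂ ℤ._<_ (sym (ℤ.*-identityʳ (ℤ.+ m))) (sym (ℤ.*-identityʳ (ℤ.+ n)))
  (ℤ.+<+ m<n))

ι-pos : ∀ n .{{_ : NonZero n}} → 0ℚ ℚ.< ι n
ι-pos n = ι-mono-< (>-nonZero⁻¹ n)

/-* : ∀ z d .{{_ : NonZero d}} → (z / d) ℚ.* ι d ≡ fromℤ z
/-* z d@(suc d-1) = ℚ.toℚᵘ-injective (begin
  ℚ.toℚᵘ ((z / d) ℚ.* ι d)             ≈⟨ ℚ.toℚᵘ-homo-* (z / d) (ι d) ⟩
  ℚ.toℚᵘ (z / d) ℚᵘ.* mkℚᵘ (ℤ.+ d) 0   ≈⟨ ℚᵘ.*-congʳ {mkℚᵘ (ℤ.+ d) 0} (ℚ.toℚᵘ-fromℚᵘ (mkℚᵘ z d-1)) ⟩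
  mkℚᵘ z d-1 ℚᵘ.* mkℚᵘ (ℤ.+ d) 0       ≈⟨ *≡* (trans (ℤ.*-identityʳ _) (cong (λ x → z ℤ.* ℤ.+ suc x) (sym (*-identityʳ d-1)))) ⟩
  mkℚᵘ z 0                             ∎)
  where open ℚᵘ.≃-Reasoning

cancel-≤ : ∀ {p q} r → 0ℚ ℚ.< r → p ℚ.* r ℚ.≤ q ℚ.* r → p ℚ.≤ q
cancel-≤ r 0<r = ℚ.*-cancelʳ-≤-pos r {{ℚ.positive 0<r}}

cancel-< : ∀ {p q} r → 0ℚ ℚ.< r → p ℚ.* r ℚ.< q ℚ.* r → p ℚ.< q
cancel-< r 0<r = ℚ.*-cancelʳ-<-nonNeg r {{ℚ.nonNegative (ℚ.<⇒≤ 0<r)}}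

scale-≤ : ∀ {p q} r → 0ℚ ℚ.≤ r → p ℚ.≤ q → p ℚ.* r ℚ.≤ q ℚ.* r
scale-≤ r 0≤r = ℚ.*-monoʳ-≤-nonNeg r {{ℚ.nonNegative 0≤r}}

-- Fractions enter only through the equations that define them, so their normal forms never matter.
fraction-≤ : ∀ s t a b c d .{{_ : NonZero b}} .{{_ : NonZero d}} →
             s ℚ.* ι b ≡ ι a → t ℚ.* ι d ≡ ι c → a * d ≤ b * c → s ℚ.≤ t
fraction-≤ s t a b c d sb≡a td≡c ad≤bc = cancel-≤ (ι b ℚ.* ι d) (0<* (ι-pos b) (ι-pos d)) (begin
  s ℚ.* (ι b ℚ.* ι d)  ≡⟨ ℚ.*-assoc s _ _ ⟨
  s ℚ.* ι b ℚ.* ι d    ≡⟨ cong (ℚ._* ι d) sb≡a ⟩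
  ι a ℚ.* ι d          ≡⟨ ι-* a d ⟨
  ι (a * d)            ≤⟨ ι-mono ad≤bc ⟩
  ι (b * c)            ≡⟨ ι-* b c ⟩
  ι b ℚ.* ι c          ≡⟨ cong (ι b ℚ.*_) td≡c ⟨
  ι b ℚ.* (t ℚ.* ι d)  ≡⟨ swap (ι b) t (ι d) ⟩
  t ℚ.* (ι b ℚ.* ι d)  ∎)
  where
  open ℚ.≤-Reasoning
  open ℚ-Solver.+-*-Solver
  swap : ∀ b t d → b ℚ.* (t ℚ.* d) ≡ t ℚ.* (b ℚ.* d)
  swap = solve 3 (λ b t d → b :* (t :* d) := t :* (b :* d)) refl

archimedean : ∀ c ε → 0ℚ ℚ.< ε → ∃[ N ] ∀ n → N ≤ n → ι c ℚ.< ε ℚ.* ι n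
archimedean c ε 0<ε with ℚ.positive 0<ε
-- The numerator is at least 1, so ε times its denominator is at least 1 and c + 1 such multiples
-- exceed c.
archimedean c ε@(mkℚ ℤ.+[1+ k ] d-1 _) 0<ε | _ = suc c * suc d-1 , λ n N≤n → begin-strict
  ι c                                 <⟨ ι-mono-< (n<1+n c) ⟩
  ι (suc c)                           ≡⟨ ℚ.*-identityʳ (ι (suc c)) ⟨
  ι (suc c) ℚ.* ι 1                   ≤⟨ ℚ.*-monoˡ-≤-nonNeg (ι (suc c)) (ι-mono (s≤s (z≤n {k}))) ⟩
  ι (suc c) ℚ.* ι (suc k)             ≡⟨ cong (ι (suc c) ℚ.*_) ε*d ⟨
  ι (suc c) ℚ.* (ε ℚ.* ι (suc d-1))   ≡⟨ swap (ι (suc c)) ε (ι (suc d-1)) ⟩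
  ε ℚ.* (ι (suc c) ℚ.* ι (suc d-1))   ≡⟨ cong (ε ℚ.*_) (ι-* (suc c) (suc d-1)) ⟨
  ε ℚ.* ι (suc c * suc d-1)           ≤⟨ ℚ.*-monoˡ-≤-nonNeg ε (ι-mono N≤n) ⟩
  ε ℚ.* ι n                           ∎
  where
  open ℚ.≤-Reasoning
  open ℚ-Solver.+-*-Solver
  swap : ∀ b t d → b ℚ.* (t ℚ.* d) ≡ t ℚ.* (b ℚ.* d)
  swap = solve 3 (λ b t d → b :* (t :* d) := t :* (b :* d)) refl
  ε*d : ε ℚ.* ι (suc d-1) ≡ ι (suc k)
  ε*d = trans (cong (ℚ._* ι (suc d-1)) (sym (ℚ.↥p/↧p≡p ε))) (/-* (ℤ.+ suc k) (suc d-1))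

-- Written as the real polynomial unfolds termwise, including the factor 1 from the zeroth power.
f : ℚ → ℚ
f x = x ℚ.* (x ℚ.* (x ℚ.* 1ℚ)) ℚ.- x ℚ.* (x ℚ.* 1ℚ) ℚ.- x ℚ.- 1ℚ

square-nonNeg : ∀ q → 0ℚ ℚ.≤ q ℚ.* q
square-nonNeg q = subst (0ℚ ℚ.≤_) ∣q∣² (subst (ℚ._≤ ℚ.∣ q ∣ ℚ.* ℚ.∣ q ∣) (ℚ.*-zeroˡ ℚ.∣ q ∣)
  (scale-≤ ℚ.∣ q ∣ (∣∣-nonNeg q) (∣∣-nonNeg q)))
  where
  open ℚ-Solver.+-*-Solver
  neg*neg : ∀ q → (ℚ.- q) ℚ.* (ℚ.- q) ≡ q ℚ.* q
  neg*neg = solve 1 (λ q → (:- q) :* (:- q) := q :* q) refl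
  ∣q∣² : ℚ.∣ q ∣ ℚ.* ℚ.∣ q ∣ ≡ q ℚ.* q
  ∣q∣² with ℚ.∣p∣≡p∨∣p∣≡-p q
  ... | inj₁ eq = cong₂ ℚ._*_ eq eq
  ... | inj₂ eq = trans (cong₂ ℚ._*_ eq eq) (neg*neg q)

-- f x - f y = (x - y) W with W ≥ 1/4, which is a sum of squares once y ≥ 9/5.
∣x-y∣≤4∣fx-fy∣ : ∀ x y → ℤ.+ 9 / 5 ℚ.≤ y → ℚ.∣ x ℚ.- y ∣ ℚ.≤ ι 4 ℚ.* ℚ.∣ f x ℚ.- f y ∣
∣x-y∣≤4∣fx-fy∣ x y 9/5≤y = begin
  ∣x-y∣                                ≡⟨ trans (sym (ℚ.*-assoc (ι 4) ¼ ∣x-y∣)) (ℚ.*-identityˡ ∣x-y∣) ⟨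
  ι 4 ℚ.* (¼ ℚ.* ∣x-y∣)                ≤⟨ ℚ.*-monoˡ-≤-nonNeg (ι 4) (scale-≤ ∣x-y∣ (∣∣-nonNeg _) ¼≤W) ⟩
  ι 4 ℚ.* (W ℚ.* ∣x-y∣)                ≡⟨ cong (λ t → ι 4 ℚ.* (t ℚ.* ∣x-y∣)) (ℚ.0≤p⇒∣p∣≡p 0≤W) ⟨
  ι 4 ℚ.* (ℚ.∣ W ∣ ℚ.* ∣x-y∣)          ≡⟨ cong (ι 4 ℚ.*_) (ℚ.∣p*q∣≡∣p∣*∣q∣ W (x ℚ.- y)) ⟨
  ι 4 ℚ.* ℚ.∣ W ℚ.* (x ℚ.- y) ∣        ≡⟨ cong (λ t → ι 4 ℚ.* ℚ.∣ t ∣) (factor x y) ⟨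
  ι 4 ℚ.* ℚ.∣ f x ℚ.- f y ∣            ∎
  where
  open ℚ.≤-Reasoning
  open ℚ-Solver.+-*-Solver
  ¼ 9/5 : ℚ
  ¼ = ℤ.+ 1 / 4
  9/5 = ℤ.+ 9 / 5
  ∣x-y∣ = ℚ.∣ x ℚ.- y ∣
  e u rest : ℚ
  e = y ℚ.- 9/5
  u = x ℚ.+ ℚ.½ ℚ.* (y ℚ.- 1ℚ)
  rest = u ℚ.* u ℚ.+ ((ℤ.+ 3 / 4) ℚ.* (e ℚ.* e) ℚ.+ ((ℤ.+ 11 / 5) ℚ.* e ℚ.+ (ℤ.+ 3 / 100)))
  W = ¼ ℚ.+ rest
  0≤e : 0ℚ ℚ.≤ e
  0≤e = subst (ℚ._≤ e) (ℚ.+-inverseʳ 9/5) (ℚ.+-monoˡ-≤ (ℚ.- 9/5) 9/5≤y)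
  0≤c* : ∀ c {t} .{{_ : ℚ.NonNegative c}} → 0ℚ ℚ.≤ t → 0ℚ ℚ.≤ c ℚ.* t
  0≤c* c {t} 0≤t = subst (ℚ._≤ c ℚ.* t) (ℚ.*-zeroʳ c) (ℚ.*-monoˡ-≤-nonNeg c 0≤t)
  0≤rest : 0ℚ ℚ.≤ rest
  0≤rest = ℚ.+-mono-≤ (square-nonNeg u)
    (ℚ.+-mono-≤ (0≤c* (ℤ.+ 3 / 4) (square-nonNeg e))
      (ℚ.+-mono-≤ (0≤c* (ℤ.+ 11 / 5) 0≤e) (ℚ.nonNegative⁻¹ (ℤ.+ 3 / 100))))
  ¼≤W : ¼ ℚ.≤ W
  ¼≤W = subst (ℚ._≤ W) (ℚ.+-identityʳ ¼) (ℚ.+-monoʳ-≤ ¼ 0≤rest)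
  0≤W : 0ℚ ℚ.≤ W
  0≤W = ℚ.≤-trans (ℚ.nonNegative⁻¹ ¼) ¼≤W
  factor : ∀ x y → f x ℚ.- f y ≡
    (¼ ℚ.+ ((x ℚ.+ ℚ.½ ℚ.* (y ℚ.- 1ℚ)) ℚ.* (x ℚ.+ ℚ.½ ℚ.* (y ℚ.- 1ℚ)) ℚ.+
      ((ℤ.+ 3 / 4) ℚ.* ((y ℚ.- 9/5) ℚ.* (y ℚ.- 9/5)) ℚ.+ ((ℤ.+ 11 / 5) ℚ.* (y ℚ.- 9/5) ℚ.+ (ℤ.+ 3 / 100)))))
    ℚ.* (x ℚ.- y)
  factor = solve 2 (λ x y →
    let f′ = λ x → x :* (x :* (x :* con 1ℚ)) :- x :* (x :* con 1ℚ) :- x :- con 1ℚ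
        u = x :+ con ℚ.½ :* (y :- con 1ℚ)
        e = y :- con 9/5
    in f′ x :- f′ y :=
       (con ¼ :+ (u :* u :+ (con (ℤ.+ 3 / 4) :* (e :* e) :+ (con (ℤ.+ 11 / 5) :* e :+ con (ℤ.+ 3 / 100)))))
       :* (x :- y)) refl

-- This yields both the Cauchy property of the ratios and the uniqueness of the zero. For the latter
-- `x` must be unrestricted, so only `y` is bounded below.
f-small⇒close : ∀ {ε} x y → ℤ.+ 9 / 5 ℚ.≤ y → let δ = (ℤ.+ 1 / 8) ℚ.* ε in
                ℚ.∣ f x ∣ ℚ.< δ → ℚ.∣ f y ∣ ℚ.< δ → ℚ.∣ x ℚ.- y ∣ ℚ.< ε
f-small⇒close {ε} x y 9/5≤y fx< fy< = begin-strict
  ℚ.∣ x ℚ.- y ∣                          ≤⟨ ∣x-y∣≤4∣fx-fy∣ x y 9/5≤y ⟩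
  ι 4 ℚ.* ℚ.∣ f x ℚ.- f y ∣              ≤⟨ ℚ.*-monoˡ-≤-nonNeg (ι 4) (ℚ.∣p-q∣≤∣p∣+∣q∣ (f x) (f y)) ⟩
  ι 4 ℚ.* (ℚ.∣ f x ∣ ℚ.+ ℚ.∣ f y ∣)      <⟨ ℚ.*-monoʳ-<-pos (ι 4) (ℚ.+-mono-< fx< fy<) ⟩
  ι 4 ℚ.* (δ ℚ.+ δ)                      ≡⟨ identity ε ⟩
  ε                                      ∎
  where
  open ℚ.≤-Reasoning
  open ℚ-Solver.+-*-Solver
  δ = (ℤ.+ 1 / 8) ℚ.* ε
  identity : ∀ ε → ι 4 ℚ.* ((ℤ.+ 1 / 8) ℚ.* ε ℚ.+ (ℤ.+ 1 / 8) ℚ.* ε) ≡ ε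
  identity = solve 1 (λ ε → con (ι 4) :* (con (ℤ.+ 1 / 8) :* ε :+ con (ℤ.+ 1 / 8) :* ε) := ε) refl

eighth-pos : ∀ {ε} → 0ℚ ℚ.< ε → 0ℚ ℚ.< (ℤ.+ 1 / 8) ℚ.* ε
eighth-pos = 0<* (ℚ.positive⁻¹ (ℤ.+ 1 / 8))

-- The zero ψ as the limit of the ratios of P

abstract
  -- Abstract, so that type checking never normalises these quotients; `ratio-*` characterises them.
  ratio : ℕ → ℚ
  ratio n = (p (1 + n) / P n) {{P≢0 n}}

  ratio-* : ∀ n → ratio n ℚ.* ι (P n) ≡ ι (P (1 + n))
  ratio-* n = /-* (p (1 + n)) (P n) {{P≢0 n}}

9/5≤ratio : ∀ n → ℤ.+ 9 / 5 ℚ.≤ ratio n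
9/5≤ratio n = fraction-≤ (ℤ.+ 9 / 5) (ratio n) 9 5 (P (1 + n)) (P n) {{_}} {{P≢0 n}} (/-* (ℤ.+ 9) 5) (ratio-* n) (9P≤5P n)

-- Multiplication by (P n)³ clears denominators and leaves the integer bounded in `cubic≤` by 3 (P
-- n)²; two factors P n cancel.
∣f-ratio∣≤ : ∀ n → ℚ.∣ f (ratio n) ∣ ℚ.* ι (P n) ℚ.≤ ι 3
∣f-ratio∣≤ n = cancel-≤ (a ℚ.* a) (0<* 0<a 0<a) (begin
  ℚ.∣ f x ∣ ℚ.* a ℚ.* (a ℚ.* a)       ≡⟨ ℚ.*-assoc ℚ.∣ f x ∣ a (a ℚ.* a) ⟩
  ℚ.∣ f x ∣ ℚ.* (a ℚ.* (a ℚ.* a))     ≡⟨ cong (ℚ.∣ f x ∣ ℚ.*_) (ℚ.0≤p⇒∣p∣≡p (ℚ.<⇒≤ (0<* 0<a (0<* 0<a 0<a)))) ⟨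
  ℚ.∣ f x ∣ ℚ.* ℚ.∣ a ℚ.* (a ℚ.* a) ∣ ≡⟨ ℚ.∣p*q∣≡∣p∣*∣q∣ (f x) _ ⟨
  ℚ.∣ f x ℚ.* (a ℚ.* (a ℚ.* a)) ∣     ≡⟨ cong ℚ.∣_∣ (homogenise x a) ⟩
  ℚ.∣ F (x ℚ.* a) a ∣                 ≡⟨ cong (λ t → ℚ.∣ F t a ∣) (ratio-* n) ⟩
  ℚ.∣ F b a ∣                         ≡⟨ cong ℚ.∣_∣ F≡ ⟨
  ℚ.∣ fromℤ N ∣                       ≡⟨ fromℤ-abs N ⟩
  ι ℤ.∣ N ∣                           ≤⟨ ι-mono (cubic≤ n) ⟩
  ι (3 * (P n * P n))                 ≡⟨ trans (ι-* 3 (P n * P n)) (cong (ι 3 ℚ.*_) (ι-* (P n) (P n))) ⟩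
  ι 3 ℚ.* (a ℚ.* a)                   ∎)
  where
  open ℚ.≤-Reasoning
  open ℚ-Solver.+-*-Solver
  x = ratio n
  a = ι (P n)
  b = ι (P (1 + n))
  0<a : 0ℚ ℚ.< a
  0<a = ι-pos (P n) {{P≢0 n}}
  F : ℚ → ℚ → ℚ
  F b a = b ℚ.* b ℚ.* b ℚ.- b ℚ.* b ℚ.* a ℚ.- b ℚ.* a ℚ.* a ℚ.- a ℚ.* a ℚ.* a
  homogenise : ∀ x a → f x ℚ.* (a ℚ.* (a ℚ.* a)) ≡ F (x ℚ.* a) a
  homogenise = solve 2 (λ x a →
    (x :* (x :* (x :* con 1ℚ)) :- x :* (x :* con 1ℚ) :- x :- con 1ℚ) :* (a :* (a :* a)) :=
    (let b = x :* a in b :* b :* b :- b :* b :* a :- b :* a :* a :- a :* a :* a)) refl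
  i = p n
  j = p (1 + n)
  N : ℤ
  N = j ℤ.* j ℤ.* j ℤ.- j ℤ.* j ℤ.* i ℤ.- j ℤ.* i ℤ.* i ℤ.- i ℤ.* i ℤ.* i
  cube : ∀ i j k → fromℤ (i ℤ.* j ℤ.* k) ≡ fromℤ i ℚ.* fromℤ j ℚ.* fromℤ k
  cube i j k = trans (fromℤ-* (i ℤ.* j) k) (cong (ℚ._* fromℤ k) (fromℤ-* i j))
  F≡ : fromℤ N ≡ F b a
  F≡ = trans (fromℤ-- (j ℤ.* j ℤ.* j ℤ.- j ℤ.* j ℤ.* i ℤ.- j ℤ.* i ℤ.* i) (i ℤ.* i ℤ.* i))
    (cong₂ ℚ._-_ (trans (fromℤ-- (j ℤ.* j ℤ.* j ℤ.- j ℤ.* j ℤ.* i) (j ℤ.* i ℤ.* i))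
      (cong₂ ℚ._-_ (trans (fromℤ-- (j ℤ.* j ℤ.* j) (j ℤ.* j ℤ.* i))
        (cong₂ ℚ._-_ (cube j j j) (cube j j i))) (cube j i i))) (cube i i i))

f-ratio→0 : ∀ ε → 0ℚ ℚ.< ε → ∃[ N ] ∀ n → N ≤ n → ℚ.∣ f (ratio n) ∣ ℚ.< ε
f-ratio→0 ε 0<ε with N , h ← archimedean 3 ε 0<ε = N , λ n N≤n →
  cancel-< {ℚ.∣ f (ratio n) ∣} {ε} (ι (P n)) (ι-pos (P n) {{P≢0 n}})
    (ℚ.≤-<-trans (∣f-ratio∣≤ n) (h (P n) (≤-trans N≤n (<⇒≤ (n<P n)))))

ψ : ℝ
ψ = mkℝ ratio λ ε 0<ε →
  let N , h = f-ratio→0 _ (eighth-pos 0<ε)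
  in N , λ m n N≤m N≤n → f-small⇒close (ratio m) (ratio n) (9/5≤ratio n) (h m N≤m) (h n N≤n)

∣q-0∣≡∣q∣ : ∀ q → ℚ.∣ q ℚ.- 0ℚ ∣ ≡ ℚ.∣ q ∣
∣q-0∣≡∣q∣ q = cong ℚ.∣_∣ (ℚ.+-identityʳ q)

ψ-zero : IsTheZeroOf (λ X → X ^ℝ 3 -ℝ X ^ℝ 2 -ℝ X -ℝ 1ℝ) ψ
ψ-zero = (λ ε 0<ε → let N , h = f-ratio→0 ε 0<ε in
            N , λ n N≤n → subst (ℚ._< ε) (sym (∣q-0∣≡∣q∣ (f (ratio n)))) (h n N≤n)) ,
  λ y fy≃0 ε 0<ε →
    let M , hy = fy≃0 _ (eighth-pos 0<ε)
        N , hψ = f-ratio→0 _ (eighth-pos 0<ε)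
    in M ⊔ N , λ n n≥ → f-small⇒close (seq y n) (ratio n) (9/5≤ratio n)
         (subst (ℚ._< _) (∣q-0∣≡∣q∣ (f (seq y n))) (hy n (m⊔n≤o⇒m≤o M N n≥)))
         (hψ n (m⊔n≤o⇒n≤o M N n≥))

½≤ratio-1 : ∀ n → ℚ.½ ℚ.≤ ratio n ℚ.- 1ℚ
½≤ratio-1 n = ℚ.≤-trans (ℚ.*≤* (ℤ.+≤+ (m≤m+n 5 3))) (ℚ.+-monoˡ-≤ (ℚ.- 1ℚ) (9/5≤ratio n))

ψ-1#0 : (ψ -ℝ 1ℝ) #ℝ 0ℝ
ψ-1#0 = inj₂ (ℚ.½ , ℚ.positive⁻¹ ℚ.½ , 0 , λ n _ →
  subst (ℚ._≤ ratio n ℚ.- 1ℚ) (sym (ℚ.+-identityˡ ℚ.½)) (½≤ratio-1 n))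

c : ℝ
c = fromℚ (ℤ.+ 2 / 1) +ℝ invℝ (ψ -ℝ 1ℝ) ψ-1#0

-- Termwise, ψ - 1 is Q n / P n, which is at least ½ and so truly inverted by `inv₀`. The
-- approximations to `c` are therefore exactly K n / Q n.
c-* : ∀ n → seq c n ℚ.* ι (Q n) ≡ ι (K n)
c-* n = begin
  (ι 2 ℚ.+ inv₀ x) ℚ.* ι (Q n)                    ≡⟨ ℚ.*-distribʳ-+ (ι (Q n)) (ι 2) (inv₀ x) ⟩
  ι 2 ℚ.* ι (Q n) ℚ.+ inv₀ x ℚ.* ι (Q n)          ≡⟨ cong₂ ℚ._+_ (sym (ι-* 2 (Q n))) inv₀*Q ⟩
  ι (2 * Q n) ℚ.+ ι (P n)                         ≡⟨ ι-+ (2 * Q n) (P n) ⟨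
  ι (2 * Q n + P n)                               ≡⟨ cong ι (+-comm (2 * Q n) (P n)) ⟩
  ι (K n)                                         ∎
  where
  open ≡-Reasoning
  open ℚ-Solver.+-*-Solver
  x = ratio n ℚ.- 1ℚ
  a = ι (P n)
  expand : ∀ r a → (r ℚ.- 1ℚ) ℚ.* a ≡ r ℚ.* a ℚ.- a
  expand = solve 2 (λ r a → (r :- con 1ℚ) :* a := r :* a :- a) refl
  cancel : ∀ a q → a ℚ.+ q ℚ.- a ≡ q
  cancel = solve 2 (λ a q → a :+ q :- a := q) refl
  regroup : ∀ i x a → i ℚ.* (x ℚ.* a) ≡ x ℚ.* i ℚ.* a
  regroup = solve 3 (λ i x a → i :* (x :* a) := x :* i :* a) refl
  x*a : x ℚ.* a ≡ ι (Q n)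
  x*a = begin
    x ℚ.* a                       ≡⟨ expand (ratio n) a ⟩
    ratio n ℚ.* a ℚ.- a           ≡⟨ cong (ℚ._- a) (ratio-* n) ⟩
    ι (P (1 + n)) ℚ.- a           ≡⟨ cong (λ t → ι t ℚ.- a) (P-suc n) ⟩
    ι (P n + Q n) ℚ.- a           ≡⟨ cong (ℚ._- a) (ι-+ (P n) (Q n)) ⟩
    a ℚ.+ ι (Q n) ℚ.- a           ≡⟨ cancel a (ι (Q n)) ⟩
    ι (Q n)                       ∎
  x≢0 : x ≢ 0ℚ
  x≢0 x≡0 = ℚ.<-irrefl refl (ℚ.<-≤-trans (ℚ.positive⁻¹ ℚ.½) (subst (ℚ.½ ℚ.≤_) x≡0 (½≤ratio-1 n)))
  inv₀*Q : inv₀ x ℚ.* ι (Q n) ≡ a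
  inv₀*Q = begin
    inv₀ x ℚ.* ι (Q n)      ≡⟨ cong (inv₀ x ℚ.*_) x*a ⟨
    inv₀ x ℚ.* (x ℚ.* a)    ≡⟨ regroup (inv₀ x) x a ⟩
    x ℚ.* inv₀ x ℚ.* a      ≡⟨ cong (ℚ._* a) (inv₀-inverse x x≢0) ⟩
    1ℚ ℚ.* a                ≡⟨ ℚ.*-identityˡ a ⟩
    a                       ∎

-- Comparison of exponents with the limit

eventually : ∀ {R : ℕ → Set} n → (∀ k → R (k + n)) → ∀ m → n ≤ m → R m
eventually {R} n h m n≤m = subst R (m∸n+n≡m n≤m) (h (m ∸ n))

≤+ε : ∀ {a b ε} → 0ℚ ℚ.< ε → a ℚ.≤ b → a ℚ.≤ b ℚ.+ ε
≤+ε {b = b} 0<ε a≤b = ℚ.≤-trans a≤b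
  (subst (ℚ._≤ b ℚ.+ _) (ℚ.+-identityʳ b) (ℚ.+-monoʳ-≤ b (ℚ.<⇒≤ 0<ε)))

fromℚ≤c : ∀ r a b .{{_ : NonZero b}} → r ℚ.* ι b ≡ ι a → ∀ n →
          (∀ k → a * Q (k + n) ≤ b * K (k + n)) → fromℚ r ≤ℝ c
fromℚ≤c r a b {{b≢0}} rb≡a n le ε 0<ε = n , λ m n≤m →
  ≤+ε 0<ε (fraction-≤ r (seq c m) a b (K m) (Q m) {{b≢0}} {{Q≢0 m}} rb≡a (c-* m)
            (eventually {λ m → a * Q m ≤ b * K m} n le m n≤m))

exponent≤c : ∀ w q → IsFactorOf w 𝐁 → (per : HasPeriod w q) →
             fromℚ (ℚ._/_ (ℤ.+ length w) q {{proj₁ per}}) ≤ℝ c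
exponent≤c w q fac per =
  let n , le = exponent≤ {w} {q} fac per
  in fromℚ≤c (ℚ._/_ (ℤ.+ length w) q {{proj₁ per}}) (length w) q {{proj₁ per}}
       (/-* (ℤ.+ length w) q {{proj₁ per}}) n le

-- The surplus 8 contributes 8 / d to the quotient, less than δ by assumption.
c≤exponent+ : ∀ l d n δ .{{_ : NonZero d}} → ι 8 ℚ.< δ ℚ.* ι d →
  (∀ k → d * K (k + n) ≤ (l + 8) * Q (k + n)) → ∀ m → n ≤ m → seq c m ℚ.≤ (ℤ.+ l / d) ℚ.+ δ
c≤exponent+ l d n δ 8< le m n≤m = cancel-≤ (ι d ℚ.* ι (Q m)) (0<* (ι-pos d) (ι-pos (Q m) {{Q≢0 m}})) (begin
  seq c m ℚ.* (ι d ℚ.* ι (Q m))             ≡⟨ swap (seq c m) (ι d) (ι (Q m)) ⟩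
  ι d ℚ.* (seq c m ℚ.* ι (Q m))             ≡⟨ cong (ι d ℚ.*_) (c-* m) ⟩
  ι d ℚ.* ι (K m)                           ≡⟨ ι-* d (K m) ⟨
  ι (d * K m)                               ≤⟨ ι-mono (eventually {λ m → d * K m ≤ (l + 8) * Q m} n le m n≤m) ⟩
  ι ((l + 8) * Q m)                         ≡⟨ trans (ι-* (l + 8) (Q m)) (cong (ℚ._* ι (Q m)) (ι-+ l 8)) ⟩
  (ι l ℚ.+ ι 8) ℚ.* ι (Q m)                 ≤⟨ scale-≤ (ι (Q m)) (ι-mono z≤n) (ℚ.+-monoʳ-≤ (ι l) (ℚ.<⇒≤ 8<)) ⟩
  (ι l ℚ.+ δ ℚ.* ι d) ℚ.* ι (Q m)           ≡⟨ cong (λ t → (t ℚ.+ δ ℚ.* ι d) ℚ.* ι (Q m)) (/-* (ℤ.+ l) d) ⟨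
  (q ℚ.* ι d ℚ.+ δ ℚ.* ι d) ℚ.* ι (Q m)     ≡⟨ cong (ℚ._* ι (Q m)) (ℚ.*-distribʳ-+ (ι d) q δ) ⟨
  (q ℚ.+ δ) ℚ.* ι d ℚ.* ι (Q m)             ≡⟨ ℚ.*-assoc (q ℚ.+ δ) (ι d) (ι (Q m)) ⟩
  (q ℚ.+ δ) ℚ.* (ι d ℚ.* ι (Q m))           ∎)
  where
  open ℚ.≤-Reasoning
  open ℚ-Solver.+-*-Solver
  q = ℤ.+ l / d
  swap : ∀ c d q → c ℚ.* (d ℚ.* q) ≡ d ℚ.* (c ℚ.* q)
  swap = solve 3 (λ c d q → c :* (d :* q) := d :* (c :* q)) refl

half-gap : ∀ y ε z q → y ℚ.+ ε ℚ.≤ z → z ℚ.≤ q ℚ.+ ℚ.½ ℚ.* ε → y ℚ.+ ℚ.½ ℚ.* ε ℚ.≤ q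
half-gap y ε z q y+ε≤z z≤q = begin
  y ℚ.+ δ                  ≡⟨ cancel y δ ⟩
  y ℚ.+ (δ ℚ.+ δ) ℚ.- δ    ≡⟨ cong (λ t → y ℚ.+ t ℚ.- δ) (half+half ε) ⟩
  y ℚ.+ ε ℚ.- δ            ≤⟨ ℚ.+-monoˡ-≤ (ℚ.- δ) (ℚ.≤-trans y+ε≤z z≤q) ⟩
  q ℚ.+ δ ℚ.- δ            ≡⟨ cancel′ q δ ⟩
  q                        ∎
  where
  open ℚ.≤-Reasoning
  open ℚ-Solver.+-*-Solver
  δ = ℚ.½ ℚ.* ε
  cancel : ∀ y h → y ℚ.+ h ≡ y ℚ.+ (h ℚ.+ h) ℚ.- h
  cancel = solve 2 (λ y h → y :+ h := y :+ (h :+ h) :- h) refl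
  cancel′ : ∀ y h → y ℚ.+ h ℚ.- h ≡ y
  cancel′ = solve 2 (λ y h → y :+ h :- h := y) refl

/-antimono : ∀ l d e .{{_ : NonZero d}} .{{_ : NonZero e}} → e ≤ d → ℤ.+ l / d ℚ.≤ ℤ.+ l / e
/-antimono l d e e≤d = fraction-≤ (ℤ.+ l / d) (ℤ.+ l / e) l d l e (/-* (ℤ.+ l) d) (/-* (ℤ.+ l) e)
  (≤-trans (*-monoʳ-≤ l e≤d) (≤-reflexive (*-comm l d)))

c-approximate : ∀ y → y <ℝ c → ∃[ q ] IsExpOfFactor 𝐁 q × y <ℝ fromℚ q
c-approximate y (ε , 0<ε , N , y+ε≤c) =
  -- Half of ε pays for the loss 8 / d of a repetition with period d at least `J`; the other half
  -- witnesses the strict inequality.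
  let J , 8< = archimedean 8 (ℚ.½ ℚ.* ε) (half-pos 0<ε)
      w , d , fac , per , J≤d , d≤w , n , le = exponent≥ J
  in from w d n fac per d≤w (8< d J≤d) le (smallest-period {w} per)
  where
  from : ∀ w d n → IsFactorOf w 𝐁 → HasPeriod w d → d ≤ length w → ι 8 ℚ.< (ℚ.½ ℚ.* ε) ℚ.* ι d →
    (∀ k → d * K (k + n) ≤ (length w + 8) * Q (k + n)) → (∃[ e ] e ≤ d × IsPer w e) →
    ∃[ q ] IsExpOfFactor 𝐁 q × y <ℝ fromℚ q
  from w d n fac (d≢0 , _) d≤w 8< le (e , e≤d , per) =
    q , (w , w≢[] , fac , e , per , refl) ,
    ℚ.½ ℚ.* ε , half-pos 0<ε , N ⊔ n , λ m m≥ →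
      half-gap (seq y m) ε (seq c m) q (y+ε≤c m (m⊔n≤o⇒m≤o N n m≥)) (ℚ.≤-trans
        (c≤exponent+ (length w) d n (ℚ.½ ℚ.* ε) {{d≢0}} 8< le m (m⊔n≤o⇒n≤o N n m≥))
        (ℚ.+-monoˡ-≤ (ℚ.½ ℚ.* ε) (/-antimono (length w) d e {{d≢0}} {{e≢0}} e≤d)))
    where
    e≢0 = proj₁ (IsPer.period per)
    q = ℚ._/_ (ℤ.+ length w) e {{e≢0}}
    w≢[] : w ≢ []
    w≢[] refl = <⇒≱ (>-nonZero⁻¹ d {{d≢0}}) d≤w

critical-exponent : IsCriticalExponent 𝐁 c
critical-exponent = record
  { upperBound  = λ { _ (w , _ , fac , d , per , refl) → exponent≤c w d fac (IsPer.period per) }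
  ; approximate = c-approximate
  }

c-lower : fromℚ (ℤ.+ 319148788395 / 100000000000) ≤ℝ c
c-lower = fromℚ≤c (ℤ.+ 319148788395 / 100000000000) 319148788395 100000000000
  (/-* (ℤ.+ 319148788395) 100000000000) 32 K/Q≥

-- `K/Q≤` has two more decimals than the bound and stays 10⁻¹³ below it; this margin serves as `ε`.
c-upper : c <ℝ fromℚ (ℤ.+ 319148788396 / 100000000000)
c-upper = ε , ℚ.positive⁻¹ ε , 32 , λ m 32≤m →
  fraction-≤ (seq c m ℚ.+ ε) (ℤ.+ 319148788396 / 100000000000) (K m * 10000000000000 + Q m) (Q m * 10000000000000) 319148788396 100000000000
    {{m*n≢0 (Q m) 10000000000000 {{Q≢0 m}}}}
    (sum m) (/-* (ℤ.+ 319148788396) 100000000000)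
    (begin
      (K m * (100 * 100000000000) + Q m) * 100000000000
        ≡⟨ cong (λ t → (t + Q m) * 100000000000) (*-comm (K m) (100 * 100000000000)) ⟩
      (10000000000000 * K m + Q m) * 100000000000
        ≤⟨ *-monoˡ-≤ 100000000000 (+-monoˡ-≤ (Q m)
             (eventually {λ m → 10000000000000 * K m ≤ 31914878839599 * Q m} 32 K/Q≤ m 32≤m)) ⟩
      (31914878839599 * Q m + Q m) * 100000000000
        ≡⟨ cong (_* 100000000000) (+-comm (31914878839599 * Q m) (Q m)) ⟩
      100 * 319148788396 * Q m * 100000000000
        ≡⟨ regroup 100 319148788396 (Q m) 100000000000 ⟩
      Q m * (100 * 100000000000) * 319148788396 ∎)
  where
  open ≤-Reasoning
  ε : ℚ
  ε = ℤ.+ 1 / 10000000000000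
  regroup : ∀ a b q v → a * b * q * v ≡ q * (a * v) * b
  regroup = solve-∀
  sum : ∀ m → (seq c m ℚ.+ ε) ℚ.* ι (Q m * 10000000000000) ≡ ι (K m * 10000000000000 + Q m)
  sum m = trans (cong ((seq c m ℚ.+ ε) ℚ.*_) (ι-* (Q m) 10000000000000))
    (trans (expand (seq c m) ε (ι (Q m)) (ι 10000000000000))
    (trans (cong₂ (λ s t → s ℚ.* ι 10000000000000 ℚ.+ t ℚ.* ι (Q m)) (c-* m) (/-* (ℤ.+ 1) 10000000000000))
    (trans (cong₂ ℚ._+_ (sym (ι-* (K m) 10000000000000)) (ℚ.*-identityˡ (ι (Q m))))
           (sym (ι-+ (K m * 10000000000000) (Q m))))))
    where
    open ℚ-Solver.+-*-Solver
    expand : ∀ s t q v → (s ℚ.+ t) ℚ.* (q ℚ.* v) ≡ s ℚ.* q ℚ.* v ℚ.+ t ℚ.* v ℚ.* q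
    expand = solve 4 (λ s t q v → (s :+ t) :* (q :* v) := s :* q :* v :+ t :* v :* q) refl

open import Data.Integer using (+_)

theorem6 : ∃[ ψ ] IsTheZeroOf (λ X → X ^ℝ 3 -ℝ X ^ℝ 2 -ℝ X -ℝ 1ℝ) ψ ×
    ∃ λ (ψ-1#0 : (ψ -ℝ 1ℝ) #ℝ 0ℝ) →
    let c = fromℚ (+ 2 / 1) +ℝ invℝ (ψ -ℝ 1ℝ) ψ-1#0 in
    IsCriticalExponent 𝐁 c ×
    fromℚ (+ 319148788395 / 100000000000) ≤ℝ c ×
    c <ℝ fromℚ (+ 319148788396 / 100000000000)
theorem6 = ψ , ψ-zero , ψ-1#0 , critical-exponent , c-lower , c-upper
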